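{- Let $\mathrm{M}$ be the submodule of $\mathbf{Z}^{(\mathcal{B})}$ consisting of those $\ell$ such that $\zeta(\ell)_{n,n}=0$ for all integers $n\geqslant 0$. Then $\mathrm{M}$ is the kernel of $\delta:\mathbf{Z}^{(\mathcal{B})}\to\mathbf{Z}^{(\mathcal{A})}$.
   Context: A composition is a finite sequence $\mathbf{a}=(a_1,\ldots,a_r)$ of positive integers ($r\geqslant 0$), of depth $r$ and weight $|\mathbf{a}|=\sum a_i$; it is admissible if $r=0$ or $a_1\geqslant 2$. $\mathcal{A}$ (resp. $\mathcal{A}_k$) is the set of admissible compositions (resp. of weight $k$). Binary word: $\mathbf{w}(\mathbf{a})=0^{a_1-1}1\cdots0^{a_r-1}1$. The dual of a word $\varepsilon_1\cdots\varepsilon_k$ is $\overline{\varepsilon_k}\cdots\overline{\varepsilon_1}$ ($\overline0=1,\overline1=0$); for admissible $\mathbf{a}$, $\overline{\mathbf{a}}$ is the admissible composition with word dual to $\mathbf{w}(\mathbf{a})$. $\mathcal{B}$ is $\mathcal{A}$ modulo $\mathbf{a}\sim\overline{\mathbf{a}}$, classes $[\mathbf{a}]$, $\mathcal{B}_k$ classes of weight $k$; $\mathbf{Z}^{(X)}$ is the free $\mathbf{Z}$-module on $X$. For a composition, $(a_1,\ldots,a_r)^{\rm init}=(a_1,\ldots,a_{r-1})$ ($\varnothing^{\rm init}=\varnothing$); for admissible $\mathbf{a}$, $\mathbf{a}^{\rm fin}$ is the dual of $(\overline{\mathbf{a}})^{\rm init}$ and $\mathbf{a}^{\rm mid}=(\mathbf{a}^{\rm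 fin})^{\rm init}$; extended $\mathbf{Z}$-linearly. $\delta$ is the unique $\mathbf{Z}$-linear map $\mathbf{Z}^{(\mathcal{B})}\to\mathbf{Z}^{(\mathcal{A})}$ with $\delta(\mathbf{Z}^{\mathcal{B}_k})\subset\mathbf{Z}^{\mathcal{A}_k}$ for all $k$, $\delta([\varnothing])=\varnothing$, and $\delta([\mathbf{a}])^{\rm init}=\delta([\mathbf{a}^{\rm init}])+\delta([\mathbf{a}^{\rm mid}])+\delta([\mathbf{a}^{\rm fin}])$ for all non-empty admissible $\mathbf{a}$. For non-empty admissible $\mathbf{a}$ and $n\geqslant0$, $\zeta(\mathbf{a})_{n,n}=\sum_{n_1>\cdots>n_r>n}\binom{n_1+n}{n}^{ -1}n_1^{ -a_1}\cdots n_r^{ -a_r}$, and $\zeta(\varnothing)_{n,n}=\binom{2n}{n}^{ -1}$; since $\zeta(\mathbf{a})_{n,n}=\zeta(\overline{\mathbf{a}})_{n,n}$, this defines a $\mathbf{Z}$-linear map $\ell\mapsto\zeta(\ell)_{n,n}$ on $\mathbf{Z}^{(\mathcal{B})}$. -}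

module Defs where

open import Data.Nat as ℕ using (ℕ; zero; suc; _∸_; _<ᵇ_)
open import Data.Nat.Combinatorics using (_C_)
open import Data.Nat.Properties using (_≟_)
open import Data.Bool using (Bool; true; false; not; if_then_else_)
open import Data.List using (List; []; _∷_; _++_; map; reverse; concatMap; replicate)
open import Data.Nat.ListAction using (sum)
open import Data.List.Properties using (≡-dec)
open import Data.Integer as ℤ using (ℤ; +_)
open import Data.Rational as ℚ using (ℚ; 0ℚ; 1ℚ)
open import Data.Product using (_×_; _,_)
open import Relation.Nullary.Decidable using (does)

-- Compositions: lists of natural numbers (entries are meant to be ≥ 1).

Comp : Set
Comp = List ℕ

data Positive : Comp → Set where
  []  : Positive []
  _∷_ : ∀ {a as} → 1 ℕ.≤ a → Positive as → Positive (a ∷ as)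

data Admissible : Comp → Set where
  adm-[] : Admissible []
  adm-∷  : ∀ {a as} → 2 ℕ.≤ a → Positive as → Admissible (a ∷ as)

weight : Comp → ℕ
weight = sum

-- binary word w(a) = 0^{a₁-1} 1 ⋯ 0^{a_r-1} 1   (false = 0, true = 1)
word : Comp → List Bool
word = concatMap (λ a → replicate (a ∸ 1) false ++ (true ∷ []))

dualWord : List Bool → List Bool
dualWord w = map not (reverse w)

fromWord′ : ℕ → List Bool → Comp
fromWord′ c []            = []
fromWord′ c (false ∷ w)   = fromWord′ (suc c) w
fromWord′ c (true ∷ w)    = suc c ∷ fromWord′ 0 w

fromWord : List Bool → Comp
fromWord = fromWord′ 0

dual : Comp → Comp
dual a = fromWord (dualWord (word a))

init : Comp → Comp
init []           = []
init (a ∷ [])     = []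
init (a ∷ b ∷ as) = a ∷ init (b ∷ as)

fin : Comp → Comp
fin a = dual (init (dual a))

mid : Comp → Comp
mid a = init (fin a)

-- Formal ℤ-linear combinations of compositions (elements of ℤ^(𝒜);
-- elements of ℤ^(ℬ) are represented by combinations of representatives).

FSum : Set
FSum = List (ℤ × Comp)

scale : ℤ → FSum → FSum
scale c = map (λ { (d , b) → (c ℤ.* d , b) })

coeff : Comp → FSum → ℤ
coeff b []             = + 0
coeff b ((c , b′) ∷ s) =
  (if does (≡-dec _≟_ b b′) then c else + 0) ℤ.+ coeff b s

-- extend a composition of weight < k to weight k: b ↦ (b, k - |b|);
-- this is the inverse of (·)^init on 𝒜_k.
extend : ℕ → Comp → Comp
extend k b = b ++ ((k ∸ weight b) ∷ [])

-- δ on a representative, with fuel (fuel ≥ weight suffices: the weights of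
-- a^init, a^mid, a^fin are strictly smaller than the weight of a ≠ ∅).
-- It solves δ([a]) ∈ ℤ^{𝒜_k}, δ([a])^init = δ([a^init]) + δ([a^mid]) + δ([a^fin]).
δ′ : ℕ → Comp → FSum
δ′ _       []       = (+ 1 , []) ∷ []
δ′ zero    (_ ∷ _)  = []
δ′ (suc f) a@(_ ∷ _) =
  map (λ { (c , b) → (c , extend (weight a) b) })
      (δ′ f (init a) ++ δ′ f (mid a) ++ δ′ f (fin a))

δ₀ : Comp → FSum
δ₀ a = δ′ (weight a) a

δ : FSum → FSum
δ []            = []
δ ((c , a) ∷ ℓ) = scale c (δ₀ a) ++ δ ℓ

InKerδ : FSum → Set
InKerδ ℓ = ∀ (b : Comp) → coeff b (δ ℓ) ≡ + 0
  where open import Relation.Binary.PropositionalEquality using (_≡_)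

-- 1/m as a rational (only used for m ≥ 1)
recip : ℕ → ℚ
recip zero    = 0ℚ
recip (suc m) = (+ 1) ℚ./ suc m

sumTo : ℕ → (ℕ → ℚ) → ℚ
sumTo zero    f = 0ℚ
sumTo (suc m) f = sumTo m f ℚ.+ f m

sumBetween : ℕ → ℕ → (ℕ → ℚ) → ℚ
sumBetween n m f = sumTo m (λ j → if n <ᵇ j then f j else 0ℚ)

inner : Comp → ℕ → ℕ → ℚ
inner []       n m = 1ℚ
inner (a ∷ as) n m = sumBetween n m (λ j → recip (j ℕ.^ a) ℚ.* inner as n j)

-- partial sum of ζ(a)_{n,n} with n₁ ≤ N:
--   Σ_{N ≥ n₁ > ⋯ > n_r > n} binom(n₁+n,n)^{-1} n₁^{-a₁} ⋯ n_r^{-a_r},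
-- and ζ(∅)_{n,n} = binom(2n,n)^{-1}.
ζpart : Comp → ℕ → ℕ → ℚ
ζpart []       n N = recip ((n ℕ.+ n) C n)
ζpart (a ∷ as) n N =
  sumBetween n (suc N)
    (λ n₁ → recip ((n₁ ℕ.+ n) C n) ℚ.* recip (n₁ ℕ.^ a) ℚ.* inner as n n₁)

ζpartL : FSum → ℕ → ℕ → ℚ
ζpartL []            n N = 0ℚ
ζpartL ((c , a) ∷ ℓ) n N = (c ℚ./ 1) ℚ.* ζpart a n N ℚ.+ ζpartL ℓ n N

ζnnVanishes : FSum → ℕ → Set
ζnnVanishes ℓ n =
  ∀ (ε : ℚ) → 0ℚ ℚ.< ε →
    Σ ℕ (λ N₀ → ∀ (N : ℕ) → N₀ ℕ.≤ N → ℚ.∣ ζpartL ℓ n N ∣ ℚ.< ε)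
  where open import Data.Product using (Σ)

InM : FSum → Set
InM ℓ = ∀ (n : ℕ) → ζnnVanishes ℓ n

data AllAdmissible : FSum → Set where
  []  : AllAdmissible []
  _∷_ : ∀ {c a ℓ} → Admissible a → AllAdmissible ℓ → AllAdmissible ((c , a) ∷ ℓ)

{-# OPTIONS --safe #-}
module Submission where

-- Write ζ(a)_{m,n} for the double tail with connector C(n₁+n,n)⁻¹ and n_r > m. Splitting off n_r = m
-- gives ζ(a)_{m-1,n} = ζ(a)_{m,n} + m^{-a_r} ζ(a^init)_{m,n}, and telescoping the connector in n gives
-- the dual relation with a^fin. Hence ζ(a)_{n-1,n-1} − ζ(a)_{n,n} is the sum of ζ(b)_{n,n} / n^{|a|-|b|}
-- over b = a^init, a^mid, a^fin. The sums σ(b)_n = Σ_{n₁>…>n_r>n} C(2n₁,n₁)⁻¹ n₁^{-b₁}⋯n_r^{-b_r}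
-- satisfy σ(b)_{n-1} − σ(b)_n = n^{-b_r} σ(b^init)_n, and everything tends to 0, so ζ(ℓ)_{n,n} is the
-- combination of the σ(b)_n with coefficients δ(ℓ). It remains to see that the functions n ↦ σ(b)_n, b
-- admissible, are linearly independent over the rational functions whose poles are natural numbers.
-- In a relation whose coefficients of maximal depth are polynomials, taking the difference in n lowers
-- their degree; when they are constants c_b, the coefficients one depth lower show that Σ_k c_{b,k} n^{-k}
-- is a difference R(n) − R(n−1), or for b = ∅ a twisted difference, which a pole count forbids.

-- No real number is ever formed: every series is cut at a bound N on its indices, and an identity
-- between limits is the statement that a difference of truncations is null in N. Most recursions
-- are exact once N is large; only the collapse of leading ones leaves a remainder, a boundary value
-- O(1/N) times an inner sum growing like a power of log N. The independence statement must allow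
-- rational coefficients even though δ produces constants, because differencing in n multiplies
-- coefficients by powers of 1/n. The restriction on poles is what makes the pole count work. The
-- depth 0 function is C(2n,n)⁻¹, which changes by a factor and not by a summand; this is the source
-- of the twisted difference, and its multiplier has numerator 4x - 2, which has no integral zero
-- and so does not stop the propagation.

open import Defs
open import Data.Bool using (Bool; true; false; not; if_then_else_; T)
import Data.Bool.Properties as Bₚ
open import Data.Empty using (⊥-elim)
open import Data.Integer as ℤ using (ℤ; -[1+_]) renaming (+_ to ⁺_)
import Data.Integer.Properties as ℤₚ
open import Data.Integer.Tactic.RingSolver using () renaming (solve-∀ to solveℤ)
open import Data.List using (List; []; _∷_; _++_; map; length; reverse; replicate)
import Data.List.Properties as Lₚ
open import Data.List.Relation.Unary.All as All using (All; []; _∷_)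
import Data.List.Relation.Unary.All.Properties as Allₚ
open import Data.Nat as ℕ using (ℕ; zero; suc; _≤_; _<_; z≤n; s≤s; _∸_; _<ᵇ_; _!)
open import Data.Nat.Combinatorics using (_C_; nC1≡n; nCk≡n!/k![n-k]!; [n∸k]!k!∣n!)
import Data.Nat.Divisibility as ℕ∣
open import Data.Nat.DivMod using (m/n*n≡m)
import Data.Nat.ListAction.Properties as LAₚ
import Data.Nat.Properties as ℕₚ
open import Data.Nat.Tactic.RingSolver using () renaming (solve-∀ to solveℕ)
open import Data.Product using (Σ; _×_; _,_; proj₁; proj₂)
open import Data.Rational as ℚ using (ℚ; 0ℚ; 1ℚ; _+_; _*_; _-_; -_; ∣_∣)
import Data.Rational.Properties as ℚₚ
import Data.Rational.Unnormalised as ℚᵘ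
import Data.Rational.Unnormalised.Properties as ℚᵘₚ
open import Data.Sum using (_⊎_; inj₁; inj₂)
open import Level using (0ℓ)
open import Relation.Binary.PropositionalEquality
open import Relation.Nullary using (yes; no; does)
open import Relation.Nullary.Decidable using (dec-true; dec-false; dec⇒maybe)
open import Tactic.RingSolver using (solve-∀)
open import Tactic.RingSolver.Core.AlmostCommutativeRing using (AlmostCommutativeRing; fromCommutativeRing)

-- Rationals

ℚ-ring : AlmostCommutativeRing 0ℓ 0ℓ
ℚ-ring = fromCommutativeRing ℚₚ.+-*-commutativeRing (λ x → dec⇒maybe (0ℚ ℚₚ.≟ x))

opaque

  -- Opaque, so that arguments see only the homomorphism laws below and the normalisation of
  -- fractions stays folded.
  ι : ℤ → ℚ
  ι i = i ℚ./ 1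

  ι-def : ∀ i → ι i ≡ i ℚ./ 1
  ι-def i = refl

  ι-0 : ι (⁺ 0) ≡ 0ℚ
  ι-0 = refl

  ι-1 : ι (⁺ 1) ≡ 1ℚ
  ι-1 = refl

  ιᵘ : ∀ i → ℚ.toℚᵘ (ι i) ℚᵘ.≃ ℚᵘ.mkℚᵘ i 0
  ιᵘ i = ℚₚ.toℚᵘ-fromℚᵘ (ℚᵘ.mkℚᵘ i 0)

  ι-+ : ∀ i j → ι (i ℤ.+ j) ≡ ι i + ι j
  ι-+ i j = ℚₚ.toℚᵘ-injective (begin
    ℚ.toℚᵘ (ι (i ℤ.+ j))              ≈⟨ ιᵘ (i ℤ.+ j) ⟩
    ℚᵘ.mkℚᵘ (i ℤ.+ j) 0               ≈⟨ ℚᵘ.*≡* (cong (ℤ._* ⁺ 1) (sym (cong₂ ℤ._+_ (ℤₚ.*-identityʳ i) (ℤₚ.*-identityʳ j)))) ⟩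
    ℚᵘ.mkℚᵘ i 0 ℚᵘ.+ ℚᵘ.mkℚᵘ j 0      ≈⟨ ℚᵘₚ.+-cong (ιᵘ i) (ιᵘ j) ⟨
    ℚ.toℚᵘ (ι i) ℚᵘ.+ ℚ.toℚᵘ (ι j)    ≈⟨ ℚₚ.toℚᵘ-homo-+ (ι i) (ι j) ⟨
    ℚ.toℚᵘ (ι i + ι j)                ∎)
    where open ℚᵘₚ.≃-Reasoning

  ι-* : ∀ i j → ι (i ℤ.* j) ≡ ι i * ι j
  ι-* i j = ℚₚ.toℚᵘ-injective (begin
    ℚ.toℚᵘ (ι (i ℤ.* j))              ≈⟨ ιᵘ (i ℤ.* j) ⟩
    ℚᵘ.mkℚᵘ i 0 ℚᵘ.* ℚᵘ.mkℚᵘ j 0      ≈⟨ ℚᵘₚ.*-cong (ιᵘ i) (ιᵘ j) ⟨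
    ℚ.toℚᵘ (ι i) ℚᵘ.* ℚ.toℚᵘ (ι j)    ≈⟨ ℚₚ.toℚᵘ-homo-* (ι i) (ι j) ⟨
    ℚ.toℚᵘ (ι i * ι j)                ∎)
    where open ℚᵘₚ.≃-Reasoning

  ι-neg : ∀ i → ι (ℤ.- i) ≡ - ι i
  ι-neg (⁺ zero)  = refl
  ι-neg ℤ.+[1+ n ] = refl
  ι-neg -[1+ n ]  = sym (neg-neg _)
    where
    neg-neg : ∀ p → - - p ≡ p
    neg-neg = solve-∀ ℚ-ring

  ι-∸ : ∀ i j → ι (i ℤ.- j) ≡ ι i - ι j
  ι-∸ i j = trans (ι-+ i (ℤ.- j)) (cong (ι i +_) (ι-neg j))

  ι-injective : ∀ {i j} → ι i ≡ ι j → i ≡ j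
  ι-injective {i} {j} eq with ℚₚ.fromℚᵘ-injective {ℚᵘ.mkℚᵘ i 0} {ℚᵘ.mkℚᵘ j 0} eq
  ... | ℚᵘ.*≡* e = trans (sym (ℤₚ.*-identityʳ i)) (trans e (ℤₚ.*-identityʳ j))

ν : ℕ → ℚ
ν n = ι (⁺ n)


ν-+ : ∀ m n → ν (m ℕ.+ n) ≡ ν m + ν n
ν-+ m n = ι-+ (⁺ m) (⁺ n)

ν-* : ∀ m n → ν (m ℕ.* n) ≡ ν m * ν n
ν-* m n = trans (cong ι (ℤₚ.pos-* m n)) (ι-* (⁺ m) (⁺ n))

ν-suc : ∀ n → ν (suc n) ≡ 1ℚ + ν n
ν-suc n = trans (ν-+ 1 n) (cong (_+ ν n) ι-1)

opaque
  unfolding ι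

  ν-nonNeg : ∀ n → 0ℚ ℚ.≤ ν n
  ν-nonNeg n = ℚₚ.nonNegative⁻¹ (ν n) ⦃ ℚₚ.normalize-nonNeg n 1 ⦄

  ν-pos : ∀ n → 0ℚ ℚ.< ν (suc n)
  ν-pos n = ℚₚ.positive⁻¹ (ν (suc n)) ⦃ ℚₚ.normalize-pos (suc n) 1 ⦄

ν-mono : ∀ {m n} → m ≤ n → ν m ℚ.≤ ν n
ν-mono {m} {n} m≤n = begin
  ν m               ≡⟨ ℚₚ.+-identityʳ (ν m) ⟨
  ν m + 0ℚ          ≤⟨ ℚₚ.+-monoʳ-≤ (ν m) (ν-nonNeg (n ∸ m)) ⟩
  ν m + ν (n ∸ m)   ≡⟨ ν-+ m (n ∸ m) ⟨
  ν (m ℕ.+ (n ∸ m)) ≡⟨ cong ν (ℕₚ.m+[n∸m]≡n m≤n) ⟩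
  ν n               ∎
  where open ℚₚ.≤-Reasoning

recip-inverse : ∀ n → 1 ≤ n → ν n * recip n ≡ 1ℚ
recip-inverse (suc n) _ = ℚₚ.toℚᵘ-injective (begin
  ℚ.toℚᵘ (ν (suc n) * recip (suc n))              ≈⟨ ℚₚ.toℚᵘ-homo-* (ν (suc n)) (recip (suc n)) ⟩
  ℚ.toℚᵘ (ν (suc n)) ℚᵘ.* ℚ.toℚᵘ (recip (suc n))  ≈⟨ ℚᵘₚ.*-cong (ιᵘ (⁺ suc n)) (ℚₚ.toℚᵘ-fromℚᵘ (ℚᵘ.mkℚᵘ (⁺ 1) n)) ⟩
  ℚᵘ.mkℚᵘ (⁺ suc n) 0 ℚᵘ.* ℚᵘ.mkℚᵘ (⁺ 1) n        ≈⟨ ℚᵘ.*≡* (cong ⁺_ (cong suc (trans (ℕₚ.*-identityʳ _) (trans (ℕₚ.*-identityʳ n) (sym (trans (ℕₚ.+-identityʳ _) (ℕₚ.+-identityʳ n))))))) ⟩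
  ℚᵘ.1ℚᵘ                                          ∎)
  where open ℚᵘₚ.≃-Reasoning

recip-nonNeg : ∀ n → 0ℚ ℚ.≤ recip n
recip-nonNeg zero    = ℚₚ.≤-refl
recip-nonNeg (suc n) = ℚₚ.nonNegative⁻¹ (recip (suc n)) ⦃ ℚₚ.normalize-nonNeg 1 (suc n) ⦄

recip-pos : ∀ n → 0ℚ ℚ.< recip (suc n)
recip-pos n = ℚₚ.positive⁻¹ (recip (suc n)) ⦃ ℚₚ.normalize-pos 1 (suc n) ⦄

*-cancelˡ-pos : ∀ {r p q} → 0ℚ ℚ.< r → r * p ≡ r * q → p ≡ q
*-cancelˡ-pos {r} {p} {q} 0<r eq = begin
  p                ≡⟨ ℚₚ.*-identityˡ p ⟨
  1ℚ * p           ≡⟨ cong (_* p) (ℚₚ.*-inverseˡ r) ⟨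
  ℚ.1/ r * r * p   ≡⟨ ℚₚ.*-assoc (ℚ.1/ r) r p ⟩
  ℚ.1/ r * (r * p) ≡⟨ cong (ℚ.1/ r *_) eq ⟩
  ℚ.1/ r * (r * q) ≡⟨ ℚₚ.*-assoc (ℚ.1/ r) r q ⟨
  ℚ.1/ r * r * q   ≡⟨ cong (_* q) (ℚₚ.*-inverseˡ r) ⟩
  1ℚ * q           ≡⟨ ℚₚ.*-identityˡ q ⟩
  q                ∎
  where
  open ≡-Reasoning
  instance _ = ℚ.>-nonZero 0<r

ν-cancel : ∀ {n p q} → 1 ≤ n → ν n * p ≡ ν n * q → p ≡ q
ν-cancel {suc n} _ = *-cancelˡ-pos (ν-pos n)

recip-* : ∀ m n → recip (m ℕ.* n) ≡ recip m * recip n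
recip-* zero    n       = sym (ℚₚ.*-zeroˡ (recip n))
recip-* (suc m) zero    = trans (cong recip (ℕₚ.*-zeroʳ m)) (sym (ℚₚ.*-zeroʳ (recip (suc m))))
recip-* (suc m) (suc n) = ν-cancel {suc m ℕ.* suc n} (s≤s z≤n) (begin
  ν (suc m ℕ.* suc n) * recip (suc m ℕ.* suc n)       ≡⟨ recip-inverse (suc m ℕ.* suc n) (s≤s z≤n) ⟩
  1ℚ * 1ℚ                                             ≡⟨ cong₂ _*_ (recip-inverse (suc m) (s≤s z≤n)) (recip-inverse (suc n) (s≤s z≤n)) ⟨
  (ν (suc m) * recip (suc m)) * (ν (suc n) * recip (suc n)) ≡⟨ interchange (ν (suc m)) (recip (suc m)) (ν (suc n)) (recip (suc n)) ⟩
  (ν (suc m) * ν (suc n)) * (recip (suc m) * recip (suc n)) ≡⟨ cong (_* (recip (suc m) * recip (suc n))) (ν-* (suc m) (suc n)) ⟨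
  ν (suc m ℕ.* suc n) * (recip (suc m) * recip (suc n)) ∎)
  where
  open ≡-Reasoning
  interchange : ∀ a b c d → (a * b) * (c * d) ≡ (a * c) * (b * d)
  interchange = solve-∀ ℚ-ring

*-nonNeg : ∀ {p q} → 0ℚ ℚ.≤ p → 0ℚ ℚ.≤ q → 0ℚ ℚ.≤ p * q
*-nonNeg {p} {q} 0≤p 0≤q = ℚₚ.nonNegative⁻¹ (p * q) ⦃ ℚₚ.nonNeg*nonNeg⇒nonNeg p ⦃ ℚ.nonNegative 0≤p ⦄ q ⦃ ℚ.nonNegative 0≤q ⦄ ⦄

+-nonNeg : ∀ {p q} → 0ℚ ℚ.≤ p → 0ℚ ℚ.≤ q → 0ℚ ℚ.≤ p + q
+-nonNeg = ℚₚ.+-mono-≤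

*-mono-≤ : ∀ {p q r s} → 0ℚ ℚ.≤ r → 0ℚ ℚ.≤ q → p ℚ.≤ q → r ℚ.≤ s → p * r ℚ.≤ q * s
*-mono-≤ {p} {q} {r} {s} 0≤r 0≤q p≤q r≤s =
  ℚₚ.≤-trans (ℚₚ.*-monoʳ-≤-nonNeg r ⦃ ℚ.nonNegative 0≤r ⦄ p≤q)
             (ℚₚ.*-monoˡ-≤-nonNeg q ⦃ ℚ.nonNegative 0≤q ⦄ r≤s)

*-monoˡ : ∀ {p q} r → 0ℚ ℚ.≤ r → p ℚ.≤ q → r * p ℚ.≤ r * q
*-monoˡ r 0≤r = ℚₚ.*-monoˡ-≤-nonNeg r ⦃ ℚ.nonNegative 0≤r ⦄

ν-cancel-≤ : ∀ {n p q} → 1 ≤ n → ν n * p ℚ.≤ ν n * q → p ℚ.≤ q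
ν-cancel-≤ {suc n} _ = ℚₚ.*-cancelˡ-≤-pos (ν (suc n)) ⦃ ℚ.positive (ν-pos n) ⦄

recip-anti : ∀ {m n} → 1 ≤ m → m ≤ n → recip n ℚ.≤ recip m
recip-anti {m} {n} 1≤m m≤n = ν-cancel-≤ {n} 1≤n (begin
  ν n * recip n  ≡⟨ recip-inverse n 1≤n ⟩
  1ℚ             ≡⟨ recip-inverse m 1≤m ⟨
  ν m * recip m  ≤⟨ ℚₚ.*-monoʳ-≤-nonNeg (recip m) ⦃ ℚ.nonNegative (recip-nonNeg m) ⦄ (ν-mono m≤n) ⟩
  ν n * recip m  ∎)
  where
  open ℚₚ.≤-Reasoning
  1≤n = ℕₚ.≤-trans 1≤m m≤n

archimedean : ∀ ε → 0ℚ ℚ.< ε → Σ ℕ λ q → recip (suc q) ℚ.≤ ε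
archimedean ε@(ℚ.mkℚ (⁺ zero) d c) (ℚ.*<* (ℤ.+<+ ()))
archimedean ε@(ℚ.mkℚ ℤ.+[1+ n ] d c) _ = d , ℚₚ.toℚᵘ-cancel-≤ (begin
  ℚ.toℚᵘ (recip (suc d)) ≃⟨ ℚₚ.toℚᵘ-fromℚᵘ (ℚᵘ.mkℚᵘ (⁺ 1) d) ⟩
  ℚᵘ.mkℚᵘ (⁺ 1) d        ≤⟨ ℚᵘ.*≤* (ℤₚ.*-monoʳ-≤-nonNeg (⁺ suc d) {⁺ 1} {ℤ.+[1+ n ]} (ℤ.+≤+ (s≤s z≤n))) ⟩
  ℚ.toℚᵘ ε               ∎)
  where open ℚᵘₚ.≤-Reasoning
archimedean ε@(ℚ.mkℚ -[1+ n ] d c) (ℚ.*<* ())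

-- Null sequences and truncated iterated sums

-- Has the shape of `ζnnVanishes`, so `InM ℓ` is definitionally nullity of `ζpartL ℓ n` for every n.
Null : (ℕ → ℚ) → Set
Null u = ∀ (ε : ℚ) → 0ℚ ℚ.< ε → Σ ℕ (λ N₀ → ∀ (N : ℕ) → N₀ ≤ N → ∣ u N ∣ ℚ.< ε)

Null-ext : ∀ {u v} N₁ → (∀ N → N₁ ≤ N → u N ≡ v N) → Null u → Null v
Null-ext N₁ eq nu ε 0<ε with nu ε 0<ε
... | N₀ , bd = N₁ ℕ.⊔ N₀ , λ N le →
  subst (λ x → ∣ x ∣ ℚ.< ε) (eq N (ℕₚ.≤-trans (ℕₚ.m≤m⊔n N₁ N₀) le)) (bd N (ℕₚ.≤-trans (ℕₚ.m≤n⊔m N₁ N₀) le))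

Null-0 : Null (λ _ → 0ℚ)
Null-0 ε 0<ε = 0 , λ _ _ → 0<ε

halve : ∀ ε → ℚ.½ * ε + ℚ.½ * ε ≡ ε
halve ε = trans (sym (ℚₚ.*-distribʳ-+ ε ℚ.½ ℚ.½)) (ℚₚ.*-identityˡ ε)

½-pos : ∀ {ε} → 0ℚ ℚ.< ε → 0ℚ ℚ.< ℚ.½ * ε
½-pos {ε} 0<ε = ℚₚ.positive⁻¹ (ℚ.½ * ε) ⦃ ℚₚ.pos*pos⇒pos ℚ.½ ε ⦃ ℚ.positive 0<ε ⦄ ⦄

Null-+ : ∀ {u v} → Null u → Null v → Null (λ N → u N + v N)
Null-+ {u} {v} nu nv ε 0<ε with nu (ℚ.½ * ε) (½-pos 0<ε) | nv (ℚ.½ * ε) (½-pos 0<ε)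
... | N₀ , b₀ | N₁ , b₁ = N₀ ℕ.⊔ N₁ , λ N le → begin-strict
  ∣ u N + v N ∣       ≤⟨ ℚₚ.∣p+q∣≤∣p∣+∣q∣ (u N) (v N) ⟩
  ∣ u N ∣ + ∣ v N ∣   <⟨ ℚₚ.+-mono-< (b₀ N (ℕₚ.≤-trans (ℕₚ.m≤m⊔n N₀ N₁) le)) (b₁ N (ℕₚ.≤-trans (ℕₚ.m≤n⊔m N₀ N₁) le)) ⟩
  ℚ.½ * ε + ℚ.½ * ε   ≡⟨ halve ε ⟩
  ε                   ∎
  where open ℚₚ.≤-Reasoning

Null-scale : ∀ c {u} → Null u → Null (λ N → c * u N)
Null-scale c {u} nu ε 0<ε with c ℚₚ.≟ 0ℚ
... | yes refl = 0 , λ N _ → subst (λ x → ∣ x ∣ ℚ.< ε) (sym (ℚₚ.*-zeroˡ (u N))) 0<ε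
... | no c≢0 = proj₁ w , λ N le → begin-strict
    ∣ c * u N ∣                  ≡⟨ ℚₚ.∣p*q∣≡∣p∣*∣q∣ c (u N) ⟩
    ∣ c ∣ * ∣ u N ∣              <⟨ ℚₚ.*-monoʳ-<-pos ∣ c ∣ (proj₂ w N le) ⟩
    ∣ c ∣ * (ℚ.1/ ∣ c ∣ * ε)     ≡⟨ ℚₚ.*-assoc ∣ c ∣ (ℚ.1/ ∣ c ∣) ε ⟨
    ∣ c ∣ * ℚ.1/ ∣ c ∣ * ε       ≡⟨ cong (_* ε) (ℚₚ.*-inverseʳ ∣ c ∣) ⟩
    1ℚ * ε                       ≡⟨ ℚₚ.*-identityˡ ε ⟩
    ε                            ∎
  where
  open ℚₚ.≤-Reasoning
  instance
    c-pos : ℚ.Positive ∣ c ∣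
    c-pos = ℚₚ.nonNeg∧nonZero⇒pos ∣ c ∣ ⦃ ℚₚ.∣-∣-nonNeg c ⦄ ⦃ ℚ.≢-nonZero (λ eq → c≢0 (ℚₚ.∣p∣≡0⇒p≡0 c eq)) ⦄
    c-nonZero : ℚ.NonZero ∣ c ∣
    c-nonZero = ℚₚ.pos⇒nonZero ∣ c ∣
  w = nu (ℚ.1/ ∣ c ∣ * ε)
    (ℚₚ.positive⁻¹ (ℚ.1/ ∣ c ∣ * ε) ⦃ ℚₚ.pos*pos⇒pos (ℚ.1/ ∣ c ∣) ⦃ ℚₚ.1/pos⇒pos ∣ c ∣ ⦄ ε ⦃ ℚ.positive 0<ε ⦄ ⦄)

Null-- : ∀ {u v} → Null u → Null v → Null (λ N → u N - v N)
Null-- {u} {v} nu nv = Null-+ nu (Null-ext 0 (λ N _ → lem (v N)) (Null-scale (- 1ℚ) nv))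
  where
  lem : ∀ x → - 1ℚ * x ≡ - x
  lem = solve-∀ ℚ-ring

Null-const : ∀ {c} → Null (λ _ → c) → c ≡ 0ℚ
Null-const {c} nc with c ℚₚ.≟ 0ℚ
... | yes c≡0 = c≡0
... | no c≢0 with nc ∣ c ∣ (ℚₚ.positive⁻¹ ∣ c ∣ ⦃ ℚₚ.nonNeg∧nonZero⇒pos ∣ c ∣ ⦃ ℚₚ.∣-∣-nonNeg c ⦄ ⦃ ℚ.≢-nonZero (λ eq → c≢0 (ℚₚ.∣p∣≡0⇒p≡0 c eq)) ⦄ ⦄)
... | N₀ , b = ⊥-elim (ℚₚ.<-irrefl refl (b N₀ ℕₚ.≤-refl))

if-true : ∀ {n j} {x y : ℚ} → n < j → (if n <ᵇ j then x else y) ≡ x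
if-true {n} {j} n<j with n <ᵇ j | ℕₚ.<⇒<ᵇ n<j
... | true | _ = refl

if-false : ∀ {n j} {x y : ℚ} → j ≤ n → (if n <ᵇ j then x else y) ≡ y
if-false {n} {j} j≤n with n <ᵇ j in eq
... | false = refl
... | true  = ⊥-elim (ℕₚ.<⇒≱ (ℕₚ.<ᵇ⇒< n j (subst T (sym eq) _)) j≤n)

sum-suc : ∀ {n M} f → n < M → sumBetween n (suc M) f ≡ sumBetween n M f + f M
sum-suc {n} {M} f n<M = cong (λ x → sumBetween n M f + x) (if-true n<M)

sum-empty : ∀ {n} M f → M ≤ suc n → sumBetween n M f ≡ 0ℚ
sum-empty zero f _ = refl
sum-empty {n} (suc M) f M<n = begin
  sumBetween n M f + (if n <ᵇ M then f M else 0ℚ) ≡⟨ cong₂ _+_ (sum-empty M f (ℕₚ.m≤n⇒m≤1+n (ℕₚ.≤-pred M<n))) (if-false (ℕₚ.≤-pred M<n)) ⟩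
  0ℚ + 0ℚ ≡⟨⟩
  0ℚ ∎
  where open ≡-Reasoning

-- Induction on the upper end starting at the empty range `M = suc n`; closed forms with boundary
-- terms are correct only from there on.
sum-elim : ∀ {n} (P : ℕ → Set) → P (suc n) → (∀ M → n < M → P M → P (suc M)) → ∀ M → n < M → P M
sum-elim P base step (suc M) n<sM with ℕₚ.m≤n⇒m<n∨m≡n (ℕₚ.≤-pred n<sM)
... | inj₁ n<M  = step M n<M (sum-elim P base step M n<M)
... | inj₂ refl = base

interval-cases : ∀ n M → (M ≤ n) ⊎ (n < M)
interval-cases n M with M ℕₚ.≤? n
... | yes p = inj₁ p
... | no p  = inj₂ (ℕₚ.≰⇒> p)

sum-cong : ∀ {n} M {f g} → (∀ j → n < j → j < M → f j ≡ g j) → sumBetween n M f ≡ sumBetween n M g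
sum-cong zero eq = refl
sum-cong {n} (suc M) {f} {g} eq with interval-cases n M
... | inj₁ M≤n = trans (sum-empty (suc M) f (s≤s M≤n)) (sym (sum-empty (suc M) g (s≤s M≤n)))
... | inj₂ n<M = trans (sum-suc f n<M) (trans (cong₂ _+_ (sum-cong M (λ j a b → eq j a (ℕₚ.m<n⇒m<1+n b))) (eq M n<M ℕₚ.≤-refl)) (sym (sum-suc g n<M)))

sum-lin : ∀ {n} M x y f g → sumBetween n M (λ j → x * f j + y * g j) ≡ x * sumBetween n M f + y * sumBetween n M g
sum-lin zero x y f g = lem x y
  where
  lem : ∀ x y → 0ℚ ≡ x * 0ℚ + y * 0ℚ
  lem = solve-∀ ℚ-ring
sum-lin {n} (suc M) x y f g with interval-cases n M
... | inj₁ M≤n = trans (sum-empty (suc M) _ (s≤s M≤n)) (trans (lem x y) (sym (cong₂ (λ a b → x * a + y * b) (sum-empty (suc M) f (s≤s M≤n)) (sum-empty (suc M) g (s≤s M≤n)))))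
  where
  lem : ∀ x y → 0ℚ ≡ x * 0ℚ + y * 0ℚ
  lem = solve-∀ ℚ-ring
... | inj₂ n<M = begin
  sumBetween n (suc M) (λ j → x * f j + y * g j) ≡⟨ sum-suc (λ j → x * f j + y * g j) n<M ⟩
  sumBetween n M (λ j → x * f j + y * g j) + (x * f M + y * g M) ≡⟨ cong (_+ (x * f M + y * g M)) (sum-lin M x y f g) ⟩
  x * sumBetween n M f + y * sumBetween n M g + (x * f M + y * g M) ≡⟨ lem x y (sumBetween n M f) (sumBetween n M g) (f M) (g M) ⟩
  x * (sumBetween n M f + f M) + y * (sumBetween n M g + g M) ≡⟨ cong₂ (λ a b → x * a + y * b) (sum-suc f n<M) (sum-suc g n<M) ⟨
  x * sumBetween n (suc M) f + y * sumBetween n (suc M) g ∎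
  where
  open ≡-Reasoning
  lem : ∀ x y a b c d → x * a + y * b + (x * c + y * d) ≡ x * (a + c) + y * (b + d)
  lem = solve-∀ ℚ-ring

sum-lower : ∀ {n} M f → suc n < M → sumBetween n M f ≡ f (suc n) + sumBetween (suc n) M f
sum-lower {n} M f = sum-elim {suc n} (λ M → sumBetween n M f ≡ f (suc n) + sumBetween (suc n) M f) base step M
  where
  open ≡-Reasoning
  base : sumBetween n (suc (suc n)) f ≡ f (suc n) + sumBetween (suc n) (suc (suc n)) f
  base = begin
    sumBetween n (suc (suc n)) f ≡⟨ sum-suc {n} {suc n} f ℕₚ.≤-refl ⟩
    sumBetween n (suc n) f + f (suc n) ≡⟨ cong (_+ f (suc n)) (sum-empty (suc n) f ℕₚ.≤-refl) ⟩
    0ℚ + f (suc n) ≡⟨ ℚₚ.+-comm 0ℚ (f (suc n)) ⟩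
    f (suc n) + 0ℚ ≡⟨ cong (λ x → f (suc n) + x) (sum-empty (suc (suc n)) f ℕₚ.≤-refl) ⟨
    f (suc n) + sumBetween (suc n) (suc (suc n)) f ∎
  step : ∀ M → suc n < M → sumBetween n M f ≡ f (suc n) + sumBetween (suc n) M f → sumBetween n (suc M) f ≡ f (suc n) + sumBetween (suc n) (suc M) f
  step M lt ih = begin
    sumBetween n (suc M) f ≡⟨ sum-suc f (ℕₚ.<-trans (ℕₚ.n<1+n n) lt) ⟩
    sumBetween n M f + f M ≡⟨ cong (_+ f M) ih ⟩
    f (suc n) + sumBetween (suc n) M f + f M ≡⟨ ℚₚ.+-assoc (f (suc n)) _ (f M) ⟩
    f (suc n) + (sumBetween (suc n) M f + f M) ≡⟨ cong (λ x → f (suc n) + x) (sum-suc f lt) ⟨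
    f (suc n) + sumBetween (suc n) (suc M) f ∎

sum-nonNeg : ∀ {n} M f → (∀ j → 0ℚ ℚ.≤ f j) → 0ℚ ℚ.≤ sumBetween n M f
sum-nonNeg zero f 0≤f = ℚₚ.≤-refl
sum-nonNeg {n} (suc M) f 0≤f with interval-cases n M
... | inj₁ M≤n = ℚₚ.≤-reflexive (sym (sum-empty (suc M) f (s≤s M≤n)))
... | inj₂ n<M = subst (0ℚ ℚ.≤_) (sym (sum-suc f n<M)) (+-nonNeg (sum-nonNeg M f 0≤f) (0≤f M))

-- Both sides run over pairs n < i < j ≤ N; the induction on the upper end adds the pairs with j =
-- M.
sum-swap : ∀ {n} N u h →
  sumBetween n (suc N) (λ i → u i * sumBetween i (suc N) h) ≡ sumBetween n (suc N) (λ j → h j * sumBetween n j u)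
sum-swap {n} N u h with interval-cases n N
... | inj₁ N≤n = trans (sum-empty (suc N) _ (s≤s N≤n)) (sym (sum-empty (suc N) (λ j → h j * sumBetween n j u) (s≤s N≤n)))
... | inj₂ n<N = sum-elim {n} (λ M → sumBetween n M (λ i → u i * sumBetween i M h) ≡ sumBetween n M (λ j → h j * sumBetween n j u)) base step (suc N) (ℕₚ.m<n⇒m<1+n n<N)
  where
  open ≡-Reasoning
  base = trans (sum-empty (suc n) (λ i → u i * sumBetween i (suc n) h) ℕₚ.≤-refl) (sym (sum-empty (suc n) (λ j → h j * sumBetween n j u) ℕₚ.≤-refl))
  lem : ∀ x a b → x * (a + b) ≡ 1ℚ * (x * a) + b * x
  lem = solve-∀ ℚ-ring
  lem₂ : ∀ a b c d → 1ℚ * a + b * c + d * 0ℚ ≡ a + b * c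
  lem₂ = solve-∀ ℚ-ring
  step : ∀ M → n < M → sumBetween n M (λ i → u i * sumBetween i M h) ≡ sumBetween n M (λ j → h j * sumBetween n j u) →
    sumBetween n (suc M) (λ i → u i * sumBetween i (suc M) h) ≡ sumBetween n (suc M) (λ j → h j * sumBetween n j u)
  step M n<M ih = begin
    sumBetween n (suc M) (λ i → u i * sumBetween i (suc M) h)
      ≡⟨ sum-suc (λ i → u i * sumBetween i (suc M) h) n<M ⟩
    sumBetween n M (λ i → u i * sumBetween i (suc M) h) + u M * sumBetween M (suc M) h
      ≡⟨ cong₂ (λ a b → a + u M * b) (sum-cong M (λ i _ i<M → trans (cong (u i *_) (sum-suc h i<M)) (lem (u i) (sumBetween i M h) (h M)))) (sum-empty (suc M) h ℕₚ.≤-refl) ⟩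
    sumBetween n M (λ i → 1ℚ * (u i * sumBetween i M h) + h M * u i) + u M * 0ℚ
      ≡⟨ cong (_+ u M * 0ℚ) (sum-lin M 1ℚ (h M) (λ i → u i * sumBetween i M h) u) ⟩
    1ℚ * sumBetween n M (λ i → u i * sumBetween i M h) + h M * sumBetween n M u + u M * 0ℚ
      ≡⟨ lem₂ (sumBetween n M (λ i → u i * sumBetween i M h)) (h M) (sumBetween n M u) (u M) ⟩
    sumBetween n M (λ i → u i * sumBetween i M h) + h M * sumBetween n M u
      ≡⟨ cong (_+ h M * sumBetween n M u) ih ⟩
    sumBetween n M (λ j → h j * sumBetween n j u) + h M * sumBetween n M u
      ≡⟨ sum-suc (λ j → h j * sumBetween n j u) n<M ⟨
    sumBetween n (suc M) (λ j → h j * sumBetween n j u) ∎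

-- With N a bound on the summation indices, A N k h m = Σ_{m<j≤N} j⁻ᵏ h(j) and
-- Z N h (a₁,…,a_r) m = Σ_{N≥n₁>…>n_r>m} h(n₁) n₁^{-a₁}⋯n_r^{-a_r}.

A : ℕ → ℕ → (ℕ → ℚ) → ℕ → ℚ
A N k h m = sumBetween m (suc N) (λ j → recip (j ℕ.^ k) * h j)

Z : ℕ → (ℕ → ℚ) → Comp → ℕ → ℚ
Z N h []       = h
Z N h (a ∷ as) = Z N (A N a h) as

A-cong : ∀ {N k h h′} m → (∀ j → j ≤ N → h j ≡ h′ j) → A N k h m ≡ A N k h′ m
A-cong {N} {k} m eq = sum-cong (suc N) (λ j _ j≤N → cong (recip (j ℕ.^ k) *_) (eq j (ℕₚ.≤-pred j≤N)))

Z-cong : ∀ {N h h′} as → (∀ j → j ≤ N → h j ≡ h′ j) → ∀ m → m ≤ N → Z N h as m ≡ Z N h′ as m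
Z-cong []       eq = eq
Z-cong {N} (a ∷ as) eq = Z-cong as (λ j _ → A-cong {N} {a} j eq)

A-lin : ∀ {N k} x y h h′ m → A N k (λ j → x * h j + y * h′ j) m ≡ x * A N k h m + y * A N k h′ m
A-lin {N} {k} x y h h′ m = trans
  (sum-cong (suc N) (λ j _ _ → lem (recip (j ℕ.^ k)) x y (h j) (h′ j)))
  (sum-lin (suc N) x y (λ j → recip (j ℕ.^ k) * h j) (λ j → recip (j ℕ.^ k) * h′ j))
  where
  lem : ∀ r x y a b → r * (x * a + y * b) ≡ x * (r * a) + y * (r * b)
  lem = solve-∀ ℚ-ring

Z-lin : ∀ {N} as x y h h′ m → m ≤ N → Z N (λ j → x * h j + y * h′ j) as m ≡ x * Z N h as m + y * Z N h′ as m
Z-lin []       x y h h′ m _ = refl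
Z-lin {N} (a ∷ as) x y h h′ m m≤N = trans (Z-cong as (λ j _ → A-lin {N} {a} x y h h′ j) m m≤N) (Z-lin as x y (A N a h) (A N a h′) m m≤N)

-- `Z` consumes a composition from the largest index n₁, while m bounds the smallest one; this form
-- exposes the last entry, on which `init` acts.
Z-snoc : ∀ {N} h as k m → Z N h (as ++ k ∷ []) m ≡ A N k (Z N h as) m
Z-snoc h []       k m = refl
Z-snoc {N} h (a ∷ as) k m = Z-snoc (A N a h) as k m

-- The term n_r = m + 1 is split off. The bound on m matters: for `as = []` the right side contains
-- h(m + 1), which is not truncated at N. This is why the later identities hold only for large N.
Z-snoc-suc : ∀ {N} h as k m → suc m ≤ N →
  Z N h (as ++ k ∷ []) m ≡ recip (suc m ℕ.^ k) * Z N h as (suc m) + Z N h (as ++ k ∷ []) (suc m)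
Z-snoc-suc {N} h as k m m<N = trans (Z-snoc h as k m)
  (trans (sum-lower (suc N) (λ j → recip (j ℕ.^ k) * Z N h as j) (s≤s m<N))
         (cong (λ x → recip (suc m ℕ.^ k) * Z N h as (suc m) + x) (sym (Z-snoc h as k (suc m)))))

-- `Z` nests tails from n₁ downwards, `inner` nests partial sums from n_r upwards. Each entry costs
-- one exchange of summation.
Z-inner : ∀ N h as n → n ≤ N → Z N (λ m → sumBetween m (suc N) h) as n ≡ sumBetween n (suc N) (λ j → h j * inner as n j)
Z-inner N h [] n n≤N = sum-cong (suc N) (λ j _ _ → sym (ℚₚ.*-identityʳ (h j)))
Z-inner N h (a ∷ as) n n≤N = begin
  Z N (λ m → sumBetween m (suc N) (λ i → recip (i ℕ.^ a) * sumBetween i (suc N) h)) as n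
    ≡⟨ Z-inner N (λ i → recip (i ℕ.^ a) * sumBetween i (suc N) h) as n n≤N ⟩
  sumBetween n (suc N) (λ i → recip (i ℕ.^ a) * sumBetween i (suc N) h * inner as n i)
    ≡⟨ sum-cong (suc N) (λ i _ _ → lem (recip (i ℕ.^ a)) (sumBetween i (suc N) h) (inner as n i)) ⟩
  sumBetween n (suc N) (λ i → recip (i ℕ.^ a) * inner as n i * sumBetween i (suc N) h)
    ≡⟨ sum-swap N (λ i → recip (i ℕ.^ a) * inner as n i) h ⟩
  sumBetween n (suc N) (λ j → h j * inner (a ∷ as) n j) ∎
  where
  open ≡-Reasoning
  lem : ∀ x y z → x * y * z ≡ x * z * y
  lem = solve-∀ ℚ-ring

Z-one : ∀ N as n → n ≤ N → Z N (λ _ → 1ℚ) as n ≡ inner as n (suc N)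
Z-one N []       n n≤N = refl
Z-one N (a ∷ as) n n≤N = trans
  (Z-inner N (λ j → recip (j ℕ.^ a) * 1ℚ) as n n≤N)
  (sum-cong (suc N) (λ j _ _ → cong (_* inner as n j) (ℚₚ.*-identityʳ (recip (j ℕ.^ a)))))

-- Decay of the tails, uniformly in the truncation

^-pos : ∀ n k → 1 ≤ n → 1 ≤ n ℕ.^ k
^-pos n zero    1≤n = ℕₚ.≤-refl
^-pos n (suc k) 1≤n = ℕₚ.*-mono-≤ 1≤n (^-pos n k 1≤n)

n≤n^k : ∀ n k → 1 ≤ n → 1 ≤ k → n ≤ n ℕ.^ k
n≤n^k n (suc k) 1≤n _ = subst (_≤ n ℕ.^ suc k) (ℕₚ.*-identityʳ n) (ℕₚ.*-monoʳ-≤ n (^-pos n k 1≤n))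

recip-^≤recip : ∀ n k → 1 ≤ n → 1 ≤ k → recip (n ℕ.^ k) ℚ.≤ recip n
recip-^≤recip n k 1≤n 1≤k = recip-anti 1≤n (n≤n^k n k 1≤n 1≤k)

recip-telescope : ∀ j → recip (suc j) * recip (suc (suc j)) + recip (suc (suc j)) ≡ recip (suc j)
recip-telescope j = begin
  a * b + b              ≡⟨ lem₁ a b ⟩
  (1ℚ + a) * b           ≡⟨ cong (λ x → (x + a) * b) (recip-inverse (suc j) (s≤s z≤n)) ⟨
  (ν (suc j) * a + a) * b ≡⟨ lem₂ (ν (suc j)) a b ⟩
  a * ((1ℚ + ν (suc j)) * b) ≡⟨ cong (λ x → a * (x * b)) (ν-suc (suc j)) ⟨
  a * (ν (suc (suc j)) * b) ≡⟨ cong (a *_) (recip-inverse (suc (suc j)) (s≤s z≤n)) ⟩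
  a * 1ℚ ≡⟨ ℚₚ.*-identityʳ a ⟩
  a ∎
  where
  open ≡-Reasoning
  a = recip (suc j)
  b = recip (suc (suc j))
  lem₁ : ∀ a b → a * b + b ≡ (1ℚ + a) * b
  lem₁ = solve-∀ ℚ-ring
  lem₂ : ∀ n a b → (n * a + a) * b ≡ a * ((1ℚ + n) * b)
  lem₂ = solve-∀ ℚ-ring

-- The bound 1/(j + 1) reproduces itself under `A`, whatever N is, because the sum of 1/(j(j + 1))
-- over j > m is 1/(m + 1).
record Decaying (h : ℕ → ℚ) : Set where
  field
    nonNeg : ∀ j → 0ℚ ℚ.≤ h j
    bound  : ∀ j → h j ℚ.≤ recip (suc j)

A-decaying : ∀ N k {h} → 1 ≤ k → Decaying h → Decaying (A N k h)
A-decaying N k {h} 1≤k d = record { nonNeg = nn ; bound = bd }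
  where
  open Decaying d
  f : ℕ → ℚ
  f j = recip (j ℕ.^ k) * h j
  nn : ∀ m → 0ℚ ℚ.≤ A N k h m
  nn m = sum-nonNeg (suc N) f (λ j → *-nonNeg (recip-nonNeg (j ℕ.^ k)) (nonNeg j))
  f≤ : ∀ j → 1 ≤ j → f j ℚ.≤ recip j * recip (suc j)
  f≤ j 1≤j = *-mono-≤ (nonNeg j) (recip-nonNeg j) (recip-^≤recip j k 1≤j 1≤k) (bound j)
  open ℚₚ.≤-Reasoning
  -- The summand 1/M is the part of the telescoping series over j ≥ M that has not yet been spent.
  step : ∀ m M → m < M → sumBetween m M f + recip M ℚ.≤ recip (suc m) → sumBetween m (suc M) f + recip (suc M) ℚ.≤ recip (suc m)
  step m (suc M) m<M ih = begin
    sumBetween m (suc (suc M)) f + recip (suc (suc M)) ≡⟨ cong (_+ recip (suc (suc M))) (sum-suc f m<M) ⟩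
    sumBetween m (suc M) f + f (suc M) + recip (suc (suc M)) ≡⟨ ℚₚ.+-assoc (sumBetween m (suc M) f) (f (suc M)) (recip (suc (suc M))) ⟩
    sumBetween m (suc M) f + (f (suc M) + recip (suc (suc M))) ≤⟨ ℚₚ.+-monoʳ-≤ (sumBetween m (suc M) f) (ℚₚ.+-monoˡ-≤ (recip (suc (suc M))) (f≤ (suc M) (s≤s z≤n))) ⟩
    sumBetween m (suc M) f + (recip (suc M) * recip (suc (suc M)) + recip (suc (suc M))) ≡⟨ cong (λ x → sumBetween m (suc M) f + x) (recip-telescope M) ⟩
    sumBetween m (suc M) f + recip (suc M) ≤⟨ ih ⟩
    recip (suc m) ∎
  bd : ∀ m → A N k h m ℚ.≤ recip (suc m)
  bd m with interval-cases m N
  ... | inj₁ N≤m = subst (ℚ._≤ recip (suc m)) (sym (sum-empty (suc N) f (s≤s N≤m))) (recip-nonNeg (suc m))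
  ... | inj₂ m<N = begin
    sumBetween m (suc N) f ≡⟨ ℚₚ.+-identityʳ _ ⟨
    sumBetween m (suc N) f + 0ℚ ≤⟨ ℚₚ.+-monoʳ-≤ (sumBetween m (suc N) f) (recip-nonNeg (suc N)) ⟩
    sumBetween m (suc N) f + recip (suc N) ≤⟨ sum-elim {m} (λ M → sumBetween m M f + recip M ℚ.≤ recip (suc m)) base (step m) (suc N) (ℕₚ.m<n⇒m<1+n m<N) ⟩
    recip (suc m) ∎
    where
    base : sumBetween m (suc m) f + recip (suc m) ℚ.≤ recip (suc m)
    base = ℚₚ.≤-reflexive (trans (cong (_+ recip (suc m)) (sum-empty (suc m) f ℕₚ.≤-refl)) (ℚₚ.+-identityˡ (recip (suc m))))

Z-decaying : ∀ N {h as} → Positive as → Decaying h → Decaying (Z N h as)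
Z-decaying N []         d = d
Z-decaying N (1≤a ∷ p) d = Z-decaying N p (A-decaying N _ 1≤a d)

-- Binomial connectors

binom : ℕ → ℕ → ℕ
binom n j = (j ℕ.+ n) C n

binom-! : ∀ n j → binom n j ℕ.* (n ! ℕ.* j !) ≡ (j ℕ.+ n) !
binom-! n j = begin
  ((j ℕ.+ n) C n) ℕ.* (n ! ℕ.* j !)
    ≡⟨ cong (λ x → ((j ℕ.+ n) C n) ℕ.* (n ! ℕ.* x !)) (ℕₚ.m+n∸n≡m j n) ⟨
  ((j ℕ.+ n) C n) ℕ.* (n ! ℕ.* (j ℕ.+ n ∸ n) !)
    ≡⟨ cong (ℕ._* (n ! ℕ.* (j ℕ.+ n ∸ n) !)) (nCk≡n!/k![n-k]! (ℕₚ.m≤n+m n j)) ⟩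
  (j ℕ.+ n) ! ℕ./ (n ! ℕ.* (j ℕ.+ n ∸ n) !) ℕ.* (n ! ℕ.* (j ℕ.+ n ∸ n) !)
    ≡⟨ m/n*n≡m (subst (ℕ∣._∣ (j ℕ.+ n) !) (ℕₚ.*-comm ((j ℕ.+ n ∸ n) !) (n !)) ([n∸k]!k!∣n! (ℕₚ.m≤n+m n j))) ⟩
  (j ℕ.+ n) ! ∎
  where
  open ≡-Reasoning
  instance _ = ℕₚ.m*n≢0 (n !) ((j ℕ.+ n ∸ n) !) ⦃ n ℕₚ.!≢0 ⦄ ⦃ (j ℕ.+ n ∸ n) ℕₚ.!≢0 ⦄

binom-pos : ∀ n j → 1 ≤ binom n j
binom-pos n j with binom n j | binom-! n j
... | zero  | eq = ⊥-elim (ℕ.≢-nonZero⁻¹ ((j ℕ.+ n) !) ⦃ (j ℕ.+ n) ℕₚ.!≢0 ⦄ (sym eq))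
... | suc _ | _  = s≤s z≤n

binom-sucˡ : ∀ n j → suc n ℕ.* binom (suc n) j ≡ (suc n ℕ.+ j) ℕ.* binom n j
binom-sucˡ n j = ℕₚ.*-cancelʳ-≡ _ _ (n ! ℕ.* j !) (begin
  suc n ℕ.* binom (suc n) j ℕ.* (n ! ℕ.* j !) ≡⟨ lem₁ (suc n) (binom (suc n) j) (n !) (j !) ⟩
  binom (suc n) j ℕ.* (suc n ! ℕ.* j !)       ≡⟨ binom-! (suc n) j ⟩
  (j ℕ.+ suc n) !                             ≡⟨ cong _! (ℕₚ.+-suc j n) ⟩
  suc (j ℕ.+ n) ℕ.* (j ℕ.+ n) !               ≡⟨ cong₂ ℕ._*_ (cong suc (ℕₚ.+-comm j n)) (sym (binom-! n j)) ⟩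
  (suc n ℕ.+ j) ℕ.* (binom n j ℕ.* (n ! ℕ.* j !)) ≡⟨ ℕₚ.*-assoc (suc n ℕ.+ j) (binom n j) (n ! ℕ.* j !) ⟨
  (suc n ℕ.+ j) ℕ.* binom n j ℕ.* (n ! ℕ.* j !) ∎)
  where
  open ≡-Reasoning
  instance _ = ℕₚ.m*n≢0 (n !) (j !) ⦃ n ℕₚ.!≢0 ⦄ ⦃ j ℕₚ.!≢0 ⦄
  lem₁ : ∀ s b p q → s ℕ.* b ℕ.* (p ℕ.* q) ≡ b ℕ.* (s ℕ.* p ℕ.* q)
  lem₁ = solveℕ

binom-sucʳ : ∀ n j → suc j ℕ.* binom n (suc j) ≡ (n ℕ.+ suc j) ℕ.* binom n j
binom-sucʳ n j = ℕₚ.*-cancelʳ-≡ _ _ (n ! ℕ.* j !) (begin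
  suc j ℕ.* binom n (suc j) ℕ.* (n ! ℕ.* j !) ≡⟨ lem₁ (suc j) (binom n (suc j)) (n !) (j !) ⟩
  binom n (suc j) ℕ.* (n ! ℕ.* suc j !)       ≡⟨ binom-! n (suc j) ⟩
  suc (j ℕ.+ n) ℕ.* (j ℕ.+ n) !               ≡⟨ cong₂ ℕ._*_ (trans (cong suc (ℕₚ.+-comm j n)) (sym (ℕₚ.+-suc n j))) (sym (binom-! n j)) ⟩
  (n ℕ.+ suc j) ℕ.* (binom n j ℕ.* (n ! ℕ.* j !)) ≡⟨ ℕₚ.*-assoc (n ℕ.+ suc j) (binom n j) (n ! ℕ.* j !) ⟨
  (n ℕ.+ suc j) ℕ.* binom n j ℕ.* (n ! ℕ.* j !) ∎)
  where
  open ≡-Reasoning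
  instance _ = ℕₚ.m*n≢0 (n !) (j !) ⦃ n ℕₚ.!≢0 ⦄ ⦃ j ℕₚ.!≢0 ⦄
  lem₁ : ∀ s b p q → s ℕ.* b ℕ.* (p ℕ.* q) ≡ b ℕ.* (p ℕ.* (s ℕ.* q))
  lem₁ = solveℕ

recip-cross : ∀ {a b c d} → 1 ≤ b → 1 ≤ d → a ℕ.* d ≡ c ℕ.* b → ν a * recip b ≡ ν c * recip d
recip-cross {a} {b} {c} {d} 1≤b 1≤d eq = ν-cancel 1≤b (ν-cancel 1≤d (begin
  ν d * (ν b * (ν a * recip b)) ≡⟨ lem (ν d) (ν b) (ν a) (recip b) ⟩
  (ν a * ν d) * (ν b * recip b) ≡⟨ cong₂ _*_ (trans (sym (ν-* a d)) (trans (cong ν eq) (ν-* c b))) (trans (recip-inverse b 1≤b) (sym (recip-inverse d 1≤d))) ⟩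
  (ν c * ν b) * (ν d * recip d) ≡⟨ lem₂ (ν d) (ν b) (ν c) (recip d) ⟩
  ν d * (ν b * (ν c * recip d)) ∎))
  where
  open ≡-Reasoning
  lem : ∀ d b a r → d * (b * (a * r)) ≡ (a * d) * (b * r)
  lem = solve-∀ ℚ-ring
  lem₂ : ∀ d b c r → (c * b) * (d * r) ≡ d * (b * (c * r))
  lem₂ = solve-∀ ℚ-ring

-- g n j = ζ(∅)_{j,n}
g : ℕ → ℕ → ℚ
g n j = recip (binom n j)

g-sucˡ : ∀ n j → ν (suc n) * g n j ≡ (ν (suc n) + ν j) * g (suc n) j
g-sucˡ n j = trans (recip-cross (binom-pos n j) (binom-pos (suc n) j) (binom-sucˡ n j)) (cong (_* g (suc n) j) (ν-+ (suc n) j))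

g-sucʳ : ∀ n j → ν (suc j) * g n j ≡ (ν n + ν (suc j)) * g n (suc j)
g-sucʳ n j = trans (recip-cross (binom-pos n j) (binom-pos n (suc j)) (binom-sucʳ n j)) (cong (_* g n (suc j)) (ν-+ n (suc j)))

binom-grows : ∀ n j → suc j ≤ binom (suc n) j
binom-grows zero    j = ℕₚ.≤-reflexive (trans (sym (ℕₚ.+-comm j 1)) (sym (nC1≡n (j ℕ.+ 1))))
binom-grows (suc n) j = ℕₚ.≤-trans (binom-grows n j) (ℕₚ.*-cancelˡ-≤ (suc (suc n)) (begin
  suc (suc n) ℕ.* binom (suc n) j          ≤⟨ ℕₚ.*-monoˡ-≤ (binom (suc n) j) (ℕₚ.m≤m+n (suc (suc n)) j) ⟩
  (suc (suc n) ℕ.+ j) ℕ.* binom (suc n) j  ≡⟨ binom-sucˡ (suc n) j ⟨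
  suc (suc n) ℕ.* binom (suc (suc n)) j    ∎))
  where open ℕₚ.≤-Reasoning

g-decaying : ∀ n → Decaying (g (suc n))
g-decaying n = record
  { nonNeg = λ j → recip-nonNeg (binom (suc n) j)
  ; bound  = λ j → recip-anti (s≤s z≤n) (binom-grows n j) }

central : ℕ → ℚ
central j = g j j

central-decaying : Decaying central
central-decaying = record { nonNeg = λ j → recip-nonNeg (binom j j) ; bound = bd }
  where
  bd : ∀ j → central j ℚ.≤ recip (suc j)
  bd zero    = ℚₚ.≤-refl
  bd (suc j) = Decaying.bound (g-decaying j) (suc j)

g-diag : ∀ n → g n (suc n) ≡ g (suc n) (suc n) + g (suc n) (suc n)
g-diag n = ν-cancel {suc n} (s≤s z≤n) (trans (g-sucˡ n (suc n)) (lem (ν (suc n)) (g (suc n) (suc n))))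
  where
  lem : ∀ a b → (a + a) * b ≡ a * (b + b)
  lem = solve-∀ ℚ-ring

central-suc : ∀ n → ν (suc n) * central n ≡ (ν n + ν (suc n)) * (central (suc n) + central (suc n))
central-suc n = trans (g-sucʳ n n) (cong ((ν n + ν (suc n)) *_) (g-diag n))

-- Sublinear growth of the inner sums

recip≤1 : ∀ n → recip n ℚ.≤ 1ℚ
recip≤1 zero    = ν≤ where
  ν≤ : 0ℚ ℚ.≤ 1ℚ
  ν≤ = ℚₚ.nonNegative⁻¹ 1ℚ
recip≤1 (suc n) = recip-anti {1} {suc n} (s≤s z≤n) (s≤s z≤n)

harmonic≤ : ∀ n N → sumBetween n N recip ℚ.≤ ν N
harmonic≤ n zero    = ν-nonNeg 0
harmonic≤ n (suc N) with interval-cases n N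
... | inj₁ N≤n = subst (ℚ._≤ ν (suc N)) (sym (sum-empty (suc N) recip (s≤s N≤n))) (ν-nonNeg (suc N))
... | inj₂ n<N = begin
  sumBetween n (suc N) recip       ≡⟨ sum-suc recip n<N ⟩
  sumBetween n N recip + recip N   ≤⟨ ℚₚ.+-mono-≤ (harmonic≤ n N) (recip≤1 N) ⟩
  ν N + 1ℚ                         ≡⟨ ℚₚ.+-comm (ν N) 1ℚ ⟩
  1ℚ + ν N                         ≡⟨ ν-suc N ⟨
  ν (suc N)                        ∎
  where open ℚₚ.≤-Reasoning

ν*recip≤1 : ∀ {c n} → c ≤ n → ν c * recip n ℚ.≤ 1ℚ
ν*recip≤1 {c} {zero} z≤n = ℚₚ.≤-trans (ℚₚ.≤-reflexive (ℚₚ.*-zeroʳ (ν c))) (recip≤1 0)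
ν*recip≤1 {c} {suc n} c≤n = ℚₚ.≤-trans
  (ℚₚ.*-monoʳ-≤-nonNeg (recip (suc n)) ⦃ ℚ.nonNegative (recip-nonNeg (suc n)) ⦄ (ν-mono c≤n))
  (ℚₚ.≤-reflexive (recip-inverse (suc n) (s≤s z≤n)))

-- C H_N = o(N) with an explicit constant: a term C/j with j ≥ C is at most 1.
harmonic-small : ∀ n c N → ν c * sumBetween n N recip ℚ.≤ ν N + ν (c ℕ.* c)
harmonic-small n c N with interval-cases c N
... | inj₁ N≤c = begin
  ν c * sumBetween n N recip ≤⟨ *-monoˡ (ν c) (ν-nonNeg c) (ℚₚ.≤-trans (harmonic≤ n N) (ν-mono N≤c)) ⟩
  ν c * ν c                  ≡⟨ ν-* c c ⟨
  ν (c ℕ.* c)                ≡⟨ ℚₚ.+-identityˡ _ ⟨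
  0ℚ + ν (c ℕ.* c)           ≤⟨ ℚₚ.+-monoˡ-≤ (ν (c ℕ.* c)) (ν-nonNeg N) ⟩
  ν N + ν (c ℕ.* c)          ∎
  where open ℚₚ.≤-Reasoning
harmonic-small n c (suc N) | inj₂ c≤N with interval-cases n N
... | inj₁ N≤n = begin
  ν c * sumBetween n (suc N) recip ≡⟨ cong (ν c *_) (sum-empty (suc N) recip (s≤s N≤n)) ⟩
  ν c * 0ℚ                   ≡⟨ ℚₚ.*-zeroʳ (ν c) ⟩
  0ℚ                         ≤⟨ +-nonNeg (ν-nonNeg (suc N)) (ν-nonNeg (c ℕ.* c)) ⟩
  ν (suc N) + ν (c ℕ.* c)    ∎
  where open ℚₚ.≤-Reasoning
... | inj₂ n<N = begin
  ν c * sumBetween n (suc N) recip           ≡⟨ cong (ν c *_) (sum-suc recip n<N) ⟩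
  ν c * (sumBetween n N recip + recip N)     ≡⟨ ℚₚ.*-distribˡ-+ (ν c) _ (recip N) ⟩
  ν c * sumBetween n N recip + ν c * recip N ≤⟨ ℚₚ.+-mono-≤ (harmonic-small n c N) (ν*recip≤1 (ℕₚ.≤-pred c≤N)) ⟩
  ν N + ν (c ℕ.* c) + 1ℚ                     ≡⟨ lem (ν N) (ν (c ℕ.* c)) ⟩
  (1ℚ + ν N) + ν (c ℕ.* c)                   ≡⟨ cong (_+ ν (c ℕ.* c)) (ν-suc N) ⟨
  ν (suc N) + ν (c ℕ.* c)                    ∎
  where
  open ℚₚ.≤-Reasoning
  lem : ∀ a b → a + b + 1ℚ ≡ (1ℚ + a) + b
  lem = solve-∀ ℚ-ring

inner-nonNeg : ∀ as n N → 0ℚ ℚ.≤ inner as n N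
inner-nonNeg []       n N = recip≤1 0
inner-nonNeg (a ∷ as) n N = sum-nonNeg N _ (λ j → *-nonNeg (recip-nonNeg (j ℕ.^ a)) (inner-nonNeg as n j))

-- This is o(N) written with explicit constants; it replaces the true growth, a power of log N, and
-- suffices against a factor 1/N.
inner-sublinear : ∀ {as} → Positive as → ∀ n q → Σ ℕ λ c → ∀ N → ν q * inner as n N ℚ.≤ ν N + ν c
inner-sublinear [] n q = q , λ N → ℚₚ.≤-trans
  (ℚₚ.≤-reflexive (trans (ℚₚ.*-identityʳ (ν q)) (sym (ℚₚ.+-identityˡ (ν q)))))
  (ℚₚ.+-monoˡ-≤ (ν q) (ν-nonNeg N))
-- With 2q at the previous depth each term is at most 1 + c/j. These add up to N + c H_N, hence to
-- at most 2N + c²; halving returns to q.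
inner-sublinear {a ∷ as} (1≤a ∷ p) n q with inner-sublinear p n (q ℕ.+ q)
... | c , ih = c ℕ.* c , λ N → ν-cancel-≤ {2} (s≤s z≤n) (bound N)
  where
  open ℚₚ.≤-Reasoning
  lem₁ : ∀ q r x → (q + q) * (r * x) ≡ r * ((q + q) * x)
  lem₁ = solve-∀ ℚ-ring
  term : ∀ j → 1 ≤ j → ν (q ℕ.+ q) * (recip (j ℕ.^ a) * inner as n j) ℚ.≤ 1ℚ + ν c * recip j
  term j 1≤j = begin
    ν (q ℕ.+ q) * (recip (j ℕ.^ a) * inner as n j) ≡⟨ cong (_* (recip (j ℕ.^ a) * inner as n j)) (ν-+ q q) ⟩
    (ν q + ν q) * (recip (j ℕ.^ a) * inner as n j) ≡⟨ lem₁ (ν q) (recip (j ℕ.^ a)) (inner as n j) ⟩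
    recip (j ℕ.^ a) * ((ν q + ν q) * inner as n j) ≡⟨ cong (λ x → recip (j ℕ.^ a) * (x * inner as n j)) (ν-+ q q) ⟨
    recip (j ℕ.^ a) * (ν (q ℕ.+ q) * inner as n j) ≤⟨ *-mono-≤ (*-nonNeg (ν-nonNeg (q ℕ.+ q)) (inner-nonNeg as n j)) (recip-nonNeg j) (recip-^≤recip j a 1≤j 1≤a) (ih j) ⟩
    recip j * (ν j + ν c)                          ≡⟨ lem₂ (recip j) (ν j) (ν c) ⟩
    ν j * recip j + ν c * recip j                  ≡⟨ cong (_+ ν c * recip j) (recip-inverse j 1≤j) ⟩
    1ℚ + ν c * recip j                             ∎
    where
    lem₂ : ∀ r j c → r * (j + c) ≡ j * r + c * r
    lem₂ = solve-∀ ℚ-ring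
  sum≤ : ∀ N → ν (q ℕ.+ q) * inner (a ∷ as) n N ℚ.≤ ν N + ν c * sumBetween n N recip
  sum≤ zero = ℚₚ.≤-reflexive (trans (ℚₚ.*-zeroʳ (ν (q ℕ.+ q))) (sym (trans (cong₂ _+_ ι-0 (ℚₚ.*-zeroʳ (ν c))) refl)))
  sum≤ (suc N) with interval-cases n N
  ... | inj₁ N≤n = begin
    ν (q ℕ.+ q) * inner (a ∷ as) n (suc N) ≡⟨ cong (ν (q ℕ.+ q) *_) (sum-empty (suc N) (λ j → recip (j ℕ.^ a) * inner as n j) (s≤s N≤n)) ⟩
    ν (q ℕ.+ q) * 0ℚ                       ≡⟨ ℚₚ.*-zeroʳ (ν (q ℕ.+ q)) ⟩
    0ℚ                                     ≤⟨ +-nonNeg (ν-nonNeg (suc N)) (*-nonNeg (ν-nonNeg c) (sum-nonNeg (suc N) recip recip-nonNeg)) ⟩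
    ν (suc N) + ν c * sumBetween n (suc N) recip ∎
  ... | inj₂ n<N = begin
    ν (q ℕ.+ q) * inner (a ∷ as) n (suc N) ≡⟨ cong (ν (q ℕ.+ q) *_) (sum-suc (λ j → recip (j ℕ.^ a) * inner as n j) n<N) ⟩
    ν (q ℕ.+ q) * (inner (a ∷ as) n N + recip (N ℕ.^ a) * inner as n N) ≡⟨ ℚₚ.*-distribˡ-+ (ν (q ℕ.+ q)) (inner (a ∷ as) n N) (recip (N ℕ.^ a) * inner as n N) ⟩
    ν (q ℕ.+ q) * inner (a ∷ as) n N + ν (q ℕ.+ q) * (recip (N ℕ.^ a) * inner as n N) ≤⟨ ℚₚ.+-mono-≤ (sum≤ N) (term N (ℕₚ.≤-trans (s≤s z≤n) n<N)) ⟩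
    (ν N + ν c * sumBetween n N recip) + (1ℚ + ν c * recip N) ≡⟨ lem₃ (ν N) (ν c) (sumBetween n N recip) (recip N) ⟩
    (1ℚ + ν N) + ν c * (sumBetween n N recip + recip N) ≡⟨ cong₂ (λ x y → x + ν c * y) (ν-suc N) (sum-suc recip n<N) ⟨
    ν (suc N) + ν c * sumBetween n (suc N) recip ∎
    where
    lem₃ : ∀ a c s r → (a + c * s) + (1ℚ + c * r) ≡ (1ℚ + a) + c * (s + r)
    lem₃ = solve-∀ ℚ-ring
  ν2 : ∀ x → ν 2 * x ≡ x + x
  ν2 x = trans (cong (_* x) (trans (ν-suc 1) (cong (λ y → 1ℚ + y) ι-1))) (lem x)
    where
    lem : ∀ x → (1ℚ + 1ℚ) * x ≡ x + x
    lem = solve-∀ ℚ-ring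
  bound : ∀ N → ν 2 * (ν q * inner (a ∷ as) n N) ℚ.≤ ν 2 * (ν N + ν (c ℕ.* c))
  bound N = begin
    ν 2 * (ν q * inner (a ∷ as) n N)           ≡⟨ ν2 _ ⟩
    ν q * inner (a ∷ as) n N + ν q * inner (a ∷ as) n N ≡⟨ ℚₚ.*-distribʳ-+ (inner (a ∷ as) n N) (ν q) (ν q) ⟨
    (ν q + ν q) * inner (a ∷ as) n N           ≡⟨ cong (_* inner (a ∷ as) n N) (ν-+ q q) ⟨
    ν (q ℕ.+ q) * inner (a ∷ as) n N           ≤⟨ sum≤ N ⟩
    ν N + ν c * sumBetween n N recip           ≤⟨ ℚₚ.+-monoʳ-≤ (ν N) (harmonic-small n c N) ⟩
    ν N + (ν N + ν (c ℕ.* c))                  ≡⟨ cong (λ x → ν N + x) (ℚₚ.+-identityˡ _) ⟨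
    ν N + (0ℚ + (ν N + ν (c ℕ.* c)))           ≤⟨ ℚₚ.+-monoʳ-≤ (ν N) (ℚₚ.+-monoˡ-≤ (ν N + ν (c ℕ.* c)) (ν-nonNeg (c ℕ.* c))) ⟩
    ν N + (ν (c ℕ.* c) + (ν N + ν (c ℕ.* c)))  ≡⟨ ℚₚ.+-assoc (ν N) _ _ ⟨
    (ν N + ν (c ℕ.* c)) + (ν N + ν (c ℕ.* c))  ≡⟨ ν2 _ ⟨
    ν 2 * (ν N + ν (c ℕ.* c)) ∎

½<1 : ∀ {ε} → 0ℚ ℚ.< ε → ℚ.½ * ε ℚ.< ε
½<1 {ε} 0<ε = begin-strict
  ℚ.½ * ε            ≡⟨ ℚₚ.+-identityˡ (ℚ.½ * ε) ⟨
  0ℚ + ℚ.½ * ε       <⟨ ℚₚ.+-monoˡ-< (ℚ.½ * ε) (½-pos 0<ε) ⟩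
  ℚ.½ * ε + ℚ.½ * ε  ≡⟨ halve ε ⟩
  ε                  ∎
  where open ℚₚ.≤-Reasoning

Null-recip : ∀ {u} → (∀ p → Σ ℕ λ N₀ → ∀ N → N₀ ≤ N → ∣ u N ∣ ℚ.≤ recip (suc p)) → Null u
Null-recip bd ε 0<ε with archimedean (ℚ.½ * ε) (½-pos 0<ε)
... | p , le with bd p
... | N₀ , b = N₀ , λ N N≥ → ℚₚ.≤-<-trans (ℚₚ.≤-trans (b N N≥) le) (½<1 0<ε)

-- Disposes of the boundary value at the upper end N left by the telescoping of an entry 1: h(N) is
-- O(1/N) and its cofactor is o(N).
remainder-null : ∀ {h as} → Decaying h → Positive as → ∀ m → Null (λ N → h N * Z N (λ _ → 1ℚ) as m)
remainder-null {h} {as} d p m = Null-ext m (λ N m≤N → cong (h N *_) (sym (Z-one N as m m≤N)))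
  (Null-recip λ k → proj₁ (w k) , λ N c≤N → bd k N c≤N)
  where
  open Decaying d
  -- The factor 2(k + 1) makes 2(k + 1) times the term at most 1 + c/(N + 1), which is at most 2
  -- once N ≥ c.
  w = λ k → inner-sublinear p m (suc k ℕ.+ suc k)
  open ℚₚ.≤-Reasoning
  bd : ∀ k N → proj₁ (w k) ≤ N → ∣ h N * inner as m (suc N) ∣ ℚ.≤ recip (suc k)
  bd k N c≤N = ν-cancel-≤ {suc k ℕ.+ suc k} (s≤s z≤n) (begin
    ν (suc k ℕ.+ suc k) * ∣ h N * inner as m (suc N) ∣ ≡⟨ cong (ν (suc k ℕ.+ suc k) *_) (ℚₚ.0≤p⇒∣p∣≡p (*-nonNeg (nonNeg N) (inner-nonNeg as m (suc N)))) ⟩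
    ν (suc k ℕ.+ suc k) * (h N * inner as m (suc N))   ≡⟨ lem₁ (ν (suc k ℕ.+ suc k)) (h N) (inner as m (suc N)) ⟩
    h N * (ν (suc k ℕ.+ suc k) * inner as m (suc N))   ≤⟨ *-mono-≤ (*-nonNeg (ν-nonNeg (suc k ℕ.+ suc k)) (inner-nonNeg as m (suc N))) (recip-nonNeg (suc N)) (bound N) (proj₂ (w k) (suc N)) ⟩
    recip (suc N) * (ν (suc N) + ν c)                  ≡⟨ lem₂ (recip (suc N)) (ν (suc N)) (ν c) ⟩
    ν (suc N) * recip (suc N) + ν c * recip (suc N)    ≤⟨ ℚₚ.+-mono-≤ (ν*recip≤1 {suc N} ℕₚ.≤-refl) (ν*recip≤1 {c} {suc N} (ℕₚ.m≤n⇒m≤1+n c≤N)) ⟩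
    1ℚ + 1ℚ                                            ≡⟨ cong₂ _+_ (recip-inverse (suc k) (s≤s z≤n)) (recip-inverse (suc k) (s≤s z≤n)) ⟨
    ν (suc k) * recip (suc k) + ν (suc k) * recip (suc k) ≡⟨ ℚₚ.*-distribʳ-+ (recip (suc k)) (ν (suc k)) (ν (suc k)) ⟨
    (ν (suc k) + ν (suc k)) * recip (suc k)            ≡⟨ cong (_* recip (suc k)) (ν-+ (suc k) (suc k)) ⟨
    ν (suc k ℕ.+ suc k) * recip (suc k)                ∎)
    where
    c = proj₁ (w k)
    lem₁ : ∀ a b c → a * (b * c) ≡ b * (a * c)
    lem₁ = solve-∀ ℚ-ring
    lem₂ : ∀ r j c → r * (j + c) ≡ j * r + c * r
    lem₂ = solve-∀ ℚ-ring

-- The operations init, mid and fin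

dualWord-++ : ∀ u v → dualWord (u ++ v) ≡ dualWord v ++ dualWord u
dualWord-++ u v = trans (cong (map not) (Lₚ.reverse-++ u v)) (Lₚ.map-++ not (reverse v) (reverse u))

dualWord-replicate : ∀ s → dualWord (replicate s true) ≡ replicate s false
dualWord-replicate zero    = refl
dualWord-replicate (suc s) = begin
  dualWord (replicate (suc s) true)                  ≡⟨ dualWord-++ (true ∷ []) (replicate s true) ⟩
  dualWord (replicate s true) ++ false ∷ []          ≡⟨ cong (_++ false ∷ []) (dualWord-replicate s) ⟩
  replicate s false ++ false ∷ []                    ≡⟨ snoc s ⟩
  replicate (suc s) false                            ∎
  where
  open ≡-Reasoning
  snoc : ∀ s → replicate s false ++ false ∷ [] ≡ false ∷ replicate s false
  snoc zero    = refl
  snoc (suc s) = cong (false ∷_) (snoc s)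

dualWord-involutive : ∀ w → dualWord (dualWord w) ≡ w
dualWord-involutive []      = refl
dualWord-involutive (x ∷ w) = begin
  dualWord (dualWord (x ∷ w))                ≡⟨ cong dualWord (dualWord-++ (x ∷ []) w) ⟩
  dualWord (dualWord w ++ not x ∷ [])        ≡⟨ dualWord-++ (dualWord w) (not x ∷ []) ⟩
  not (not x) ∷ dualWord (dualWord w)        ≡⟨ cong₂ _∷_ (Bₚ.not-involutive x) (dualWord-involutive w) ⟩
  x ∷ w                                      ∎
  where open ≡-Reasoning

fromWord′-block : ∀ c s w → fromWord′ c (replicate s false ++ true ∷ w) ≡ suc (s ℕ.+ c) ∷ fromWord w
fromWord′-block c zero    w = refl
fromWord′-block c (suc s) w = trans (fromWord′-block (suc c) s w) (cong (λ x → suc x ∷ fromWord w) (ℕₚ.+-suc s c))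

fromWord-word : ∀ {a} → Positive a → fromWord (word a) ≡ a
fromWord-word [] = refl
fromWord-word {suc k ∷ as} (1≤k ∷ p) = begin
  fromWord ((replicate k false ++ true ∷ []) ++ word as) ≡⟨ cong fromWord (Lₚ.++-assoc (replicate k false) (true ∷ []) (word as)) ⟩
  fromWord (replicate k false ++ true ∷ word as)         ≡⟨ fromWord′-block 0 k (word as) ⟩
  suc (k ℕ.+ 0) ∷ fromWord (word as)                     ≡⟨ cong₂ (λ x y → suc x ∷ y) (ℕₚ.+-identityʳ k) (fromWord-word p) ⟩
  suc k ∷ as                                             ∎
  where open ≡-Reasoning

fromWord′-++ : ∀ c v w → fromWord′ c (v ++ true ∷ w) ≡ fromWord′ c (v ++ true ∷ []) ++ fromWord w
fromWord′-++ c []          w = refl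
fromWord′-++ c (false ∷ v) w = fromWord′-++ (suc c) v w
fromWord′-++ c (true ∷ v)  w = cong (suc c ∷_) (fromWord′-++ 0 v w)

word-fromWord′ : ∀ c v → word (fromWord′ c (v ++ true ∷ [])) ≡ replicate c false ++ v ++ true ∷ []
word-fromWord′ c []          = Lₚ.++-identityʳ (replicate c false ++ true ∷ [])
word-fromWord′ c (true ∷ v)  = begin
  (replicate c false ++ true ∷ []) ++ word (fromWord (v ++ true ∷ [])) ≡⟨ cong ((replicate c false ++ true ∷ []) ++_) (word-fromWord′ 0 v) ⟩
  (replicate c false ++ true ∷ []) ++ v ++ true ∷ []                   ≡⟨ Lₚ.++-assoc (replicate c false) (true ∷ []) (v ++ true ∷ []) ⟩
  replicate c false ++ true ∷ v ++ true ∷ []                           ∎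
  where open ≡-Reasoning
word-fromWord′ c (false ∷ v) = trans (word-fromWord′ (suc c) v) (move c (v ++ true ∷ []))
  where
  move : ∀ c w → false ∷ replicate c false ++ w ≡ replicate c false ++ false ∷ w
  move zero    w = refl
  move (suc c) w = cong (false ∷_) (move c w)

init-snoc : ∀ x k → init (x ++ k ∷ []) ≡ x
init-snoc []          k = refl
init-snoc (a ∷ [])    k = refl
init-snoc (a ∷ b ∷ x) k = cong (a ∷_) (init-snoc (b ∷ x) k)

-- Deleting the last block 0ˢ1 of the dual word deletes the first block 01ˢ of the word.
fin-word : ∀ {a x} s → Positive x → word x ≡ [] ⊎ Σ (List Bool) (λ w → word x ≡ false ∷ w) →
  word a ≡ false ∷ replicate s true ++ word x → fin a ≡ x
fin-word {a} {x} s pos shape eq = begin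
  fin a                                        ≡⟨⟩
  dual (init (fromWord (dualWord (word a))))   ≡⟨ cong (λ z → dual (init (fromWord z))) dual-eq ⟩
  dual (init (fromWord (u ++ replicate s false ++ true ∷ []))) ≡⟨ cong (λ z → dual (init z)) (split u u-shape) ⟩
  dual (init (fromWord u ++ suc (s ℕ.+ 0) ∷ [])) ≡⟨ cong dual (init-snoc (fromWord u) _) ⟩
  dual (fromWord u)                            ≡⟨ cong (λ z → fromWord (dualWord z)) (word-fromWord u u-shape) ⟩
  fromWord (dualWord (dualWord (word x)))      ≡⟨ cong fromWord (dualWord-involutive (word x)) ⟩
  fromWord (word x)                            ≡⟨ fromWord-word pos ⟩
  x                                            ∎
  where
  open ≡-Reasoning
  u = dualWord (word x)
  dual-eq : dualWord (word a) ≡ u ++ replicate s false ++ true ∷ []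
  dual-eq = begin
    dualWord (word a)                                              ≡⟨ cong dualWord eq ⟩
    dualWord ((false ∷ replicate s true) ++ word x)                ≡⟨ dualWord-++ (false ∷ replicate s true) (word x) ⟩
    u ++ dualWord (false ∷ replicate s true)                       ≡⟨ cong (u ++_) (dualWord-++ (false ∷ []) (replicate s true)) ⟩
    u ++ dualWord (replicate s true) ++ true ∷ []                  ≡⟨ cong (λ z → u ++ z ++ true ∷ []) (dualWord-replicate s) ⟩
    u ++ replicate s false ++ true ∷ []                            ∎
  Ends : List Bool → Set
  Ends u = u ≡ [] ⊎ Σ (List Bool) (λ v → u ≡ v ++ true ∷ [])
  ends : ∀ {z} → z ≡ [] ⊎ Σ (List Bool) (λ w → z ≡ false ∷ w) → Ends (dualWord z)
  ends (inj₁ e)       = inj₁ (cong dualWord e)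
  ends (inj₂ (w , e)) = inj₂ (dualWord w , trans (cong dualWord e) (dualWord-++ (false ∷ []) w))
  u-shape : Ends u
  u-shape = ends shape
  split : ∀ u → Ends u → fromWord (u ++ replicate s false ++ true ∷ []) ≡ fromWord u ++ suc (s ℕ.+ 0) ∷ []
  split .[] (inj₁ refl) = fromWord′-block 0 s []
  split .(v ++ true ∷ []) (inj₂ (v , refl)) = begin
    fromWord ((v ++ true ∷ []) ++ replicate s false ++ true ∷ [])        ≡⟨ cong fromWord (Lₚ.++-assoc v (true ∷ []) _) ⟩
    fromWord (v ++ true ∷ replicate s false ++ true ∷ [])                ≡⟨ fromWord′-++ 0 v _ ⟩
    fromWord (v ++ true ∷ []) ++ fromWord (replicate s false ++ true ∷ []) ≡⟨ cong (fromWord (v ++ true ∷ []) ++_) (fromWord′-block 0 s []) ⟩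
    fromWord (v ++ true ∷ []) ++ suc (s ℕ.+ 0) ∷ []                      ∎
  word-fromWord : ∀ u → Ends u → word (fromWord u) ≡ u
  word-fromWord .[] (inj₁ refl) = refl
  word-fromWord .(v ++ true ∷ []) (inj₂ (v , refl)) = word-fromWord′ 0 v

-- The word of `2 ∷ as` starts with 01ˢ⁺¹, where s counts the leading ones of `as`, and `fin`
-- deletes that block. For a first entry of at least 3 the block is a single 0, and `fin` lowers the
-- entry by one.
dropOnes : Comp → Comp
dropOnes (1 ∷ as) = dropOnes as
dropOnes as       = as

leadingOnes : Comp → ℕ
leadingOnes (1 ∷ as) = suc (leadingOnes as)
leadingOnes _        = 0

dropOnes-positive : ∀ {as} → Positive as → Positive (dropOnes as)
dropOnes-positive []                          = []
dropOnes-positive {suc zero ∷ as} (_ ∷ p)     = dropOnes-positive p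
dropOnes-positive {suc (suc a) ∷ as} (q ∷ p)  = q ∷ p

dropOnes-admissible : ∀ {as} → Positive as → Admissible (dropOnes as)
dropOnes-admissible []                          = adm-[]
dropOnes-admissible {suc zero ∷ as} (_ ∷ p)     = dropOnes-admissible p
dropOnes-admissible {suc (suc a) ∷ as} (q ∷ p)  = adm-∷ (s≤s (s≤s z≤n)) p

dropOnes-weight : ∀ as → weight as ≡ leadingOnes as ℕ.+ weight (dropOnes as)
dropOnes-weight []                   = refl
dropOnes-weight (zero ∷ as)          = refl
dropOnes-weight (suc zero ∷ as)      = cong suc (dropOnes-weight as)
dropOnes-weight (suc (suc a) ∷ as)   = refl

dropOnes-word : ∀ {as} → Positive as → word as ≡ replicate (leadingOnes as) true ++ word (dropOnes as)
dropOnes-word []                          = refl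
dropOnes-word {suc zero ∷ as} (_ ∷ p)     = cong (true ∷_) (dropOnes-word p)
dropOnes-word {suc (suc a) ∷ as} (q ∷ p)  = refl

dropOnes-shape : ∀ {as} → Positive as → word (dropOnes as) ≡ [] ⊎ Σ (List Bool) (λ w → word (dropOnes as) ≡ false ∷ w)
dropOnes-shape []                          = inj₁ refl
dropOnes-shape {suc zero ∷ as} (_ ∷ p)     = dropOnes-shape p
dropOnes-shape {suc (suc a) ∷ as} (q ∷ p)  = inj₂ (_ , refl)

init-dropOnes : ∀ as → init (dropOnes as) ≡ dropOnes (init as)
init-dropOnes []                        = refl
init-dropOnes (zero ∷ [])               = refl
init-dropOnes (zero ∷ b ∷ bs)           = refl
init-dropOnes (suc zero ∷ [])           = refl
init-dropOnes (suc zero ∷ b ∷ bs)       = init-dropOnes (b ∷ bs)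
init-dropOnes (suc (suc a) ∷ [])        = refl
init-dropOnes (suc (suc a) ∷ b ∷ bs)    = refl

fin-2 : ∀ {as} → Positive as → fin (2 ∷ as) ≡ dropOnes as
fin-2 {as} p = fin-word {2 ∷ as} (suc (leadingOnes as)) (dropOnes-positive p) (dropOnes-shape p) (cong (λ w → false ∷ true ∷ w) (dropOnes-word p))

fin-3 : ∀ {k as} → Positive as → fin (suc (suc (suc k)) ∷ as) ≡ suc (suc k) ∷ as
fin-3 {k} {as} p = fin-word {suc (suc (suc k)) ∷ as} 0 (s≤s z≤n ∷ p) (inj₂ (_ , refl)) refl

init-positive : ∀ {as} → Positive as → Positive (init as)
init-positive []            = []
init-positive (_ ∷ [])      = []
init-positive (q ∷ r ∷ p)   = q ∷ init-positive (r ∷ p)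

init-admissible : ∀ {a} → Admissible a → Admissible (init a)
init-admissible adm-[]                 = adm-[]
init-admissible (adm-∷ q [])           = adm-[]
init-admissible (adm-∷ q (r ∷ p))      = adm-∷ q (init-positive (r ∷ p))

fin-admissible : ∀ {a} → Admissible a → Admissible (fin a)
fin-admissible adm-[] = adm-[]
fin-admissible {suc (suc zero) ∷ as} (adm-∷ q p)     = subst Admissible (sym (fin-2 p)) (dropOnes-admissible p)
fin-admissible {suc (suc (suc k)) ∷ as} (adm-∷ q p)  = subst Admissible (sym (fin-3 {k} p)) (adm-∷ (s≤s (s≤s z≤n)) p)
fin-admissible {suc zero ∷ as} (adm-∷ (s≤s ()) p)

-- Deleting at the two ends of the word commutes. `mid` is defined as init of fin, but the recursion
-- meets it as fin of init.
mid≡fin-init : ∀ {a} → Admissible a → mid a ≡ fin (init a)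
mid≡fin-init adm-[] = refl
mid≡fin-init {suc zero ∷ as} (adm-∷ (s≤s ()) p)
mid≡fin-init {suc (suc zero) ∷ []} (adm-∷ q p) = refl
mid≡fin-init {suc (suc zero) ∷ b ∷ bs} (adm-∷ q p) =
  trans (cong init (fin-2 p)) (trans (init-dropOnes (b ∷ bs)) (sym (fin-2 (init-positive p))))
mid≡fin-init {suc (suc (suc k)) ∷ []} (adm-∷ q p) = cong init (fin-3 {k} p)
mid≡fin-init {suc (suc (suc k)) ∷ b ∷ bs} (adm-∷ q p) =
  trans (cong init (fin-3 {k} p)) (sym (fin-3 {k} (init-positive p)))

weight-fin-≤ : ∀ {a} → Admissible a → weight (fin a) ≤ weight a
weight-fin-≤ adm-[] = z≤n
weight-fin-≤ {suc zero ∷ as} (adm-∷ (s≤s ()) p)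
weight-fin-≤ {suc (suc zero) ∷ as} (adm-∷ q p) rewrite fin-2 p | dropOnes-weight as =
  ℕₚ.m≤n+m (weight (dropOnes as)) (2 ℕ.+ leadingOnes as)
weight-fin-≤ {suc (suc (suc k)) ∷ as} (adm-∷ q p) rewrite fin-3 {k} p = ℕₚ.n≤1+n _

weight-fin-< : ∀ {a as} → Admissible (a ∷ as) → weight (fin (a ∷ as)) < weight (a ∷ as)
weight-fin-< {suc zero} (adm-∷ (s≤s ()) p)
weight-fin-< {suc (suc zero)} {as} (adm-∷ q p) rewrite fin-2 p | dropOnes-weight as =
  s≤s (ℕₚ.m≤n+m (weight (dropOnes as)) (1 ℕ.+ leadingOnes as))
weight-fin-< {suc (suc (suc k))} {as} (adm-∷ q p) rewrite fin-3 {k} p = ℕₚ.≤-refl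

last : ℕ → Comp → ℕ
last a []       = a
last a (b ∷ bs) = last b bs

init-last : ∀ a as → a ∷ as ≡ init (a ∷ as) ++ last a as ∷ []
init-last a []       = refl
init-last a (b ∷ bs) = cong (a ∷_) (init-last b bs)

weight-init : ∀ a as → weight (a ∷ as) ≡ weight (init (a ∷ as)) ℕ.+ last a as
weight-init a []       = ℕₚ.+-identityʳ a
weight-init a (b ∷ bs) = trans (cong (a ℕ.+_) (weight-init b bs)) (sym (ℕₚ.+-assoc a _ _))

last-positive : ∀ {a as} → Positive (a ∷ as) → 1 ≤ last a as
last-positive (q ∷ [])     = q
last-positive (q ∷ r ∷ p)  = last-positive (r ∷ p)

-- Recursions for the double tails

-- The factor j on the right cancels one power of 1/j in the outermost sum, so lowering the
-- connector trades one unit of the first exponent for 1/(n + 1).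
g-split : ∀ n j → g n j ≡ g (suc n) j + recip (suc n) * ν j * g (suc n) j
g-split n j = ν-cancel {suc n} (s≤s z≤n) (begin
  ν (suc n) * g n j                           ≡⟨ g-sucˡ n j ⟩
  (ν (suc n) + ν j) * g (suc n) j             ≡⟨ lem₁ (ν (suc n)) (ν j) (g (suc n) j) ⟩
  ν (suc n) * g (suc n) j + 1ℚ * ν j * g (suc n) j ≡⟨ cong (λ x → ν (suc n) * g (suc n) j + x * ν j * g (suc n) j) (recip-inverse (suc n) (s≤s z≤n)) ⟨
  ν (suc n) * g (suc n) j + ν (suc n) * recip (suc n) * ν j * g (suc n) j ≡⟨ lem₂ (ν (suc n)) (recip (suc n)) (ν j) (g (suc n) j) ⟩
  ν (suc n) * (g (suc n) j + recip (suc n) * ν j * g (suc n) j) ∎)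
  where
  open ≡-Reasoning
  lem₁ : ∀ s j x → (s + j) * x ≡ s * x + 1ℚ * j * x
  lem₁ = solve-∀ ℚ-ring
  lem₂ : ∀ s r j x → s * x + s * r * j * x ≡ s * (x + r * j * x)
  lem₂ = solve-∀ ℚ-ring

A-g-split : ∀ N k n m → A N (suc k) (g n) m ≡ 1ℚ * A N (suc k) (g (suc n)) m + recip (suc n) * A N k (g (suc n)) m
A-g-split N k n m = trans (sum-cong (suc N) term)
  (sum-lin (suc N) 1ℚ (recip (suc n)) (λ j → recip (j ℕ.^ suc k) * g (suc n) j) (λ j → recip (j ℕ.^ k) * g (suc n) j))
  where
  open ≡-Reasoning
  lem₁ : ∀ r R s j x → (r * R) * (x + s * j * x) ≡ 1ℚ * ((r * R) * x) + s * (j * r) * (R * x)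
  lem₁ = solve-∀ ℚ-ring
  lem₂ : ∀ p s R x → 1ℚ * (p * x) + s * 1ℚ * (R * x) ≡ 1ℚ * (p * x) + s * (R * x)
  lem₂ = solve-∀ ℚ-ring
  term : ∀ j → m < j → j < suc N → recip (j ℕ.^ suc k) * g n j ≡
    1ℚ * (recip (j ℕ.^ suc k) * g (suc n) j) + recip (suc n) * (recip (j ℕ.^ k) * g (suc n) j)
  term j m<j _ = begin
    recip (j ℕ.^ suc k) * g n j ≡⟨ cong₂ _*_ (recip-* j (j ℕ.^ k)) (g-split n j) ⟩
    (r * R) * (x + s * ν j * x) ≡⟨ lem₁ r R s (ν j) x ⟩
    1ℚ * ((r * R) * x) + s * (ν j * r) * (R * x) ≡⟨ cong₂ (λ u v → 1ℚ * (u * x) + s * v * (R * x)) (sym (recip-* j (j ℕ.^ k))) (recip-inverse j (ℕₚ.≤-trans (s≤s z≤n) m<j)) ⟩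
    1ℚ * (recip (j ℕ.^ suc k) * x) + s * 1ℚ * (R * x) ≡⟨ lem₂ (recip (j ℕ.^ suc k)) s R x ⟩
    1ℚ * (recip (j ℕ.^ suc k) * x) + s * (R * x) ∎
    where
    r = recip j
    R = recip (j ℕ.^ k)
    s = recip (suc n)
    x = g (suc n) j

Z-g-split : ∀ {N} n k as m → m ≤ N →
  Z N (g n) (suc k ∷ as) m ≡ 1ℚ * Z N (g (suc n)) (suc k ∷ as) m + recip (suc n) * Z N (g (suc n)) (k ∷ as) m
Z-g-split {N} n k as m m≤N = trans
  (Z-cong as (λ j _ → A-g-split N k n j) m m≤N)
  (Z-lin as 1ℚ (recip (suc n)) (A N (suc k) (g (suc n))) (A N k (g (suc n))) m m≤N)

-- Telescoping: with h = `g (suc n)`, h(j)/j = (h(j - 1) - h(j))/(n + 1). The boundary value h(N) is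
-- written as a multiple of the constant function 1, so that `Z-lin` carries it through the
-- remaining entries.
A-one : ∀ {N} n m → m ≤ N → A N 1 (g (suc n)) m ≡ recip (suc n) * g (suc n) m + (- recip (suc n) * g (suc n) N) * 1ℚ
A-one {N} n m m≤N = sum-elim {m} (λ M → sumBetween m M f ≡ s * h m + (- s * h (ℕ.pred M)) * 1ℚ) base step (suc N) (s≤s m≤N)
  where
  open ≡-Reasoning
  h = g (suc n)
  s = recip (suc n)
  f : ℕ → ℚ
  f j = recip (j ℕ.^ 1) * h j
  lem₀ : ∀ s x → 0ℚ ≡ s * x + (- s * x) * 1ℚ
  lem₀ = solve-∀ ℚ-ring
  base = trans (sum-empty (suc m) f ℕₚ.≤-refl) (lem₀ s (h m))
  r-h : ∀ M → h M ≡ (ν (suc n) * recip (suc M) + 1ℚ) * h (suc M)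
  r-h M = ν-cancel {suc M} (s≤s z≤n) (begin
    ν (suc M) * h M                           ≡⟨ g-sucʳ (suc n) M ⟩
    (ν (suc n) + ν (suc M)) * h (suc M)       ≡⟨ lem (ν (suc n)) (ν (suc M)) (h (suc M)) ⟩
    (1ℚ * ν (suc n) + ν (suc M)) * h (suc M)  ≡⟨ cong (λ x → (x * ν (suc n) + ν (suc M)) * h (suc M)) (recip-inverse (suc M) (s≤s z≤n)) ⟨
    (ν (suc M) * recip (suc M) * ν (suc n) + ν (suc M)) * h (suc M) ≡⟨ lem′ (ν (suc M)) (recip (suc M)) (ν (suc n)) (h (suc M)) ⟩
    ν (suc M) * ((ν (suc n) * recip (suc M) + 1ℚ) * h (suc M)) ∎)
    where
    lem : ∀ a b c → (a + b) * c ≡ (1ℚ * a + b) * c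
    lem = solve-∀ ℚ-ring
    lem′ : ∀ M r n x → (M * r * n + M) * x ≡ M * ((n * r + 1ℚ) * x)
    lem′ = solve-∀ ℚ-ring
  lem₁ : ∀ s c a R x → s * c + (- s * ((a * R + 1ℚ) * x)) * 1ℚ + R * x ≡ s * c + (- s * x) * 1ℚ + (1ℚ - a * s) * (R * x)
  lem₁ = solve-∀ ℚ-ring
  lem₂ : ∀ c y → c + (1ℚ - 1ℚ) * y ≡ c
  lem₂ = solve-∀ ℚ-ring
  step : ∀ M → m < M → sumBetween m M f ≡ s * h m + (- s * h (ℕ.pred M)) * 1ℚ → sumBetween m (suc M) f ≡ s * h m + (- s * h M) * 1ℚ
  step (suc M) m<M ih = begin
    sumBetween m (suc (suc M)) f                                     ≡⟨ sum-suc f m<M ⟩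
    sumBetween m (suc M) f + f (suc M)                               ≡⟨ cong₂ (λ x y → x + recip y * h (suc M)) ih (ℕₚ.*-identityʳ (suc M)) ⟩
    s * h m + (- s * h M) * 1ℚ + recip (suc M) * h (suc M)           ≡⟨ cong (λ x → s * h m + (- s * x) * 1ℚ + recip (suc M) * h (suc M)) (r-h M) ⟩
    s * h m + (- s * ((ν (suc n) * recip (suc M) + 1ℚ) * h (suc M))) * 1ℚ + recip (suc M) * h (suc M) ≡⟨ lem₁ s (h m) (ν (suc n)) (recip (suc M)) (h (suc M)) ⟩
    s * h m + (- s * h (suc M)) * 1ℚ + (1ℚ - ν (suc n) * s) * (recip (suc M) * h (suc M)) ≡⟨ cong (λ x → s * h m + (- s * h (suc M)) * 1ℚ + (1ℚ - x) * (recip (suc M) * h (suc M))) (recip-inverse (suc n) (s≤s z≤n)) ⟩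
    s * h m + (- s * h (suc M)) * 1ℚ + (1ℚ - 1ℚ) * (recip (suc M) * h (suc M)) ≡⟨ lem₂ (s * h m + (- s * h (suc M)) * 1ℚ) (recip (suc M) * h (suc M)) ⟩
    s * h m + (- s * h (suc M)) * 1ℚ ∎

Z-one-null : ∀ n {as} → Positive as → ∀ m →
  Null (λ N → Z N (g (suc n)) (1 ∷ as) m - recip (suc n) * Z N (g (suc n)) as m)
Z-one-null n {as} p m = Null-ext m (λ N m≤N → sym (eq N m≤N)) (Null-scale (- recip (suc n)) (remainder-null (g-decaying n) p m))
  where
  lem : ∀ s x c y → s * x + (- s * c) * y - s * x ≡ - s * (c * y)
  lem = solve-∀ ℚ-ring
  eq : ∀ N → m ≤ N → Z N (g (suc n)) (1 ∷ as) m - recip (suc n) * Z N (g (suc n)) as m ≡ - recip (suc n) * (g (suc n) N * Z N (λ _ → 1ℚ) as m)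
  eq N m≤N = trans
    (cong (_- recip (suc n) * Z N (g (suc n)) as m)
      (trans (Z-cong as (λ j j≤N → A-one n j j≤N) m m≤N)
             (Z-lin as (recip (suc n)) (- recip (suc n) * g (suc n) N) (g (suc n)) (λ _ → 1ℚ) m m≤N)))
    (lem (recip (suc n)) (Z N (g (suc n)) as m) (g (suc n) N) (Z N (λ _ → 1ℚ) as m))

Z-ones-null : ∀ n {as} → Positive as → ∀ m →
  Null (λ N → Z N (g (suc n)) (1 ∷ as) m - recip (suc n ℕ.^ suc (leadingOnes as)) * Z N (g (suc n)) (dropOnes as) m)
Z-ones-null n [] m = Null-ext 0 (λ N _ → cong (λ x → Z N (g (suc n)) (1 ∷ []) m - recip x * g (suc n) m) (sym (ℕₚ.*-identityʳ (suc n)))) (Z-one-null n [] m)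
Z-ones-null n {suc zero ∷ as} (q ∷ p) m = Null-ext 0 (λ N _ → eq N)
  (Null-+ (Z-one-null n (q ∷ p) m) (Null-scale (recip (suc n)) (Z-ones-null n p m)))
  where
  lem : ∀ x s y e z → x - s * y + s * (y - e * z) ≡ x - (s * e) * z
  lem = solve-∀ ℚ-ring
  e = suc n ℕ.^ suc (leadingOnes as)
  eq : ∀ N → _
  eq N = trans (lem (Z N (g (suc n)) (1 ∷ 1 ∷ as) m) (recip (suc n)) (Z N (g (suc n)) (1 ∷ as) m) (recip e) (Z N (g (suc n)) (dropOnes as) m))
    (cong (λ x → Z N (g (suc n)) (1 ∷ 1 ∷ as) m - x * Z N (g (suc n)) (dropOnes as) m) (sym (recip-* (suc n) e)))
Z-ones-null n {suc (suc a) ∷ as} (q ∷ p) m = Null-ext 0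
  (λ N _ → cong (λ x → Z N (g (suc n)) (1 ∷ suc (suc a) ∷ as) m - recip x * Z N (g (suc n)) (suc (suc a) ∷ as) m) (sym (ℕₚ.*-identityʳ (suc n)))) (Z-one-null n (q ∷ p) m)

-- For a first entry of at least 3 this is `g-split`, exact at every truncation N ≥ m. For a first
-- entry 2, the lowered entry 1 heads a run of ones, each of which telescopes away at the cost of
-- 1/(n + 1) and a null remainder; the exponents add up to the loss of weight.
fin-recursion : ∀ {a as} → Admissible (a ∷ as) → ∀ n m →
  Null (λ N → Z N (g n) (a ∷ as) m - Z N (g (suc n)) (a ∷ as) m
            - recip (suc n ℕ.^ (weight (a ∷ as) ∸ weight (fin (a ∷ as)))) * Z N (g (suc n)) (fin (a ∷ as)) m)
fin-recursion {suc zero} (adm-∷ (s≤s ()) p)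
fin-recursion {suc (suc zero)} {as} (adm-∷ q p) n m =
  Null-ext m eq (Null-scale (recip (suc n)) (Z-ones-null n p m))
  where
  open ≡-Reasoning
  e = suc n ℕ.^ suc (leadingOnes as)
  exponent : weight (2 ∷ as) ∸ weight (dropOnes as) ≡ suc (suc (leadingOnes as))
  exponent = trans (cong (λ x → 2 ℕ.+ x ∸ weight (dropOnes as)) (dropOnes-weight as)) (ℕₚ.m+n∸n≡m (suc (suc (leadingOnes as))) (weight (dropOnes as)))
  lem : ∀ x s y e z → s * (y - e * z) ≡ 1ℚ * x + s * y - x - (s * e) * z
  lem = solve-∀ ℚ-ring
  eq : ∀ N → m ≤ N → recip (suc n) * (Z N (g (suc n)) (1 ∷ as) m - recip e * Z N (g (suc n)) (dropOnes as) m) ≡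
    Z N (g n) (2 ∷ as) m - Z N (g (suc n)) (2 ∷ as) m
            - recip (suc n ℕ.^ (weight (2 ∷ as) ∸ weight (fin (2 ∷ as)))) * Z N (g (suc n)) (fin (2 ∷ as)) m
  eq N m≤N = begin
    recip (suc n) * (Z N (g (suc n)) (1 ∷ as) m - recip e * Z N (g (suc n)) (dropOnes as) m)
      ≡⟨ lem (Z N (g (suc n)) (2 ∷ as) m) (recip (suc n)) (Z N (g (suc n)) (1 ∷ as) m) (recip e) (Z N (g (suc n)) (dropOnes as) m) ⟩
    1ℚ * Z N (g (suc n)) (2 ∷ as) m + recip (suc n) * Z N (g (suc n)) (1 ∷ as) m - Z N (g (suc n)) (2 ∷ as) m - (recip (suc n) * recip e) * Z N (g (suc n)) (dropOnes as) m
      ≡⟨ cong₂ (λ x y → x - Z N (g (suc n)) (2 ∷ as) m - y * Z N (g (suc n)) (dropOnes as) m) (Z-g-split n 1 as m m≤N) (trans (cong (λ x → recip (suc n ℕ.^ x)) exponent) (recip-* (suc n) e)) ⟨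
    Z N (g n) (2 ∷ as) m - Z N (g (suc n)) (2 ∷ as) m - recip (suc n ℕ.^ (weight (2 ∷ as) ∸ weight (dropOnes as))) * Z N (g (suc n)) (dropOnes as) m
      ≡⟨ cong (λ b → Z N (g n) (2 ∷ as) m - Z N (g (suc n)) (2 ∷ as) m - recip (suc n ℕ.^ (weight (2 ∷ as) ∸ weight b)) * Z N (g (suc n)) b m) (fin-2 p) ⟨
    Z N (g n) (2 ∷ as) m - Z N (g (suc n)) (2 ∷ as) m
            - recip (suc n ℕ.^ (weight (2 ∷ as) ∸ weight (fin (2 ∷ as)))) * Z N (g (suc n)) (fin (2 ∷ as)) m ∎
fin-recursion {a@(suc k@(suc (suc k′)))} {as} (adm-∷ q p) n m = Null-ext m eq Null-0
  where
  open ≡-Reasoning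
  lem : ∀ x s y → 0ℚ ≡ 1ℚ * x + s * y - x - s * y
  lem = solve-∀ ℚ-ring
  exponent : suc n ℕ.^ (weight (a ∷ as) ∸ weight (k ∷ as)) ≡ suc n
  exponent = trans (cong (suc n ℕ.^_) (ℕₚ.m+n∸n≡m 1 (weight (k ∷ as)))) (ℕₚ.*-identityʳ (suc n))
  eq : ∀ N → m ≤ N → 0ℚ ≡ Z N (g n) (a ∷ as) m - Z N (g (suc n)) (a ∷ as) m
            - recip (suc n ℕ.^ (weight (a ∷ as) ∸ weight (fin (a ∷ as)))) * Z N (g (suc n)) (fin (a ∷ as)) m
  eq N m≤N = begin
    0ℚ ≡⟨ lem (Z N (g (suc n)) (a ∷ as) m) (recip (suc n)) (Z N (g (suc n)) (k ∷ as) m) ⟩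
    1ℚ * Z N (g (suc n)) (a ∷ as) m + recip (suc n) * Z N (g (suc n)) (k ∷ as) m - Z N (g (suc n)) (a ∷ as) m - recip (suc n) * Z N (g (suc n)) (k ∷ as) m
      ≡⟨ cong₂ (λ x y → x - Z N (g (suc n)) (a ∷ as) m - recip y * Z N (g (suc n)) (k ∷ as) m) (Z-g-split n k as m m≤N) exponent ⟨
    Z N (g n) (a ∷ as) m - Z N (g (suc n)) (a ∷ as) m - recip (suc n ℕ.^ (weight (a ∷ as) ∸ weight (k ∷ as))) * Z N (g (suc n)) (k ∷ as) m
      ≡⟨ cong (λ b → Z N (g n) (a ∷ as) m - Z N (g (suc n)) (a ∷ as) m - recip (suc n ℕ.^ (weight (a ∷ as) ∸ weight b)) * Z N (g (suc n)) b m) (fin-3 {k′} p) ⟨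
    Z N (g n) (a ∷ as) m - Z N (g (suc n)) (a ∷ as) m
            - recip (suc n ℕ.^ (weight (a ∷ as) ∸ weight (fin (a ∷ as)))) * Z N (g (suc n)) (fin (a ∷ as)) m ∎

-- The empty composition is its own `fin`, so here the relation reads C(2n+2,n+1) = 2 C(2n+1,n);
-- this case is the reason for restricting to m = n + 1.
fin-recursion-diag : ∀ {a} → Admissible a → ∀ n →
  Null (λ N → Z N (g n) a (suc n) - Z N (g (suc n)) a (suc n)
            - recip (suc n ℕ.^ (weight a ∸ weight (fin a))) * Z N (g (suc n)) (fin a) (suc n))
fin-recursion-diag {[]} adm-[] n = Null-ext 0 (λ N _ → trans (lem (g (suc n) (suc n))) (cong (λ y → y - g (suc n) (suc n) - 1ℚ * g (suc n) (suc n)) (sym (g-diag n)))) Null-0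
  where
  lem : ∀ x → 0ℚ ≡ x + x - x - 1ℚ * x
  lem = solve-∀ ℚ-ring
fin-recursion-diag {a ∷ as} adm n = fin-recursion adm n (suc n)

scaledTail : ℕ → ℕ → ℕ → Comp → ℚ
scaledTail w n N b = recip (n ℕ.^ (w ∸ weight b)) * Z N (g n) b n

recip-^-+ : ∀ n i j → recip (n ℕ.^ (i ℕ.+ j)) ≡ recip (n ℕ.^ i) * recip (n ℕ.^ j)
recip-^-+ n i j = trans (cong recip (ℕₚ.^-distribˡ-+-* n i j)) (recip-* (n ℕ.^ i) (n ℕ.^ j))

-- The path from (n, n) to (n + 1, n + 1) passes through m = n + 1 with connector n. The `init` term
-- split off on the way still carries connector n; moving it to n + 1 yields the `init` term and, in
-- addition, the `mid` term.
ζ-recursion : ∀ {a as} → Admissible (a ∷ as) → ∀ n →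
  Null (λ N → Z N (g n) (a ∷ as) n - Z N (g (suc n)) (a ∷ as) (suc n)
            - (scaledTail (weight (a ∷ as)) (suc n) N (init (a ∷ as)) + scaledTail (weight (a ∷ as)) (suc n) N (mid (a ∷ as)) + scaledTail (weight (a ∷ as)) (suc n) N (fin (a ∷ as))))
ζ-recursion {a₁} {as} adm n = Null-ext (suc n) eq (Null-+ (fin-recursion-diag adm n) (Null-scale (recip (s ℕ.^ k)) (fin-recursion-diag (init-admissible adm) n)))
  where
  open ≡-Reasoning
  a = a₁ ∷ as
  s = suc n
  k = last a₁ as
  w = weight a
  i = init a
  lem : ∀ x′ x F r y′ y R M → (x′ - x - F) + r * (y′ - y - R * M) ≡ (r * y′ + x′) - x - (r * y + (r * R) * M + F)
  lem = solve-∀ ℚ-ring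
  w∸i : w ∸ weight i ≡ k
  w∸i = trans (cong (_∸ weight i) (weight-init a₁ as)) (ℕₚ.m+n∸m≡n (weight i) k)
  w∸m : w ∸ weight (fin i) ≡ k ℕ.+ (weight i ∸ weight (fin i))
  w∸m = trans (cong (_∸ weight (fin i)) (trans (weight-init a₁ as) (ℕₚ.+-comm (weight i) k))) (ℕₚ.+-∸-assoc k (weight-fin-≤ (init-admissible adm)))
  eq : ∀ N → s ≤ N → _ ≡ _
  eq N s≤N = begin
    (Z N (g n) a s - Z N (g s) a s - scaledTail w s N (fin a)) + recip (s ℕ.^ k) * (Z N (g n) i s - Z N (g s) i s - recip (s ℕ.^ (weight i ∸ weight (fin i))) * Z N (g s) (fin i) s)
      ≡⟨ lem (Z N (g n) a s) (Z N (g s) a s) (scaledTail w s N (fin a)) (recip (s ℕ.^ k)) (Z N (g n) i s) (Z N (g s) i s) (recip (s ℕ.^ (weight i ∸ weight (fin i)))) (Z N (g s) (fin i) s) ⟩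
    (recip (s ℕ.^ k) * Z N (g n) i s + Z N (g n) a s) - Z N (g s) a s - (recip (s ℕ.^ k) * Z N (g s) i s + (recip (s ℕ.^ k) * recip (s ℕ.^ (weight i ∸ weight (fin i)))) * Z N (g s) (fin i) s + scaledTail w s N (fin a))
      ≡⟨ cong₂ (λ x y → x - Z N (g s) a s - (y + scaledTail w s N (fin a)))
           (trans (cong (λ b → recip (s ℕ.^ k) * Z N (g n) i s + Z N (g n) b s) (init-last a₁ as))
             (trans (sym (Z-snoc-suc (g n) i k n s≤N)) (cong (λ b → Z N (g n) b n) (sym (init-last a₁ as)))))
           (cong₂ _+_ (cong (λ x → recip (s ℕ.^ x) * Z N (g s) i s) (sym w∸i))
             (trans (cong (_* Z N (g s) (fin i) s) (trans (sym (recip-^-+ s k _)) (cong (λ x → recip (s ℕ.^ x)) (sym w∸m))))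
                    (cong (scaledTail w s N) (sym (mid≡fin-init adm))))) ⟩
    Z N (g n) a n - Z N (g s) a s - (scaledTail w s N i + scaledTail w s N (mid a) + scaledTail w s N (fin a)) ∎

ζpart≡Z : ∀ a n N → n ≤ N → ζpart a n N ≡ Z N (g n) a n
ζpart≡Z []       n N _   = refl
ζpart≡Z (a ∷ as) n N n≤N = sym (trans
  (Z-inner N (λ j → recip (j ℕ.^ a) * g n j) as n n≤N)
  (sum-cong (suc N) (λ j _ _ → cong (_* inner as n j) (ℚₚ.*-comm (recip (j ℕ.^ a)) (g n j)))))

-- Expansion along δ

σ : Comp → ℕ → ℕ → ℚ
σ b n N = Z N central b n

Φ : FSum → ℕ → ℕ → ℚ
Φ []            n N = 0ℚ
Φ ((c , b) ∷ s) n N = ι c * σ b n N + Φ s n N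

Φ-++ : ∀ s t n N → Φ (s ++ t) n N ≡ Φ s n N + Φ t n N
Φ-++ []            t n N = sym (ℚₚ.+-identityˡ (Φ t n N))
Φ-++ ((c , b) ∷ s) t n N = trans (cong (λ x → ι c * σ b n N + x) (Φ-++ s t n N)) (sym (ℚₚ.+-assoc (ι c * σ b n N) (Φ s n N) (Φ t n N)))

Φ-scale : ∀ c s n N → Φ (scale c s) n N ≡ ι c * Φ s n N
Φ-scale c []            n N = sym (ℚₚ.*-zeroʳ (ι c))
Φ-scale c ((d , b) ∷ s) n N = trans
  (cong₂ (λ x y → x * σ b n N + y) (ι-* c d) (Φ-scale c s n N))
  (lem (ι c) (ι d) (σ b n N) (Φ s n N))
  where
  lem : ∀ c d x y → c * d * x + c * y ≡ c * (d * x + y)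
  lem = solve-∀ ℚ-ring

AllKeys : (Comp → Set) → FSum → Set
AllKeys P = All (λ p → P (proj₂ p))

Good : ℕ → ℤ × Comp → Set
Good v (c , b) = Admissible b × weight b ≡ v

-- `F` stands for the anonymous function inside `δ′`, accessible only through its values on pairs.
module _ (w : ℕ) (F : ℤ × Comp → ℤ × Comp) (F-eq : ∀ c b → F (c , b) ≡ (c , extend w b)) where

  -- All keys have weight v, so all receive the same new last entry w - v, and one common power of
  -- 1/(n + 1) comes out.
  Φ-extend : ∀ {v} s → All (Good v) s → ∀ n N → suc n ≤ N →
    Φ (map F s) n N ≡ Φ (map F s) (suc n) N + recip (suc n ℕ.^ (w ∸ v)) * Φ s (suc n) N
  Φ-extend {v} [] [] n N n<N = sym (trans (ℚₚ.+-identityˡ _) (ℚₚ.*-zeroʳ (recip (suc n ℕ.^ (w ∸ v)))))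
  Φ-extend {v} ((c , b) ∷ s) ((_ , refl) ∷ gs) n N n<N rewrite F-eq c b = trans
    (cong₂ (λ x y → ι c * x + y) (Z-snoc-suc central b (w ∸ v) n n<N) (Φ-extend s gs n N n<N))
    (lem (ι c) (recip (suc n ℕ.^ (w ∸ v))) (σ b (suc n) N) (σ (extend w b) (suc n) N) (Φ (map F s) (suc n) N) (Φ s (suc n) N))
    where
    lem : ∀ c r x y z t → c * (r * x + y) + (z + r * t) ≡ (c * y + z) + r * (c * x + t)
    lem = solve-∀ ℚ-ring

  extend-good : ∀ {v} s → 2 ≤ w → v < w → All (Good v) s → All (Good w) (map F s)
  extend-good [] 2≤w v<w [] = []
  extend-good {v} ((c , b) ∷ s) 2≤w v<w ((adm , refl) ∷ gs) rewrite F-eq c b =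
    (admissible adm v<w , weight-extend) ∷ extend-good s 2≤w v<w gs
    where
    snoc-positive : ∀ {as k} → Positive as → 1 ≤ k → Positive (as ++ k ∷ [])
    snoc-positive []      q = q ∷ []
    snoc-positive (r ∷ p) q = r ∷ snoc-positive p q
    admissible : ∀ {b} → Admissible b → weight b < w → Admissible (extend w b)
    admissible adm-[]      _  = adm-∷ 2≤w []
    admissible (adm-∷ q p) lt = adm-∷ q (snoc-positive p (ℕₚ.m<n⇒0<n∸m lt))
    weight-extend : weight (extend w b) ≡ w
    weight-extend = trans (LAₚ.sum-++ b ((w ∸ weight b) ∷ [])) (trans (cong (weight b ℕ.+_) (ℕₚ.+-identityʳ _)) (ℕₚ.m+[n∸m]≡n (ℕₚ.<⇒≤ v<w)))

weight-≥2 : ∀ {a as} → Admissible (a ∷ as) → 2 ≤ weight (a ∷ as)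
weight-≥2 {a} (adm-∷ q p) = ℕₚ.≤-trans q (ℕₚ.m≤m+n a _)

positive : ∀ {a} → Admissible a → Positive a
positive adm-[]      = []
positive (adm-∷ q p) = ℕₚ.≤-trans (s≤s z≤n) q ∷ p

weight-init-≤ : ∀ {a} → weight (init a) ≤ weight a
weight-init-≤ {[]}     = z≤n
weight-init-≤ {a ∷ as} = subst (weight (init (a ∷ as)) ≤_) (sym (weight-init a as)) (ℕₚ.m≤m+n _ (last a as))

weight-init-< : ∀ {a as} → Admissible (a ∷ as) → weight (init (a ∷ as)) < weight (a ∷ as)
weight-init-< {a} {as} adm = subst (weight (init (a ∷ as)) <_) (sym (weight-init a as)) (ℕₚ.m<m+n _ (last-positive (positive adm)))

weight-mid-< : ∀ {a as} → Admissible (a ∷ as) → weight (mid (a ∷ as)) < weight (a ∷ as)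
weight-mid-< {a} {as} adm = ℕₚ.≤-<-trans (weight-init-≤ {fin (a ∷ as)}) (weight-fin-< adm)

mid-admissible : ∀ {a} → Admissible a → Admissible (mid a)
mid-admissible adm = init-admissible (fin-admissible adm)

δ′-good : ∀ f {a} → Admissible a → weight a ≤ f → All (Good (weight a)) (δ′ f a)
δ′-good zero    {[]} adm-[] _ = (adm-[] , refl) ∷ []
δ′-good (suc f) {[]} adm-[] _ = (adm-[] , refl) ∷ []
δ′-good zero    {a ∷ as} adm le = ⊥-elim (ℕₚ.<⇒≱ (weight-≥2 adm) (ℕₚ.≤-trans le z≤n))
δ′-good (suc f) {a ∷ as} adm le =
  subst (All (Good w)) (sym (trans (Lₚ.map-++ _ (δ′ f (init (a ∷ as))) _) (cong (map _ (δ′ f (init (a ∷ as))) ++_) (Lₚ.map-++ _ (δ′ f (mid (a ∷ as))) (δ′ f (fin (a ∷ as)))))))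
  (Allₚ.++⁺ (extend-good w _ (λ _ _ → refl) _ (weight-≥2 adm) (weight-init-< adm) (δ′-good f (init-admissible adm) (ℕₚ.≤-pred (ℕₚ.≤-trans (weight-init-< adm) le))))
  (Allₚ.++⁺ (extend-good w _ (λ _ _ → refl) _ (weight-≥2 adm) (weight-mid-< adm) (δ′-good f (mid-admissible adm) (ℕₚ.≤-pred (ℕₚ.≤-trans (weight-mid-< adm) le))))
            (extend-good w _ (λ _ _ → refl) _ (weight-≥2 adm) (weight-fin-< adm) (δ′-good f (fin-admissible adm) (ℕₚ.≤-pred (ℕₚ.≤-trans (weight-fin-< adm) le))))))
  where
  w = weight (a ∷ as)

-- In the limit N → ∞ the value of E does not depend on n, and it is O(1/m) at every later m. The
-- bound is uniform in N, so m can be fixed before N. It is asked at `suc n` only, since the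
-- connector with n = 0 is constantly 1 and does not decay.
Null-descent : ∀ (E : ℕ → ℕ → ℚ) c → (∀ n → Null (λ N → E n N - E (suc n) N)) →
  (∀ n N → ∣ E (suc n) N ∣ ℚ.≤ ν c * recip (suc (suc n))) → ∀ n → Null (E n)
Null-descent E c const bd n = Null-limit
  where
  open ℚₚ.≤-Reasoning
  lem₁ : ∀ a b c → (a - b) + (b - c) ≡ a - c
  lem₁ = solve-∀ ℚ-ring
  lem₀ : ∀ a → 0ℚ ≡ a - a
  lem₀ = solve-∀ ℚ-ring
  lem₂ : ∀ a b → a ≡ (a - b) + b
  lem₂ = solve-∀ ℚ-ring
  shift : ∀ d → Null (λ N → E n N - E (d ℕ.+ n) N)
  shift zero    = Null-ext 0 (λ N _ → lem₀ (E n N)) Null-0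
  shift (suc d) = Null-ext 0 (λ N _ → lem₁ (E n N) (E (d ℕ.+ n) N) (E (suc d ℕ.+ n) N)) (Null-+ (shift d) (const (d ℕ.+ n)))
  -- The index is chosen so that c/(m + 1) ≤ 1/(p + 1).
  small : ∀ p N → ∣ E (suc (suc p ℕ.* c) ℕ.+ n) N ∣ ℚ.≤ recip (suc p)
  small p N = ℚₚ.≤-trans (bd (suc p ℕ.* c ℕ.+ n) N) (ν-cancel-≤ {suc p} (s≤s z≤n) (begin
    ν (suc p) * (ν c * recip M)   ≡⟨ ℚₚ.*-assoc (ν (suc p)) (ν c) (recip M) ⟨
    ν (suc p) * ν c * recip M     ≡⟨ cong (_* recip M) (ν-* (suc p) c) ⟨
    ν (suc p ℕ.* c) * recip M     ≤⟨ ν*recip≤1 {suc p ℕ.* c} {M} (ℕₚ.≤-trans (ℕₚ.m≤m+n _ n) (ℕₚ.≤-trans (ℕₚ.n≤1+n _) (ℕₚ.n≤1+n _))) ⟩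
    1ℚ                            ≡⟨ recip-inverse (suc p) (s≤s z≤n) ⟨
    ν (suc p) * recip (suc p)     ∎))
    where M = suc (suc (suc p ℕ.* c ℕ.+ n))
  Null-limit : Null (E n)
  Null-limit ε 0<ε = proj₁ near , λ N N≥ → begin-strict
    ∣ E n N ∣                                ≡⟨ cong ∣_∣ (lem₂ (E n N) (E m N)) ⟩
    ∣ (E n N - E m N) + E m N ∣              ≤⟨ ℚₚ.∣p+q∣≤∣p∣+∣q∣ (E n N - E m N) (E m N) ⟩
    ∣ E n N - E m N ∣ + ∣ E m N ∣            <⟨ ℚₚ.+-mono-<-≤ (proj₂ near N N≥) (ℚₚ.≤-trans (small p N) (proj₂ arch)) ⟩
    ℚ.½ * ε + ℚ.½ * ε                        ≡⟨ halve ε ⟩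
    ε                                        ∎
    where
    arch = archimedean (ℚ.½ * ε) (½-pos 0<ε)
    p = proj₁ arch
    m = suc (suc p ℕ.* c) ℕ.+ n
    near = shift (suc (suc p ℕ.* c)) (ℚ.½ * ε) (½-pos 0<ε)

ι-abs : ∀ i → ∣ ι i ∣ ≡ ν ℤ.∣ i ∣
ι-abs (⁺ n)     = ℚₚ.0≤p⇒∣p∣≡p (ν-nonNeg n)
ι-abs -[1+ n ]  = trans (cong ∣_∣ (ι-neg (⁺ suc n))) (trans (ℚₚ.∣-p∣≡∣p∣ (ν (suc n))) (ℚₚ.0≤p⇒∣p∣≡p (ν-nonNeg (suc n))))

norm : FSum → ℕ
norm []            = 0
norm ((c , _) ∷ s) = ℤ.∣ c ∣ ℕ.+ norm s

Φ-bound : ∀ {v} s → All (Good v) s → ∀ n N → ∣ Φ s n N ∣ ℚ.≤ ν (norm s) * recip (suc n)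
Φ-bound [] [] n N = ℚₚ.≤-reflexive (sym (trans (cong (_* recip (suc n)) ι-0) (ℚₚ.*-zeroˡ (recip (suc n)))))
Φ-bound ((c , b) ∷ s) ((adm , _) ∷ gs) n N = begin
  ∣ ι c * σ b n N + Φ s n N ∣                                  ≤⟨ ℚₚ.∣p+q∣≤∣p∣+∣q∣ (ι c * σ b n N) (Φ s n N) ⟩
  ∣ ι c * σ b n N ∣ + ∣ Φ s n N ∣                              ≡⟨ cong (_+ ∣ Φ s n N ∣) (trans (ℚₚ.∣p*q∣≡∣p∣*∣q∣ (ι c) (σ b n N)) (cong₂ _*_ (ι-abs c) (ℚₚ.0≤p⇒∣p∣≡p (nonNeg n)))) ⟩
  ν ℤ.∣ c ∣ * σ b n N + ∣ Φ s n N ∣                            ≤⟨ ℚₚ.+-mono-≤ (*-monoˡ (ν ℤ.∣ c ∣) (ν-nonNeg ℤ.∣ c ∣) (bound n)) (Φ-bound s gs n N) ⟩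
  ν ℤ.∣ c ∣ * recip (suc n) + ν (norm s) * recip (suc n)       ≡⟨ ℚₚ.*-distribʳ-+ (recip (suc n)) (ν ℤ.∣ c ∣) (ν (norm s)) ⟨
  (ν ℤ.∣ c ∣ + ν (norm s)) * recip (suc n)                     ≡⟨ cong (_* recip (suc n)) (ν-+ ℤ.∣ c ∣ (norm s)) ⟨
  ν (ℤ.∣ c ∣ ℕ.+ norm s) * recip (suc n)                       ∎
  where
  open ℚₚ.≤-Reasoning
  open Decaying (Z-decaying N (positive adm) central-decaying)

-- Induction on the fuel. The correction terms in `ζ-recursion` and in `Φ-step` agree up to null
-- sequences by the induction hypothesis for `init`, `mid` and `fin`; the difference E is then
-- independent of n in the limit and `Null-descent` applies.
δ′-expansion : ∀ f {a} → Admissible a → weight a ≤ f → ∀ n → Null (λ N → Z N (g n) a n - Φ (δ′ f a) n N)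
δ′-expansion zero {a ∷ as} adm le = ⊥-elim (ℕₚ.<⇒≱ (weight-≥2 adm) (ℕₚ.≤-trans le z≤n))
δ′-expansion zero {[]} adm le n = Null-ext 0 (λ N _ → trans (lem (central n)) (cong (λ x → central n - (x * central n + 0ℚ)) (sym ι-1))) Null-0
  where
  lem : ∀ x → 0ℚ ≡ x - (1ℚ * x + 0ℚ)
  lem = solve-∀ ℚ-ring
δ′-expansion (suc f) {[]} adm le n = Null-ext 0 (λ N _ → trans (lem (central n)) (cong (λ x → central n - (x * central n + 0ℚ)) (sym ι-1))) Null-0
  where
  lem : ∀ x → 0ℚ ≡ x - (1ℚ * x + 0ℚ)
  lem = solve-∀ ℚ-ring
δ′-expansion (suc f) {a₁ ∷ as} adm le = Null-descent E (suc (norm (δ′ (suc f) a))) step bd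
  where
  a = a₁ ∷ as
  w = weight a
  E : ℕ → ℕ → ℚ
  E n N = Z N (g n) a n - Φ (δ′ (suc f) a) n N
  le-i = ℕₚ.≤-pred (ℕₚ.≤-trans (weight-init-< adm) le)
  le-m = ℕₚ.≤-pred (ℕₚ.≤-trans (weight-mid-< adm) le)
  le-f = ℕₚ.≤-pred (ℕₚ.≤-trans (weight-fin-< adm) le)
  adm-i = init-admissible adm
  adm-m = mid-admissible adm
  adm-f = fin-admissible adm
  r : ℕ → Comp → ℚ
  r n x = recip (suc n ℕ.^ (w ∸ weight x))
  Φ-step : ∀ n N → suc n ≤ N → Φ (δ′ (suc f) a) n N ≡ Φ (δ′ (suc f) a) (suc n) N +
    (r n (init a) * Φ (δ′ f (init a)) (suc n) N + r n (mid a) * Φ (δ′ f (mid a)) (suc n) N + r n (fin a) * Φ (δ′ f (fin a)) (suc n) N)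
  Φ-step n N n<N = begin
    Φ (map F (X ++ Y ++ W)) n N ≡⟨ split n ⟩
    Φ (map F X) n N + (Φ (map F Y) n N + Φ (map F W) n N)
      ≡⟨ cong₂ _+_ (Φ-extend w F (λ _ _ → refl) X (δ′-good f adm-i le-i) n N n<N)
          (cong₂ _+_ (Φ-extend w F (λ _ _ → refl) Y (δ′-good f adm-m le-m) n N n<N) (Φ-extend w F (λ _ _ → refl) W (δ′-good f adm-f le-f) n N n<N)) ⟩
    _ ≡⟨ lem (Φ (map F X) (suc n) N) (Φ (map F Y) (suc n) N) (Φ (map F W) (suc n) N) (r n (init a) * Φ X (suc n) N) (r n (mid a) * Φ Y (suc n) N) (r n (fin a) * Φ W (suc n) N) ⟩
    (Φ (map F X) (suc n) N + (Φ (map F Y) (suc n) N + Φ (map F W) (suc n) N)) + _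
      ≡⟨ cong (_+ (r n (init a) * Φ X (suc n) N + r n (mid a) * Φ Y (suc n) N + r n (fin a) * Φ W (suc n) N)) (split (suc n)) ⟨
    Φ (map F (X ++ Y ++ W)) (suc n) N + (r n (init a) * Φ X (suc n) N + r n (mid a) * Φ Y (suc n) N + r n (fin a) * Φ W (suc n) N) ∎
    where
    open ≡-Reasoning
    X = δ′ f (init a)
    Y = δ′ f (mid a)
    W = δ′ f (fin a)
    F : ℤ × Comp → ℤ × Comp
    F (c , b) = c , extend w b
    lem : ∀ x y z p q t → (x + p) + ((y + q) + (z + t)) ≡ (x + (y + z)) + (p + q + t)
    lem = solve-∀ ℚ-ring
    split : ∀ n → Φ (map F (X ++ Y ++ W)) n N ≡ Φ (map F X) n N + (Φ (map F Y) n N + Φ (map F W) n N)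
    split n = trans (cong (λ s → Φ s n N) (trans (Lₚ.map-++ F X (Y ++ W)) (cong (map F X ++_) (Lₚ.map-++ F Y W))))
      (trans (Φ-++ (map F X) (map F Y ++ map F W) n N) (cong (λ x → Φ (map F X) n N + x) (Φ-++ (map F Y) (map F W) n N)))
  step : ∀ n → Null (λ N → E n N - E (suc n) N)
  step n = Null-ext (suc n) eq
    (Null-+ (ζ-recursion adm n)
      (Null-+ (Null-scale (r n (init a)) (δ′-expansion f adm-i le-i (suc n)))
        (Null-+ (Null-scale (r n (mid a)) (δ′-expansion f adm-m le-m (suc n)))
                (Null-scale (r n (fin a)) (δ′-expansion f adm-f le-f (suc n))))))
    where
    lem : ∀ x y S ri rm rf zi zm zf pi pm pf →
      (x - y - (ri * zi + rm * zm + rf * zf)) + (ri * (zi - pi) + (rm * (zm - pm) + rf * (zf - pf)))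
      ≡ (x - (S + (ri * pi + rm * pm + rf * pf))) - (y - S)
    lem = solve-∀ ℚ-ring
    eq : ∀ N → suc n ≤ N → _ ≡ E n N - E (suc n) N
    eq N n<N = trans
      (lem (Z N (g n) a n) (Z N (g (suc n)) a (suc n)) (Φ (δ′ (suc f) a) (suc n) N) (r n (init a)) (r n (mid a)) (r n (fin a))
        (Z N (g (suc n)) (init a) (suc n)) (Z N (g (suc n)) (mid a) (suc n)) (Z N (g (suc n)) (fin a) (suc n))
        (Φ (δ′ f (init a)) (suc n) N) (Φ (δ′ f (mid a)) (suc n) N) (Φ (δ′ f (fin a)) (suc n) N))
      (cong (λ x → (Z N (g n) a n - x) - E (suc n) N) (sym (Φ-step n N n<N)))
  bd : ∀ n N → ∣ E (suc n) N ∣ ℚ.≤ ν (suc (norm (δ′ (suc f) a))) * recip (suc (suc n))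
  bd n N = begin
    ∣ E (suc n) N ∣                                                   ≤⟨ ℚₚ.∣p-q∣≤∣p∣+∣q∣ (Z N (g (suc n)) a (suc n)) (Φ (δ′ (suc f) a) (suc n) N) ⟩
    ∣ Z N (g (suc n)) a (suc n) ∣ + ∣ Φ (δ′ (suc f) a) (suc n) N ∣    ≡⟨ cong (_+ ∣ Φ (δ′ (suc f) a) (suc n) N ∣) (ℚₚ.0≤p⇒∣p∣≡p (nonNeg (suc n))) ⟩
    Z N (g (suc n)) a (suc n) + ∣ Φ (δ′ (suc f) a) (suc n) N ∣        ≤⟨ ℚₚ.+-mono-≤ (bound (suc n)) (Φ-bound (δ′ (suc f) a) (δ′-good (suc f) adm le) (suc n) N) ⟩
    recip (suc (suc n)) + ν c * recip (suc (suc n))                   ≡⟨ lem (recip (suc (suc n))) (ν c) ⟩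
    (1ℚ + ν c) * recip (suc (suc n))                                  ≡⟨ cong (_* recip (suc (suc n))) (ν-suc c) ⟨
    ν (suc c) * recip (suc (suc n))                                   ∎
    where
    open ℚₚ.≤-Reasoning
    open Decaying (Z-decaying N (positive adm) (g-decaying n))
    c = norm (δ′ (suc f) a)
    lem : ∀ r c → r + c * r ≡ (1ℚ + c) * r
    lem = solve-∀ ℚ-ring

δ-expansion : ∀ {ℓ} → AllAdmissible ℓ → ∀ n → Null (λ N → ζpartL ℓ n N - Φ (δ ℓ) n N)
δ-expansion [] n = Null-0
δ-expansion {(c , a) ∷ ℓ} (adm ∷ adms) n = Null-ext n eq
  (Null-+ (Null-scale (ι c) (δ′-expansion (weight a) adm ℕₚ.≤-refl n)) (δ-expansion adms n))
  where
  lem : ∀ c x y u v → c * (x - y) + (u - v) ≡ (c * x + u) - (c * y + v)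
  lem = solve-∀ ℚ-ring
  eq : ∀ N → n ≤ N → _ ≡ ζpartL ((c , a) ∷ ℓ) n N - Φ (δ ((c , a) ∷ ℓ)) n N
  eq N n≤N = trans (lem (ι c) (Z N (g n) a n) (Φ (δ₀ a) n N) (ζpartL ℓ n N) (Φ (δ ℓ) n N))
    (cong₂ _-_ (cong₂ (λ x y → x * y + ζpartL ℓ n N) (ι-def c) (sym (ζpart≡Z a n N n≤N)))
      (trans (cong (_+ Φ (δ ℓ) n N) (sym (Φ-scale c (δ₀ a) n N))) (sym (Φ-++ (scale c (δ₀ a)) (δ ℓ) n N))))

δ-admissible : ∀ {ℓ} → AllAdmissible ℓ → AllKeys Admissible (δ ℓ)
δ-admissible [] = []
δ-admissible {(c , a) ∷ ℓ} (adm ∷ adms) = Allₚ.++⁺ (scaled (δ₀ a) (δ′-good (weight a) adm ℕₚ.≤-refl)) (δ-admissible adms)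
  where
  scaled : ∀ {v} s → All (Good v) s → AllKeys Admissible (scale c s)
  scaled []            []              = []
  scaled ((d , b) ∷ s) ((adm , _) ∷ p) = adm ∷ scaled s p

-- Rational functions and poles

-- Functions satisfying Cong and Deg e stand in for the integer polynomials of degree < e: only
-- x − y ∣ f x − f y and the vanishing of the e-th difference are needed.

record Cong (f : ℤ → ℤ) : Set where
  constructor isCongruence
  field
    quotient : ∀ x y → Σ ℤ λ q → f x ℤ.- f y ≡ q ℤ.* (x ℤ.- y)
open Cong

Cong-const : ∀ c → Cong (λ _ → c)
Cong-const c = isCongruence λ x y → ⁺ 0 , lem c x y
  where
  lem : ∀ c x y → c ℤ.- c ≡ ⁺ 0 ℤ.* (x ℤ.- y)
  lem = solveℤ

Cong-id : Cong (λ x → x)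
Cong-id = isCongruence λ x y → ⁺ 1 , sym (ℤₚ.*-identityˡ (x ℤ.- y))

Cong-+ : ∀ {f g} → Cong f → Cong g → Cong (λ x → f x ℤ.+ g x)
quotient (Cong-+ {f} {g} cf cg) x y with quotient cf x y | quotient cg x y
... | p , eq | q , eq′ = p ℤ.+ q , trans (lem (f x) (f y) (g x) (g y)) (trans (cong₂ ℤ._+_ eq eq′) (sym (ℤₚ.*-distribʳ-+ (x ℤ.- y) p q)))
  where
  lem : ∀ a b c d → (a ℤ.+ c) ℤ.- (b ℤ.+ d) ≡ (a ℤ.- b) ℤ.+ (c ℤ.- d)
  lem = solveℤ

Cong-* : ∀ {f g} → Cong f → Cong g → Cong (λ x → f x ℤ.* g x)
quotient (Cong-* {f} {g} cf cg) x y with quotient cf x y | quotient cg x y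
... | p , eq | q , eq′ = p ℤ.* g x ℤ.+ f y ℤ.* q ,
  trans (lem (f x) (f y) (g x) (g y)) (trans (cong₂ (λ u v → u ℤ.* g x ℤ.+ f y ℤ.* v) eq eq′) (lem′ p q (g x) (f y) (x ℤ.- y)))
  where
  lem : ∀ a b c d → (a ℤ.* c) ℤ.- (b ℤ.* d) ≡ (a ℤ.- b) ℤ.* c ℤ.+ b ℤ.* (c ℤ.- d)
  lem = solveℤ
  lem′ : ∀ p q c b z → p ℤ.* z ℤ.* c ℤ.+ b ℤ.* (q ℤ.* z) ≡ (p ℤ.* c ℤ.+ b ℤ.* q) ℤ.* z
  lem′ = solveℤ

Cong-neg : ∀ {f} → Cong f → Cong (λ x → ℤ.- f x)
quotient (Cong-neg {f} cf) x y with quotient cf x y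
... | p , eq = ℤ.- p , trans (lem (f x) (f y)) (trans (cong ℤ.-_ eq) (ℤₚ.neg-distribˡ-* p (x ℤ.- y)))
  where
  lem : ∀ a b → ℤ.- a ℤ.- ℤ.- b ≡ ℤ.- (a ℤ.- b)
  lem = solveℤ

Cong-shift : ∀ {f} c → Cong f → Cong (λ x → f (x ℤ.+ c))
quotient (Cong-shift c cf) x y with quotient cf (x ℤ.+ c) (y ℤ.+ c)
... | p , eq = p , trans eq (cong (p ℤ.*_) (lem x y c))
  where
  lem : ∀ x y c → (x ℤ.+ c) ℤ.- (y ℤ.+ c) ≡ x ℤ.- y
  lem = solveℤ

-- Large M divide f(0) − f(M) = f(0).
Cong-vanish : ∀ {f} → Cong f → ∀ n₀ → (∀ n → n₀ ≤ n → f (⁺ n) ≡ ⁺ 0) → f (⁺ 0) ≡ ⁺ 0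
Cong-vanish {f} cf n₀ f≡0 with quotient cf (⁺ 0) (⁺ M)
  where M = n₀ ℕ.+ suc ℤ.∣ f (⁺ 0) ∣
... | q , eq = case-q ℤ.∣ q ∣ abs-eq
  where
  M = n₀ ℕ.+ suc ℤ.∣ f (⁺ 0) ∣
  lem₁ : ∀ a → a ≡ a ℤ.- ⁺ 0
  lem₁ = solveℤ
  abs-eq : ℤ.∣ f (⁺ 0) ∣ ≡ ℤ.∣ q ∣ ℕ.* M
  abs-eq = trans (cong ℤ.∣_∣ (trans (lem₁ (f (⁺ 0))) (trans (cong (λ z → f (⁺ 0) ℤ.- z) (sym (f≡0 M (ℕₚ.m≤m+n n₀ _)))) eq)))
    (trans (ℤₚ.abs-* q (⁺ 0 ℤ.- ⁺ M)) (cong (ℤ.∣ q ∣ ℕ.*_) (trans (cong ℤ.∣_∣ (ℤₚ.+-identityˡ (ℤ.- ⁺ M))) (ℤₚ.∣-i∣≡∣i∣ (⁺ M)))))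
  case-q : ∀ k → ℤ.∣ f (⁺ 0) ∣ ≡ k ℕ.* M → f (⁺ 0) ≡ ⁺ 0
  case-q zero    e = ℤₚ.∣i∣≡0⇒i≡0 e
  case-q (suc k) e = ⊥-elim (ℕₚ.<-irrefl e (ℕₚ.≤-trans (ℕₚ.m≤n+m (suc ℤ.∣ f (⁺ 0) ∣) n₀) (ℕₚ.m≤m+n M (k ℕ.* M))))

-- Carries an identity known only at large naturals to the point 0, where a possible pole is to be
-- tested.
Cong-agree : ∀ {f g} → Cong f → Cong g → ∀ n₀ → (∀ n → n₀ ≤ n → f (⁺ n) ≡ g (⁺ n)) → f (⁺ 0) ≡ g (⁺ 0)
Cong-agree {f} {g} cf cg n₀ f≡g = ℤₚ.i-j≡0⇒i≡j (f (⁺ 0)) (g (⁺ 0))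
  (Cong-vanish (Cong-+ cf (Cong-neg cg)) n₀ (λ n le → ℤₚ.i≡j⇒i-j≡0 (f≡g n le)))

-- The sign is that of the value at n - 1 minus the value at n, as in `derive`.
Δ : (ℤ → ℤ) → ℤ → ℤ
Δ f x = f (x ℤ.+ -[1+ 0 ]) ℤ.- f x

Deg : ℕ → (ℤ → ℤ) → Set
Deg zero    f = ∀ x → f x ≡ ⁺ 0
Deg (suc e) f = Deg e (Δ f)

Deg-ext : ∀ e {f g} → (∀ x → f x ≡ g x) → Deg e f → Deg e g
Deg-ext zero    eq d x = trans (sym (eq x)) (d x)
Deg-ext (suc e) eq d   = Deg-ext e (λ x → cong₂ ℤ._-_ (eq (x ℤ.+ -[1+ 0 ])) (eq x)) d

Deg-0 : ∀ e → Deg e (λ _ → ⁺ 0)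
Deg-0 zero    x = refl
Deg-0 (suc e)   = Deg-0 e

Deg-+ : ∀ e {f g} → Deg e f → Deg e g → Deg e (λ x → f x ℤ.+ g x)
Deg-+ zero    df dg x = cong₂ ℤ._+_ (df x) (dg x)
Deg-+ (suc e) {f} {g} df dg = Deg-ext e (λ x → lem (f (x ℤ.+ -[1+ 0 ])) (f x) (g (x ℤ.+ -[1+ 0 ])) (g x)) (Deg-+ e df dg)
  where
  lem : ∀ a b c d → (a ℤ.- b) ℤ.+ (c ℤ.- d) ≡ (a ℤ.+ c) ℤ.- (b ℤ.+ d)
  lem = solveℤ

Deg-suc : ∀ e {f} → Deg e f → Deg (suc e) f
Deg-suc zero    {f} df x = cong₂ ℤ._-_ (df (x ℤ.+ -[1+ 0 ])) (df x)
Deg-suc (suc e) df = Deg-suc e df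

Deg-mono : ∀ {e e′ f} → e ≤ e′ → Deg e f → Deg e′ f
Deg-mono {e} {e′} {f} e≤e′ df = subst (λ k → Deg k f) (ℕₚ.m∸n+n≡m e≤e′) (go (e′ ∸ e))
  where
  go : ∀ k → Deg (k ℕ.+ e) f
  go zero    = df
  go (suc k) = Deg-suc (k ℕ.+ e) (go k)

Deg-shift : ∀ e {f} c → Deg e f → Deg e (λ x → f (x ℤ.+ c))
Deg-shift zero    c df x = df (x ℤ.+ c)
Deg-shift (suc e) {f} c df = Deg-ext e (λ x → cong (λ z → f z ℤ.- f (x ℤ.+ c)) (lem x c)) (Deg-shift e c df)
  where
  lem : ∀ x c → x ℤ.+ c ℤ.+ -[1+ 0 ] ≡ x ℤ.+ -[1+ 0 ] ℤ.+ c
  lem = solveℤ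

-- Discrete Leibniz rule: Δ(fg)(x) = Δf(x) g(x - 1) + f(x) Δg(x). The bound is not sharp; the
-- argument only needs some finite bound.
Deg-* : ∀ d e {f g} → Deg d f → Deg e g → Deg (d ℕ.+ e) (λ x → f x ℤ.* g x)
Deg-* zero    e {f} {g} df dg = Deg-ext e (λ x → sym (trans (cong (ℤ._* g x) (df x)) (ℤₚ.*-zeroˡ (g x)))) (Deg-0 e)
Deg-* (suc d) zero {f} {g} df dg = Deg-ext (suc d ℕ.+ 0) {λ _ → ⁺ 0} (λ x → sym (trans (cong (f x ℤ.*_) (dg x)) (ℤₚ.*-zeroʳ (f x)))) (Deg-0 (suc d ℕ.+ 0))
Deg-* (suc d) (suc e) {f} {g} df dg = Deg-ext (d ℕ.+ suc e)
  (λ x → lem (f (x ℤ.+ -[1+ 0 ])) (f x) (g (x ℤ.+ -[1+ 0 ])) (g x))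
  (Deg-+ (d ℕ.+ suc e)
    (Deg-* d (suc e) {Δ f} df (Deg-shift (suc e) {g} -[1+ 0 ] dg))
    (subst (λ k → Deg k (λ x → f x ℤ.* Δ g x)) (sym (ℕₚ.+-suc d e)) (Deg-* (suc d) e {f} {Δ g} df dg)))
  where
  lem : ∀ a b c d → (a ℤ.- b) ℤ.* c ℤ.+ b ℤ.* (c ℤ.- d) ≡ a ℤ.* c ℤ.- b ℤ.* d
  lem = solveℤ

-- Polynomials, and rational functions with poles at natural numbers

record Poly (e : ℕ) (f : ℤ → ℤ) : Set where
  constructor poly
  field
    isCong : Cong f
    isDeg  : Deg e f
open Poly

Poly-const : ∀ c → Poly 1 (λ _ → c)
Poly-const c = poly (Cong-const c) (λ x → ℤₚ.+-inverseʳ c)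

Poly-id : Poly 2 (λ x → x)
Poly-id = poly Cong-id lem
  where
  lem : ∀ x → (x ℤ.+ -[1+ 0 ] ℤ.+ -[1+ 0 ] ℤ.- (x ℤ.+ -[1+ 0 ])) ℤ.- (x ℤ.+ -[1+ 0 ] ℤ.- x) ≡ ⁺ 0
  lem = solveℤ

Poly-+ : ∀ {d e f g} → Poly d f → Poly e g → Poly (d ℕ.+ e) (λ x → f x ℤ.+ g x)
Poly-+ {d} {e} (poly cf df) (poly cg dg) = poly (Cong-+ cf cg) (Deg-+ (d ℕ.+ e) (Deg-mono (ℕₚ.m≤m+n d e) df) (Deg-mono (ℕₚ.m≤n+m e d) dg))

Poly-* : ∀ {d e f g} → Poly d f → Poly e g → Poly (d ℕ.+ e) (λ x → f x ℤ.* g x)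
Poly-* {d} {e} (poly cf df) (poly cg dg) = poly (Cong-* cf cg) (Deg-* d e df dg)

Poly-shift : ∀ {e f} c → Poly e f → Poly e (λ x → f (x ℤ.+ c))
Poly-shift {e} c (poly cf df) = poly (Cong-shift c cf) (Deg-shift e c df)

-- Denominators with zeros at naturals only: the class contains x, is stable under x ↦ x - 1, and
-- its members do not vanish at -1.
den : List ℕ → ℤ → ℤ
den []      x = ⁺ 1
den (i ∷ L) x = (x ℤ.+ ℤ.- ⁺ i) ℤ.* den L x

den-++ : ∀ L L′ x → den (L ++ L′) x ≡ den L x ℤ.* den L′ x
den-++ []      L′ x = sym (ℤₚ.*-identityˡ (den L′ x))
den-++ (i ∷ L) L′ x = trans (cong ((x ℤ.+ ℤ.- ⁺ i) ℤ.*_) (den-++ L L′ x)) (sym (ℤₚ.*-assoc (x ℤ.+ ℤ.- ⁺ i) (den L x) (den L′ x)))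

den-shift : ∀ L x → den (map suc L) x ≡ den L (x ℤ.+ -[1+ 0 ])
den-shift []      x = refl
den-shift (i ∷ L) x = cong₂ ℤ._*_ (trans (cong (λ z → x ℤ.+ ℤ.- z) (ℤₚ.pos-+ 1 i)) (lem x (⁺ i))) (den-shift L x)
  where
  lem : ∀ x i → x ℤ.+ ℤ.- (⁺ 1 ℤ.+ i) ≡ x ℤ.+ -[1+ 0 ] ℤ.+ ℤ.- i
  lem = solveℤ

denDeg : List ℕ → ℕ
denDeg []      = 1
denDeg (i ∷ L) = 3 ℕ.+ denDeg L

den-poly : ∀ L → Poly (denDeg L) (den L)
den-poly []      = Poly-const (⁺ 1)
den-poly (i ∷ L) = Poly-* (Poly-+ Poly-id (Poly-const (ℤ.- ⁺ i))) (den-poly L)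

*-nonZero : ∀ {i j} → i ≢ ⁺ 0 → j ≢ ⁺ 0 → i ℤ.* j ≢ ⁺ 0
*-nonZero {i} i≢0 j≢0 eq with ℤₚ.i*j≡0⇒i≡0∨j≡0 i eq
... | inj₁ e = i≢0 e
... | inj₂ e = j≢0 e

cancel-nonZero : ∀ i j → i ≢ ⁺ 0 → i ℤ.* j ≡ ⁺ 0 → j ≡ ⁺ 0
cancel-nonZero i j i≢0 eq with ℤₚ.i*j≡0⇒i≡0∨j≡0 i eq
... | inj₁ e = ⊥-elim (i≢0 e)
... | inj₂ e = e

den-neg : ∀ L → den L -[1+ 0 ] ≢ ⁺ 0
den-neg []      ()
den-neg (i ∷ L) = *-nonZero {j = den L -[1+ 0 ]} (neg i) (den-neg L)
  where
  neg : ∀ i → -[1+ 0 ] ℤ.+ ℤ.- ⁺ i ≢ ⁺ 0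
  neg zero    ()
  neg (suc i) ()

poles : List ℕ → ℕ
poles []      = 0
poles (i ∷ L) = suc i ℕ.+ poles L

den-large : ∀ L n → poles L ≤ n → den L (⁺ n) ≢ ⁺ 0
den-large []      n _  ()
den-large (i ∷ L) n le = *-nonZero {j = den L (⁺ n)}
  (λ eq → ℕₚ.<-irrefl (sym (ℤₚ.+-injective (ℤₚ.i-j≡0⇒i≡j (⁺ n) (⁺ i) eq))) (ℕₚ.≤-trans (ℕₚ.m≤m+n (suc i) (poles L)) le))
  (den-large L n (ℕₚ.≤-trans (ℕₚ.m≤n+m (poles L) (suc i)) le))

-- Denominator, degree bound and threshold are common to the whole family. This lets one
-- multiplication clear all denominators and one number e govern the induction on the degree.
record Rat {I : Set} (R : I → ℕ → ℚ) : Set where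
  field
    L     : List ℕ
    e     : ℕ
    num   : I → ℤ → ℤ
    num-poly : ∀ i → Poly e (num i)
    n₀    : ℕ
    eq    : ∀ i n → n₀ ≤ n → ι (den L (⁺ n)) * R i n ≡ ι (num i (⁺ n))

module _ {I : Set} where

  Rat-poly : ∀ {e} (f : I → ℤ → ℤ) → (∀ i → Poly e (f i)) → Rat (λ i n → ι (f i (⁺ n)))
  Rat-poly f pf = record { L = [] ; num = f ; num-poly = pf ; n₀ = 0
    ; eq = λ i n _ → trans (cong (_* ι (f i (⁺ n))) ι-1) (ℚₚ.*-identityˡ _) }

  Rat-ext : ∀ {R R′ : I → ℕ → ℚ} n₁ → (∀ i n → n₁ ≤ n → R i n ≡ R′ i n) → Rat R → Rat R′
  Rat-ext n₁ e r = record { L = L ; num = num ; num-poly = num-poly ; n₀ = n₁ ℕ.+ n₀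
    ; eq = λ i n le → trans (cong (ι (den L (⁺ n)) *_) (sym (e i n (ℕₚ.≤-trans (ℕₚ.m≤m+n n₁ n₀) le)))) (eq i n (ℕₚ.≤-trans (ℕₚ.m≤n+m n₀ n₁) le)) }
    where open Rat r hiding (e)

  Rat-+ : ∀ {R S : I → ℕ → ℚ} → Rat R → Rat S → Rat (λ i n → R i n + S i n)
  Rat-+ {R} {S} r s = record
    { L = r.L ++ s.L
    ; num = λ i x → r.num i x ℤ.* den s.L x ℤ.+ s.num i x ℤ.* den r.L x
    ; num-poly = λ i → Poly-+ (Poly-* (r.num-poly i) (den-poly s.L)) (Poly-* (s.num-poly i) (den-poly r.L))
    ; n₀ = r.n₀ ℕ.+ s.n₀
    ; eq = λ i n le → let x = ⁺ n in begin
        ι (den (r.L ++ s.L) x) * (R i n + S i n) ≡⟨ cong (_* (R i n + S i n)) (trans (cong ι (den-++ r.L s.L x)) (ι-* (den r.L x) (den s.L x))) ⟩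
        ι (den r.L x) * ι (den s.L x) * (R i n + S i n) ≡⟨ lem (ι (den r.L x)) (ι (den s.L x)) (R i n) (S i n) ⟩
        ι (den r.L x) * R i n * ι (den s.L x) + ι (den s.L x) * S i n * ι (den r.L x)
          ≡⟨ cong₂ (λ a b → a * ι (den s.L x) + b * ι (den r.L x)) (r.eq i n (ℕₚ.≤-trans (ℕₚ.m≤m+n r.n₀ s.n₀) le)) (s.eq i n (ℕₚ.≤-trans (ℕₚ.m≤n+m s.n₀ r.n₀) le)) ⟩
        ι (r.num i x) * ι (den s.L x) + ι (s.num i x) * ι (den r.L x) ≡⟨ cong₂ _+_ (ι-* (r.num i x) (den s.L x)) (ι-* (s.num i x) (den r.L x)) ⟨
        ι (r.num i x ℤ.* den s.L x) + ι (s.num i x ℤ.* den r.L x) ≡⟨ ι-+ (r.num i x ℤ.* den s.L x) (s.num i x ℤ.* den r.L x) ⟨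
        ι (r.num i x ℤ.* den s.L x ℤ.+ s.num i x ℤ.* den r.L x) ∎
    }
    where
    open ≡-Reasoning
    module r = Rat r
    module s = Rat s
    lem : ∀ a b c d → a * b * (c + d) ≡ a * c * b + b * d * a
    lem = solve-∀ ℚ-ring

  Rat-* : ∀ {R S : I → ℕ → ℚ} → Rat R → Rat S → Rat (λ i n → R i n * S i n)
  Rat-* {R} {S} r s = record
    { L = r.L ++ s.L
    ; num = λ i x → r.num i x ℤ.* s.num i x
    ; num-poly = λ i → Poly-* (r.num-poly i) (s.num-poly i)
    ; n₀ = r.n₀ ℕ.+ s.n₀
    ; eq = λ i n le → let x = ⁺ n in begin
        ι (den (r.L ++ s.L) x) * (R i n * S i n) ≡⟨ cong (_* (R i n * S i n)) (trans (cong ι (den-++ r.L s.L x)) (ι-* (den r.L x) (den s.L x))) ⟩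
        ι (den r.L x) * ι (den s.L x) * (R i n * S i n) ≡⟨ lem (ι (den r.L x)) (ι (den s.L x)) (R i n) (S i n) ⟩
        (ι (den r.L x) * R i n) * (ι (den s.L x) * S i n)
          ≡⟨ cong₂ _*_ (r.eq i n (ℕₚ.≤-trans (ℕₚ.m≤m+n r.n₀ s.n₀) le)) (s.eq i n (ℕₚ.≤-trans (ℕₚ.m≤n+m s.n₀ r.n₀) le)) ⟩
        ι (r.num i x) * ι (s.num i x) ≡⟨ ι-* (r.num i x) (s.num i x) ⟨
        ι (r.num i x ℤ.* s.num i x) ∎
    }
    where
    open ≡-Reasoning
    module r = Rat r
    module s = Rat s
    lem : ∀ a b c d → a * b * (c * d) ≡ (a * c) * (b * d)
    lem = solve-∀ ℚ-ring

  Rat-shift : ∀ {R : I → ℕ → ℚ} → Rat R → Rat (λ i n → R i (ℕ.pred n))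
  Rat-shift {R} r = record
    { L = map suc L
    ; num = λ i x → num i (x ℤ.+ -[1+ 0 ])
    ; num-poly = λ i → Poly-shift -[1+ 0 ] (num-poly i)
    ; n₀ = suc n₀
    ; eq = λ { i (suc n) (s≤s le) → trans (cong (λ z → ι z * R i n) (den-shift L (⁺ suc n))) (eq i n le) }
    }
    where open Rat r

  Rat-recip : Rat {I} (λ _ n → recip n)
  Rat-recip = record
    { L = 0 ∷ []
    ; num = λ _ _ → ⁺ 1
    ; num-poly = λ _ → Poly-const (⁺ 1)
    ; n₀ = 1
    ; eq = λ i n 1≤n → trans (cong (λ z → ι z * recip n) (trans (ℤₚ.*-identityʳ (⁺ n ℤ.+ ⁺ 0)) (ℤₚ.+-identityʳ (⁺ n)))) (trans (recip-inverse n 1≤n) (sym ι-1))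
    }

  Rat-const : ∀ (c : I → ℤ) → Rat (λ i _ → ι (c i))
  Rat-const c = Rat-poly (λ i _ → c i) (λ i → Poly-const (c i))

  Rat-recip-^ : ∀ k → Rat {I} (λ _ n → recip (n ℕ.^ k))
  Rat-recip-^ zero    = Rat-ext 0 (λ _ _ _ → ι-1) (Rat-const (λ _ → ⁺ 1))
  Rat-recip-^ (suc k) = Rat-ext 0 (λ _ n _ → sym (recip-* n (n ℕ.^ k))) (Rat-* Rat-recip (Rat-recip-^ k))

  Rat-sum : ∀ K {R : ℕ → I → ℕ → ℚ} → (∀ k → Rat (R k)) → Rat (λ i n → sumTo K (λ k → R k i n))
  Rat-sum zero    r = Rat-ext 0 (λ _ _ _ → ι-0) (Rat-const (λ _ → ⁺ 0))
  Rat-sum (suc K) r = Rat-+ (Rat-sum K r) (r K)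

  Rat-- : ∀ {R S : I → ℕ → ℚ} → Rat R → Rat S → Rat (λ i n → R i n - S i n)
  Rat-- {R} {S} r s = Rat-+ r (Rat-ext 0 (λ i n _ → trans (cong (_* S i n) (trans (ι-neg (⁺ 1)) (cong -_ ι-1))) (lem (S i n))) (Rat-* (Rat-const (λ _ → -[1+ 0 ])) s))
    where
    lem : ∀ x → - 1ℚ * x ≡ - x
    lem = solve-∀ ℚ-ring

Rat-reindex : ∀ {I J : Set} {R : I → ℕ → ℚ} (φ : J → I) → Rat R → Rat (λ j → R (φ j))
Rat-reindex φ r = record { L = L ; num = λ j → num (φ j) ; num-poly = λ j → num-poly (φ j) ; n₀ = n₀ ; eq = λ j → eq (φ j) }
  where open Rat r

-- Absence of a pole at i, expressed by one representation for large n whose denominator is nonzero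
-- at i; neither lowest terms nor a value of r at i is involved.
record Regular (i : ℤ) (r : ℕ → ℚ) : Set where
  field
    den′ num′ : ℤ → ℤ
    den-cong : Cong den′
    num-cong : Cong num′
    den≢0    : den′ i ≢ ⁺ 0
    n₀       : ℕ
    eq       : ∀ n → n₀ ≤ n → ι (den′ (⁺ n)) * r n ≡ ι (num′ (⁺ n))

Rat⇒Regular : ∀ {I : Set} {R : I → ℕ → ℚ} (rat : Rat R) i x → den (Rat.L rat) x ≢ ⁺ 0 → Regular x (R i)
Rat⇒Regular rat i x ≢0 = record
  { den-cong = isCong (den-poly L) ; num-cong = isCong (num-poly i) ; den≢0 = ≢0 ; n₀ = n₀ ; eq = eq i }
  where open Rat rat

-- Principal parts at 0 and the pole count

pow : ℕ → ℤ → ℤ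
pow zero    x = ⁺ 1
pow (suc K) x = x ℤ.* pow K x

pow-cong : ∀ K → Cong (pow K)
pow-cong zero    = Cong-const (⁺ 1)
pow-cong (suc K) = Cong-* {λ x → x} {pow K} Cong-id (pow-cong K)

pow-nonZero : ∀ K n → pow K (⁺ suc n) ≢ ⁺ 0
pow-nonZero zero    n ()
pow-nonZero (suc K) n = *-nonZero {⁺ suc n} {pow K (⁺ suc n)} (λ ()) (pow-nonZero K n)

principal : ℕ → (ℕ → ℤ) → ℕ → ℚ
principal K c n = sumTo K (λ k → ι (c k) * recip (n ℕ.^ suc k))

horner : ℕ → (ℕ → ℤ) → ℤ → ℤ
horner zero    c x = ⁺ 0
horner (suc K) c x = x ℤ.* horner K c x ℤ.+ c K

horner-cong : ∀ K c → Cong (horner K c)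
horner-cong zero    c = Cong-const (⁺ 0)
horner-cong (suc K) c = Cong-+ (Cong-* Cong-id (horner-cong K c)) (Cong-const (c K))

ι-pow : ∀ K n → ι (pow K (⁺ n)) ≡ ν (n ℕ.^ K)
ι-pow zero    n = refl
ι-pow (suc K) n = trans (ι-* (⁺ n) (pow K (⁺ n))) (trans (cong (ν n *_) (ι-pow K n)) (sym (ν-* n (n ℕ.^ K))))

principal-horner : ∀ K c n → 1 ≤ n → ι (pow K (⁺ n)) * principal K c n ≡ ι (horner K c (⁺ n))
principal-horner zero    c n 1≤n = trans (ℚₚ.*-zeroʳ (ι (⁺ 1))) (sym ι-0)
principal-horner (suc K) c n 1≤n = begin
  ι (⁺ n ℤ.* pow K (⁺ n)) * (principal K c n + ι (c K) * recip (n ℕ.^ suc K))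
    ≡⟨ ℚₚ.*-distribˡ-+ (ι (pow (suc K) (⁺ n))) (principal K c n) _ ⟩
  ι (⁺ n ℤ.* pow K (⁺ n)) * principal K c n + ι (pow (suc K) (⁺ n)) * (ι (c K) * recip (n ℕ.^ suc K))
    ≡⟨ cong₂ (λ a b → a * principal K c n + b * (ι (c K) * recip (n ℕ.^ suc K))) (ι-* (⁺ n) (pow K (⁺ n))) (ι-pow (suc K) n) ⟩
  ν n * ι (pow K (⁺ n)) * principal K c n + ν (n ℕ.^ suc K) * (ι (c K) * recip (n ℕ.^ suc K))
    ≡⟨ lem (ν n) (ι (pow K (⁺ n))) (principal K c n) (ν (n ℕ.^ suc K)) (ι (c K)) (recip (n ℕ.^ suc K)) ⟩
  ν n * (ι (pow K (⁺ n)) * principal K c n) + ι (c K) * (ν (n ℕ.^ suc K) * recip (n ℕ.^ suc K))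
    ≡⟨ cong₂ (λ a b → ν n * a + ι (c K) * b) (principal-horner K c n 1≤n) (recip-inverse (n ℕ.^ suc K) (^-pos n (suc K) 1≤n)) ⟩
  ν n * ι (horner K c (⁺ n)) + ι (c K) * 1ℚ
    ≡⟨ cong₂ _+_ (sym (ι-* (⁺ n) (horner K c (⁺ n)))) (ℚₚ.*-identityʳ (ι (c K))) ⟩
  ι (⁺ n ℤ.* horner K c (⁺ n)) + ι (c K)
    ≡⟨ ι-+ (⁺ n ℤ.* horner K c (⁺ n)) (c K) ⟨
  ι (horner (suc K) c (⁺ n)) ∎
  where
  open ≡-Reasoning
  lem : ∀ n p g m c r → n * p * g + m * (c * r) ≡ n * (p * g) + c * (m * r)
  lem = solve-∀ ℚ-ring

⁺-suc : ∀ n → ⁺ n ℤ.+ ⁺ 1 ≡ ⁺ suc n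
⁺-suc n = cong ⁺_ (ℕₚ.+-comm n 1)

-- Here s = f/h stands for r(x), r for r(x - 1), and H/p for the principal part; the equation v s -
-- w r = H/p is solved for r.
solve-for : ∀ h w p v f H r s → ι h * s ≡ ι f → ι p * (ι v * s - ι w * r) ≡ ι H →
  ι (h ℤ.* (w ℤ.* p)) * r ≡ ι (p ℤ.* (v ℤ.* f) ℤ.+ ℤ.- (h ℤ.* H))
solve-for h w p v f H r s eq rel = begin
  ι (h ℤ.* (w ℤ.* p)) * r
    ≡⟨ cong (_* r) (trans (ι-* h (w ℤ.* p)) (cong (ι h *_) (ι-* w p))) ⟩
  ι h * (ι w * ι p) * r
    ≡⟨ lem (ι h) (ι w) (ι p) r (ι v) s ⟩
  ι p * (ι v * (ι h * s)) - ι h * (ι p * (ι v * s - ι w * r))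
    ≡⟨ cong₂ (λ a b → ι p * (ι v * a) - ι h * b) eq rel ⟩
  ι p * (ι v * ι f) - ι h * ι H
    ≡⟨ cong₂ _-_ (trans (cong (ι p *_) (sym (ι-* v f))) (sym (ι-* p (v ℤ.* f)))) (sym (ι-* h H)) ⟩
  ι (p ℤ.* (v ℤ.* f)) - ι (h ℤ.* H)
    ≡⟨ ι-∸ (p ℤ.* (v ℤ.* f)) (h ℤ.* H) ⟨
  ι (p ℤ.* (v ℤ.* f) ℤ.+ ℤ.- (h ℤ.* H)) ∎
  where
  open ≡-Reasoning
  lem : ∀ h w p r v s → h * (w * p) * r ≡ p * (v * (h * s)) - h * (p * (v * s - w * r))
  lem = solve-∀ ℚ-ring

-- The same equation with s = f/a and r = h/b, cleared of denominators.
cross-multiply : ∀ a b f h v w p H r s → ι a * s ≡ ι f → ι b * r ≡ ι h → ι p * (ι v * s - ι w * r) ≡ ι H →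
  a ℤ.* b ℤ.* H ≡ p ℤ.* (v ℤ.* (b ℤ.* f) ℤ.+ ℤ.- (w ℤ.* (a ℤ.* h)))
cross-multiply a b f h v w p H r s eq-a eq-b rel = ι-injective (begin
  ι (a ℤ.* b ℤ.* H)
    ≡⟨ trans (ι-* (a ℤ.* b) H) (cong₂ _*_ (ι-* a b) (sym rel)) ⟩
  ι a * ι b * (ι p * (ι v * s - ι w * r))
    ≡⟨ lem (ι a) (ι b) (ι p) (ι v) s (ι w) r ⟩
  ι p * (ι v * (ι b * (ι a * s)) - ι w * (ι a * (ι b * r)))
    ≡⟨ cong₂ (λ x y → ι p * (ι v * (ι b * x) - ι w * (ι a * y))) eq-a eq-b ⟩
  ι p * (ι v * (ι b * ι f) - ι w * (ι a * ι h))
    ≡⟨ cong₂ (λ x y → ι p * (x - y)) (trans (cong (ι v *_) (sym (ι-* b f))) (sym (ι-* v (b ℤ.* f)))) (trans (cong (ι w *_) (sym (ι-* a h))) (sym (ι-* w (a ℤ.* h)))) ⟩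
  ι p * (ι (v ℤ.* (b ℤ.* f)) - ι (w ℤ.* (a ℤ.* h)))
    ≡⟨ trans (cong (ι p *_) (sym (ι-∸ (v ℤ.* (b ℤ.* f)) (w ℤ.* (a ℤ.* h))))) (sym (ι-* p _)) ⟩
  ι (p ℤ.* (v ℤ.* (b ℤ.* f) ℤ.+ ℤ.- (w ℤ.* (a ℤ.* h)))) ∎)
  where
  open ≡-Reasoning
  lem : ∀ a b P v s w r → a * b * (P * (v * s - w * r)) ≡ P * (v * (b * (a * s)) - w * (a * (b * r)))
  lem = solve-∀ ℚ-ring

pow-0 : ∀ K → pow (suc K) (⁺ 0) ≡ ⁺ 0
pow-0 K = ℤₚ.*-zeroˡ (pow K (⁺ 0))

horner-0 : ∀ K c → horner (suc K) c (⁺ 0) ≡ c K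
horner-0 K c = ℤₚ.+-identityˡ (c K)

module Poles (v w : ℤ → ℤ) (v-cong : Cong v) (w-cong : Cong w) (w≢0 : ∀ n → w (⁺ suc n) ≢ ⁺ 0) (r : ℕ → ℚ) (n₁ : ℕ) where

  Relation : ℕ → (ℕ → ℤ) → Set
  Relation K c = ∀ n → n₁ ≤ n → principal K c (suc n) ≡ ι (v (⁺ suc n)) * r (suc n) - ι (w (⁺ suc n)) * r n

  -- Solving the relation for r n, regularity at m + 1 gives regularity at m, as long as the pole m + 1 = 0 is not met.
  descend : ∀ K c → Relation K c → ∀ m → Regular (⁺ suc m) r → Regular (⁺ m) r
  descend K c rel m reg = record
    { den′ = λ x → h (x ℤ.+ ⁺ 1) ℤ.* (w (x ℤ.+ ⁺ 1) ℤ.* pow K (x ℤ.+ ⁺ 1))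
    ; num′ = λ x → pow K (x ℤ.+ ⁺ 1) ℤ.* (v (x ℤ.+ ⁺ 1) ℤ.* f (x ℤ.+ ⁺ 1)) ℤ.+ ℤ.- (h (x ℤ.+ ⁺ 1) ℤ.* horner K c (x ℤ.+ ⁺ 1))
    ; den-cong = Cong-shift (⁺ 1) (Cong-* den-cong (Cong-* w-cong (pow-cong K)))
    ; num-cong = Cong-shift (⁺ 1) (Cong-+ (Cong-* (pow-cong K) (Cong-* v-cong num-cong)) (Cong-neg (Cong-* den-cong (horner-cong K c))))
    ; den≢0 = subst (λ z → h z ℤ.* (w z ℤ.* pow K z) ≢ ⁺ 0) (sym (⁺-suc m)) (*-nonZero den≢0 (*-nonZero (w≢0 m) (pow-nonZero K m)))
    ; n₀ = n₁ ℕ.+ n₀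
    ; eq = λ n le → subst (λ z → ι (h z ℤ.* (w z ℤ.* pow K z)) * r n ≡ ι (pow K z ℤ.* (v z ℤ.* f z) ℤ.+ ℤ.- (h z ℤ.* horner K c z))) (sym (⁺-suc n))
        (eqn n (ℕₚ.≤-trans (ℕₚ.m≤m+n n₁ n₀) le) (ℕₚ.m≤n⇒m≤1+n (ℕₚ.≤-trans (ℕₚ.m≤n+m n₀ n₁) le)))
    }
    where
    open Regular reg renaming (den′ to h; num′ to f)
    eqn : ∀ n → n₁ ≤ n → n₀ ≤ suc n → let z = ⁺ suc n in
      ι (h z ℤ.* (w z ℤ.* pow K z)) * r n ≡ ι (pow K z ℤ.* (v z ℤ.* f z) ℤ.+ ℤ.- (h z ℤ.* horner K c z))
    eqn n le₁ le₀ = solve-for (h z) (w z) (pow K z) (v z) (f z) (horner K c z) (r n) (r (suc n)) (eq (suc n) le₀)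
      (trans (cong (ι (pow K z) *_) (sym (rel n le₁))) (principal-horner K c (suc n) (s≤s z≤n)))
      where z = ⁺ suc n

  descend-to-0 : ∀ K c → Relation K c → ∀ m → Regular (⁺ m) r → Regular (⁺ 0) r
  descend-to-0 K c rel zero    reg = reg
  descend-to-0 K c rel (suc m) reg = descend-to-0 K c rel m (descend K c rel m reg)

  -- At x = 0 the left side involves only r at 0 and at -1, both regular. After clearing
  -- denominators the side carrying x^{K+1} vanishes at 0, and the other is a nonzero multiple of
  -- the leading coefficient `c K`.
  top-vanishes : ∀ K c → Relation (suc K) c → Regular -[1+ 0 ] r → Regular (⁺ 0) r → c K ≡ ⁺ 0
  top-vanishes K c rel reg₋ reg₀ = c≡0
    where
    module p = Regular reg₋
    module q = Regular reg₀
    a b f h X : ℤ → ℤ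
    a = q.den′
    f = q.num′
    -- `b` and `h` represent r(z - 1), so regularity at -1 is read off at z = 0.
    b z = p.den′ (z ℤ.+ -[1+ 0 ])
    h z = p.num′ (z ℤ.+ -[1+ 0 ])
    X z = v z ℤ.* (b z ℤ.* f z) ℤ.+ ℤ.- (w z ℤ.* (a z ℤ.* h z))
    b-cong : Cong b
    b-cong = Cong-shift -[1+ 0 ] p.den-cong
    h-cong : Cong h
    h-cong = Cong-shift -[1+ 0 ] p.num-cong
    X-cong : Cong X
    X-cong = Cong-+ (Cong-* v-cong (Cong-* b-cong q.num-cong)) (Cong-neg (Cong-* w-cong (Cong-* q.den-cong h-cong)))
    agree : ∀ n → suc (n₁ ℕ.+ (p.n₀ ℕ.+ q.n₀)) ≤ n → a (⁺ n) ℤ.* b (⁺ n) ℤ.* horner (suc K) c (⁺ n) ≡ pow (suc K) (⁺ n) ℤ.* X (⁺ n)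
    agree (suc n) (s≤s le) = cross-multiply (a z) (b z) (f z) (h z) (v z) (w z) (pow (suc K) z) (horner (suc K) c z) (r n) (r (suc n))
      (q.eq (suc n) le₀) (p.eq n le₋)
      (trans (cong (ι (pow (suc K) z) *_) (sym (rel n le₁))) (principal-horner (suc K) c (suc n) (s≤s z≤n)))
      where
      z = ⁺ suc n
      le₁ = ℕₚ.≤-trans (ℕₚ.m≤m+n n₁ _) le
      le₋ = ℕₚ.≤-trans (ℕₚ.m≤m+n p.n₀ q.n₀) (ℕₚ.≤-trans (ℕₚ.m≤n+m _ n₁) le)
      le₀ = ℕₚ.m≤n⇒m≤1+n (ℕₚ.≤-trans (ℕₚ.m≤n+m q.n₀ p.n₀) (ℕₚ.≤-trans (ℕₚ.m≤n+m _ n₁) le))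
    at-0 : a (⁺ 0) ℤ.* b (⁺ 0) ℤ.* horner (suc K) c (⁺ 0) ≡ pow (suc K) (⁺ 0) ℤ.* X (⁺ 0)
    at-0 = Cong-agree {λ z → a z ℤ.* b z ℤ.* horner (suc K) c z} {λ z → pow (suc K) z ℤ.* X z}
      (Cong-* (Cong-* q.den-cong b-cong) (horner-cong (suc K) c)) (Cong-* (pow-cong (suc K)) X-cong) _ agree
    simplify : ∀ m H C P X → m ℤ.* H ≡ P ℤ.* X → H ≡ C → P ≡ ⁺ 0 → m ℤ.* C ≡ ⁺ 0
    simplify m H C P X e refl refl = trans e (ℤₚ.*-zeroˡ X)
    c≡0 : c K ≡ ⁺ 0
    c≡0 = cancel-nonZero (a (⁺ 0) ℤ.* b (⁺ 0)) (c K) (*-nonZero {a (⁺ 0)} {b (⁺ 0)} q.den≢0 p.den≢0)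
      (simplify (a (⁺ 0) ℤ.* b (⁺ 0)) (horner (suc K) c (⁺ 0)) (c K) (pow (suc K) (⁺ 0)) (X (⁺ 0)) at-0 (horner-0 K c) (pow-0 K))

  -- Once the top coefficient is known to vanish, the relation holds with a shorter principal part.
  no-pole : ∀ K c → Relation K c → Regular -[1+ 0 ] r → ∀ m → Regular (⁺ m) r → ∀ k → k < K → c k ≡ ⁺ 0
  no-pole (suc K) c rel reg₋ m reg k k<K = below (ℕₚ.m≤n⇒m<n∨m≡n (ℕₚ.≤-pred k<K))
    where
    cK≡0 : c K ≡ ⁺ 0
    cK≡0 = top-vanishes K c rel reg₋ (descend-to-0 (suc K) c rel m reg)
    lem : ∀ a b → a ≡ a + 0ℚ * b
    lem = solve-∀ ℚ-ring
    rel′ : Relation K c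
    rel′ n le = trans (trans (lem (principal K c (suc n)) (recip (suc n ℕ.^ suc K))) (cong (λ z → principal K c (suc n) + z * recip (suc n ℕ.^ suc K)) (trans (sym ι-0) (cong ι (sym cK≡0))))) (rel n le)
    below : k < K ⊎ k ≡ K → c k ≡ ⁺ 0
    below (inj₁ k<K′) = no-pole K c rel′ reg₋ m reg k k<K′
    below (inj₂ refl) = cK≡0

-- Linear independence of the sums σ

-- Compositions are indexed by reversed lists, with entries shifted by 1 (the first entry of the
-- composition by 2) so that every list of naturals indexes an admissible composition.
exponent : List ℕ → ℕ → ℕ
exponent []      k = suc (suc k)
exponent (_ ∷ _) k = suc k

toComp : List ℕ → Comp
toComp []      = []
toComp (k ∷ b) = toComp b ++ exponent b k ∷ []

toComp-injective : ∀ i j → toComp i ≡ toComp j → i ≡ j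
toComp-injective []      []      eq = refl
toComp-injective []      (l ∷ c) eq = ⊥-elim (nil≢snoc (toComp c) eq)
  where
  nil≢snoc : ∀ {A : Set} (x : List A) {y} → [] ≢ x ++ y ∷ []
  nil≢snoc []      ()
  nil≢snoc (_ ∷ _) ()
toComp-injective (k ∷ b) []      eq = sym (toComp-injective [] (k ∷ b) (sym eq))
toComp-injective (k ∷ b) (l ∷ c) eq with Lₚ.∷ʳ-injective (toComp b) (toComp c) eq
... | eq₁ , eq₂ with toComp-injective b c eq₁
... | refl = cong (_∷ b) (exponent-injective b eq₂)
  where
  exponent-injective : ∀ b {k l} → exponent b k ≡ exponent b l → k ≡ l
  exponent-injective []      refl = refl
  exponent-injective (_ ∷ _) refl = refl

index : ∀ {b} → Admissible b → Σ (List ℕ) λ i → toComp i ≡ b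
index adm-[] = [] , refl
index {suc (suc a) ∷ as} (adm-∷ (s≤s (s≤s _)) p) = go (a ∷ []) (λ ()) p
  where
  go : ∀ i → i ≢ [] → ∀ {as} → Positive as → Σ (List ℕ) λ j → toComp j ≡ toComp i ++ as
  go i ne [] = i , sym (Lₚ.++-identityʳ (toComp i))
  go [] ne (_ ∷ _) = ⊥-elim (ne refl)
  go i@(_ ∷ _) ne {suc k ∷ as} (_ ∷ p) with go (k ∷ i) (λ ()) p
  ... | j , eq = j , trans eq (Lₚ.++-assoc (toComp i) (suc k ∷ []) as)

σᵢ : List ℕ → ℕ → ℕ → ℚ
σᵢ b = σ (toComp b)

-- Reversal puts the entry of the smallest summation index at the head, so the tail recursion
-- removes a cons.
σᵢ-suc : ∀ k b n N → suc n ≤ N → σᵢ (k ∷ b) n N ≡ recip (suc n ℕ.^ exponent b k) * σᵢ b (suc n) N + σᵢ (k ∷ b) (suc n) N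
σᵢ-suc k b n N = Z-snoc-suc central (toComp b) (exponent b k) n

-- 4x − 2, from C(2n,n) = ((4n−2)/n) C(2n−2,n−1)
ω : ℤ → ℤ
ω x = (x ℤ.+ (x ℤ.+ -[1+ 0 ])) ℤ.+ (x ℤ.+ (x ℤ.+ -[1+ 0 ]))

ι-ω : ∀ n → ι (ω (⁺ suc n)) ≡ (ν (suc n) + ν n) + (ν (suc n) + ν n)
ι-ω n = trans (ι-+ (⁺ suc n ℤ.+ ⁺ n) (⁺ suc n ℤ.+ ⁺ n)) (cong₂ _+_ (ι-+ (⁺ suc n) (⁺ n)) (ι-+ (⁺ suc n) (⁺ n)))

-- The multiplier in passing from n - 1 to n: non-empty sums change by a summand, the depth 0
-- function by the factor (4n - 2)/n.
u : List ℕ → ℕ → ℚ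
u []      n = ι (ω (⁺ n)) * recip n
u (_ ∷ _) n = 1ℚ

central-u : ∀ n → central n ≡ u [] (suc n) * central (suc n)
central-u n = ν-cancel {suc n} (s≤s z≤n) (begin
  ν (suc n) * central n                                                     ≡⟨ central-suc n ⟩
  (ν n + ν (suc n)) * (c + c)                                               ≡⟨ lem₁ (ν n) (ν (suc n)) c ⟩
  1ℚ * ((ν (suc n) + ν n) + (ν (suc n) + ν n)) * c                          ≡⟨ cong₂ (λ x y → x * y * c) (recip-inverse (suc n) (s≤s z≤n)) (ι-ω n) ⟨
  ν (suc n) * recip (suc n) * ι (ω (⁺ suc n)) * c                           ≡⟨ lem₂ (ν (suc n)) (recip (suc n)) (ι (ω (⁺ suc n))) c ⟩
  ν (suc n) * (ι (ω (⁺ suc n)) * recip (suc n) * c)                         ∎)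
  where
  open ≡-Reasoning
  c = central (suc n)
  lem₁ : ∀ m n c → (m + n) * (c + c) ≡ 1ℚ * ((n + m) + (n + m)) * c
  lem₁ = solve-∀ ℚ-ring
  lem₂ : ∀ n r w c → n * r * w * c ≡ n * (w * r * c)
  lem₂ = solve-∀ ℚ-ring

sumTo-cong : ∀ K {f g : ℕ → ℚ} → (∀ k → k < K → f k ≡ g k) → sumTo K f ≡ sumTo K g
sumTo-cong zero    eq = refl
sumTo-cong (suc K) eq = cong₂ _+_ (sumTo-cong K (λ k k<K → eq k (ℕₚ.m<n⇒m<1+n k<K))) (eq K ℕₚ.≤-refl)

sumTo-+ : ∀ K (f g : ℕ → ℚ) → sumTo K (λ k → f k + g k) ≡ sumTo K f + sumTo K g
sumTo-+ zero    f g = refl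
sumTo-+ (suc K) f g = trans (cong (_+ (f K + g K)) (sumTo-+ K f g)) (lem (sumTo K f) (sumTo K g) (f K) (g K))
  where
  lem : ∀ a b c d → a + b + (c + d) ≡ (a + c) + (b + d)
  lem = solve-∀ ℚ-ring

sumTo-scale : ∀ K c (f : ℕ → ℚ) → sumTo K (λ k → c * f k) ≡ c * sumTo K f
sumTo-scale zero    c f = sym (ℚₚ.*-zeroʳ c)
sumTo-scale (suc K) c f = trans (cong (_+ c * f K) (sumTo-scale K c f)) (sym (ℚₚ.*-distribˡ-+ c (sumTo K f) (f K)))

sumTo-zero : ∀ K {f : ℕ → ℚ} → (∀ k → k < K → f k ≡ 0ℚ) → sumTo K f ≡ 0ℚ
sumTo-zero zero    eq = refl
sumTo-zero (suc K) eq = cong₂ _+_ (sumTo-zero K (λ k k<K → eq k (ℕₚ.m<n⇒m<1+n k<K))) (eq K ℕₚ.≤-refl)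

sumTo-single : ∀ K {f : ℕ → ℚ} {k₀} → k₀ < K → (∀ k → k ≢ k₀ → f k ≡ 0ℚ) → sumTo K f ≡ f k₀
sumTo-single (suc K) {f} {k₀} k₀<K eq with ℕₚ.m≤n⇒m<n∨m≡n (ℕₚ.≤-pred k₀<K)
... | inj₁ lt   = trans (cong₂ _+_ (sumTo-single K lt eq) (eq K (λ e → ℕₚ.<-irrefl (sym e) lt))) (ℚₚ.+-identityʳ (f k₀))
... | inj₂ refl = trans (cong (_+ f K) (sumTo-zero K (λ k k<K → eq k (λ e → ℕₚ.<-irrefl e k<K)))) (ℚₚ.+-identityˡ (f K))

ω-poly : Poly 8 ω
ω-poly = Poly-+ p p
  where
  p : Poly 4 (λ x → x ℤ.+ (x ℤ.+ -[1+ 0 ]))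
  p = Poly-+ Poly-id (Poly-shift {f = λ x → x} -[1+ 0 ] Poly-id)

Poly-mono : ∀ {d e f} → d ≤ e → Poly d f → Poly e f
Poly-mono d≤e (poly c p) = poly c (Deg-mono d≤e p)

Rat-u : Rat u
Rat-u = Rat-ext 1 eq (Rat-* (Rat-poly num num-poly) Rat-recip)
  where
  -- The multiplier 1 is written as n/n, to share the denominator of (4n - 2)/n.
  num : List ℕ → ℤ → ℤ
  num []      = ω
  num (_ ∷ _) = λ x → x
  num-poly : ∀ b → Poly 8 (num b)
  num-poly []      = ω-poly
  num-poly (_ ∷ _) = Poly-mono (s≤s (s≤s z≤n)) Poly-id
  eq : ∀ b n → 1 ≤ n → ι (num b (⁺ n)) * recip n ≡ u b n
  eq []      n 1≤n = refl
  eq (_ ∷ _) n 1≤n = recip-inverse n 1≤n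

Rat-exponent : ∀ k → Rat (λ b n → recip (n ℕ.^ exponent b k))
Rat-exponent k = Rat-ext 1 eq (Rat-* (Rat-poly num num-poly) (Rat-recip-^ (suc (suc k))))
  where
  num : List ℕ → ℤ → ℤ
  num []      = λ _ → ⁺ 1
  num (_ ∷ _) = λ x → x
  num-poly : ∀ b → Poly 2 (num b)
  num-poly []      = Poly-mono (s≤s z≤n) (Poly-const (⁺ 1))
  num-poly (_ ∷ _) = Poly-id
  eq : ∀ b n → 1 ≤ n → ι (num b (⁺ n)) * recip (n ℕ.^ suc (suc k)) ≡ recip (n ℕ.^ exponent b k)
  eq []      n 1≤n = trans (cong (_* recip (n ℕ.^ suc (suc k))) ι-1) (ℚₚ.*-identityˡ _)
  eq (_ ∷ _) n 1≤n = trans (cong (ν n *_) (recip-* n (n ℕ.^ suc k)))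
    (trans (sym (ℚₚ.*-assoc (ν n) (recip n) (recip (n ℕ.^ suc k)))) (trans (cong (_* recip (n ℕ.^ suc k)) (recip-inverse n 1≤n)) (ℚₚ.*-identityˡ _)))

-- Cuts off the extensions `k ∷ b` that would leave the range of lengths at most d.
χ : ℕ → List ℕ → ℤ
χ d b = if length b <ᵇ d then ⁺ 1 else ⁺ 0

χ-below : ∀ {d b} → length b < d → χ d b ≡ ⁺ 1
χ-below {d} {b} lt with length b <ᵇ d | ℕₚ.<⇒<ᵇ lt
... | true | _ = refl

χ-above : ∀ {d b} → d ≤ length b → χ d b ≡ ⁺ 0
χ-above {d} {b} le with length b <ᵇ d in eq
... | false = refl
... | true  = ⊥-elim (ℕₚ.<⇒≱ (ℕₚ.<ᵇ⇒< (length b) d (subst T (sym eq) _)) le)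

-- Finite boxes of indices and the induction on depth

module Box (K : ℕ) where

  Small : List ℕ → Set
  Small = All (_< K)

  -- Non-empty lists are grouped by their tails, which is the grouping that `derive` needs.
  Tot : ℕ → (List ℕ → ℚ) → ℚ
  Tot zero    F = F []
  Tot (suc d) F = F [] + Tot d (λ b → sumTo K (λ k → F (k ∷ b)))

  Tot-cong : ∀ d {F G} → (∀ b → length b ≤ d → Small b → F b ≡ G b) → Tot d F ≡ Tot d G
  Tot-cong zero    eq = eq [] z≤n []
  Tot-cong (suc d) eq = cong₂ _+_ (eq [] z≤n []) (Tot-cong d (λ b le sm → sumTo-cong K (λ k k<K → eq (k ∷ b) (s≤s le) (k<K ∷ sm))))

  Tot-+ : ∀ d F G → Tot d (λ b → F b + G b) ≡ Tot d F + Tot d G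
  Tot-+ zero    F G = refl
  Tot-+ (suc d) F G = trans
    (cong (λ x → F [] + G [] + x) (trans (Tot-cong d (λ b _ _ → sumTo-+ K (λ k → F (k ∷ b)) (λ k → G (k ∷ b)))) (Tot-+ d F′ G′)))
    (lem (F []) (G []) (Tot d F′) (Tot d G′))
    where
    F′ = λ b → sumTo K (λ k → F (k ∷ b))
    G′ = λ b → sumTo K (λ k → G (k ∷ b))
    lem : ∀ a b c d → a + b + (c + d) ≡ (a + c) + (b + d)
    lem = solve-∀ ℚ-ring

  Tot-scale : ∀ d c F → Tot d (λ b → c * F b) ≡ c * Tot d F
  Tot-scale zero    c F = refl
  Tot-scale (suc d) c F = trans
    (cong (λ x → c * F [] + x) (trans (Tot-cong d (λ b _ _ → sumTo-scale K c (λ k → F (k ∷ b)))) (Tot-scale d c F′)))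
    (sym (ℚₚ.*-distribˡ-+ c (F []) (Tot d F′)))
    where
    F′ = λ b → sumTo K (λ k → F (k ∷ b))

  Tot-zero : ∀ d {F} → (∀ b → length b ≤ d → Small b → F b ≡ 0ℚ) → Tot d F ≡ 0ℚ
  Tot-zero zero    eq = eq [] z≤n []
  Tot-zero (suc d) eq = cong₂ _+_ (eq [] z≤n []) (Tot-zero d (λ b le sm → sumTo-zero K (λ k k<K → eq (k ∷ b) (s≤s le) (k<K ∷ sm))))

  Tot-single : ∀ d {F} i → length i ≤ d → Small i → (∀ b → b ≢ i → F b ≡ 0ℚ) → Tot d F ≡ F i
  Tot-single zero    []      _  _  eq = refl
  Tot-single (suc d) {F} [] _ _ eq = trans (cong (λ x → F [] + x) (Tot-zero d (λ b _ _ → sumTo-zero K (λ k _ → eq (k ∷ b) (λ ()))))) (ℚₚ.+-identityʳ (F []))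
  Tot-single (suc d) {F} (k ∷ i) (s≤s le) (k<K ∷ sm) eq = trans
    (cong₂ _+_ (eq [] (λ ()))
      (trans (Tot-single d i le sm (λ b b≢i → sumTo-zero K (λ l _ → eq (l ∷ b) (λ e → b≢i (Lₚ.∷-injectiveʳ e)))))
             (sumTo-single K {λ l → F (l ∷ i)} k<K (λ l l≢k → eq (l ∷ i) (λ e → l≢k (Lₚ.∷-injectiveˡ e))))))
    (ℚₚ.+-identityˡ (F (k ∷ i)))

  Tot-drop : ∀ d {F} → (∀ b → length b ≡ suc d → Small b → F b ≡ 0ℚ) → Tot (suc d) F ≡ Tot d F
  Tot-drop zero    {F} eq = trans (cong (λ x → F [] + x) (sumTo-zero K (λ k k<K → eq (k ∷ []) refl (k<K ∷ [])))) (ℚₚ.+-identityʳ (F []))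
  Tot-drop (suc d) {F} eq = cong (λ x → F [] + x) (Tot-drop d (λ b len sm → sumTo-zero K (λ k k<K → eq (k ∷ b) (cong suc len) (k<K ∷ sm))))

  -- The coefficients, with respect to σᵢ b n, of the difference between n − 1 and n of Σ_b R b n σᵢ b n
  -- over length b ≤ d; they are meaningful for n ≥ 1 only.
  derive : ℕ → (List ℕ → ℕ → ℚ) → List ℕ → ℕ → ℚ
  derive d R b n = u b n * R b (ℕ.pred n) - R b n + ι (χ d b) * sumTo K (λ k → R (k ∷ b) (ℕ.pred n) * recip (n ℕ.^ exponent b k))

  Rat-derive : ∀ d {R} → Rat R → Rat (derive d R)
  Rat-derive d r = Rat-+ (Rat-- (Rat-* Rat-u (Rat-shift r)) r)
    (Rat-* (Rat-const (χ d)) (Rat-sum K (λ k → Rat-* (Rat-shift (Rat-reindex (k ∷_) r)) (Rat-exponent k))))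

  combination : ℕ → (List ℕ → ℕ → ℚ) → ℕ → ℕ → ℚ
  combination d R n N = Tot d (λ b → R b n * σᵢ b n N)

  -- The summand that `σᵢ (k ∷ b)` sheds between n and n + 1 is a multiple of `σᵢ b`. It is recorded
  -- in `B` under `k ∷ b` and then collected as part of the coefficient of b.
  combination-derive : ∀ d R n N → suc n ≤ N →
    combination d (derive d R) (suc n) N ≡ combination d R n N - combination d R (suc n) N
  combination-derive d R n N n<N = sym (begin
    combination d R n N - combination d R (suc n) N
      ≡⟨ cong (_- combination d R (suc n) N) (trans (Tot-cong d (λ b _ _ → pointwise b)) (trans (Tot-+ d F₁ (λ b → A₁ b + B b)) (cong (λ x → Tot d F₁ + x) (Tot-+ d A₁ B)))) ⟩
    Tot d F₁ + (Tot d A₁ + Tot d B) - Tot d F₁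
      ≡⟨ lem₁ (Tot d F₁) (Tot d A₁ + Tot d B) ⟩
    Tot d A₁ + Tot d B
      ≡⟨ cong (λ x → Tot d A₁ + x) (children d) ⟩
    Tot d A₁ + Tot d (λ b → ι (χ d b) * H b)
      ≡⟨ Tot-+ d A₁ (λ b → ι (χ d b) * H b) ⟨
    Tot d (λ b → A₁ b + ι (χ d b) * H b)
      ≡⟨ Tot-cong d (λ b _ _ → collect b) ⟨
    combination d (derive d R) (suc n) N ∎)
    where
    open ≡-Reasoning
    F₁ A₁ B H : List ℕ → ℚ
    F₁ b = R b (suc n) * σᵢ b (suc n) N
    A₁ b = (u b (suc n) * R b n - R b (suc n)) * σᵢ b (suc n) N
    B []      = 0ℚ
    B (k ∷ b) = σᵢ b (suc n) N * (R (k ∷ b) n * recip (suc n ℕ.^ exponent b k))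
    H b = sumTo K (λ k → B (k ∷ b))
    lem₁ : ∀ a b → a + b - a ≡ b
    lem₁ = solve-∀ ℚ-ring
    pointwise : ∀ b → R b n * σᵢ b n N ≡ F₁ b + (A₁ b + B b)
    pointwise [] = trans (cong (R [] n *_) (central-u n)) (lem (R [] n) (R [] (suc n)) (u [] (suc n)) (central (suc n)))
      where
      lem : ∀ r r′ u c → r * (u * c) ≡ r′ * c + ((u * r - r′) * c + 0ℚ)
      lem = solve-∀ ℚ-ring
    pointwise (k ∷ b) = trans (cong (R (k ∷ b) n *_) (σᵢ-suc k b n N n<N)) (lem (R (k ∷ b) n) (R (k ∷ b) (suc n)) (recip (suc n ℕ.^ exponent b k)) (σᵢ b (suc n) N) (σᵢ (k ∷ b) (suc n) N))
      where
      lem : ∀ r r′ e s t → r * (e * s + t) ≡ r′ * t + ((1ℚ * r - r′) * t + s * (r * e))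
      lem = solve-∀ ℚ-ring
    collect : ∀ b → derive d R b (suc n) * σᵢ b (suc n) N ≡ A₁ b + ι (χ d b) * H b
    collect b = trans (lem (u b (suc n) * R b n - R b (suc n)) (ι (χ d b)) (sumTo K (λ k → R (k ∷ b) n * recip (suc n ℕ.^ exponent b k))) (σᵢ b (suc n) N))
      (cong (λ x → A₁ b + ι (χ d b) * x) (sym (sumTo-scale K (σᵢ b (suc n) N) (λ k → R (k ∷ b) n * recip (suc n ℕ.^ exponent b k)))))
      where
      lem : ∀ a x s t → (a + x * s) * t ≡ a * t + x * (t * s)
      lem = solve-∀ ℚ-ring
    children : ∀ d → Tot d B ≡ Tot d (λ b → ι (χ d b) * H b)
    children zero    = sym (trans (cong (_* H []) ι-0) (ℚₚ.*-zeroˡ (H [])))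
    children (suc d) = begin
      0ℚ + Tot d H                                ≡⟨ ℚₚ.+-identityˡ (Tot d H) ⟩
      Tot d H                                     ≡⟨ Tot-cong d (λ b le _ → trans (cong (_* H b) (trans (cong ι (χ-below {suc d} {b} (s≤s le))) ι-1)) (ℚₚ.*-identityˡ (H b))) ⟨
      Tot d (λ b → ι (χ (suc d) b) * H b)         ≡⟨ Tot-drop d (λ b len _ → trans (cong (_* H b) (trans (cong ι (χ-above {suc d} {b} (ℕₚ.≤-reflexive (sym len)))) ι-0)) (ℚₚ.*-zeroˡ (H b))) ⟨
      Tot (suc d) (λ b → ι (χ (suc d) b) * H b)   ∎

  Vanishing : ℕ → (List ℕ → ℕ → ℚ) → Set
  Vanishing d R = Σ ℕ λ n₀ → ∀ n → n₀ ≤ n → Null (combination d R n)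

  Vanishing-derive : ∀ d R → Vanishing d R → Vanishing d (derive d R)
  Vanishing-derive d R (n₀ , null) = suc n₀ , λ { (suc n) (s≤s le) →
    Null-ext (suc n) (λ N n<N → sym (combination-derive d R n N n<N)) (Null-- (null n le) (null (suc n) (ℕₚ.m≤n⇒m≤1+n le))) }

  Zero : ℕ → (List ℕ → ℕ → ℚ) → Set
  Zero d R = Σ ℕ λ n₁ → ∀ b → length b ≤ d → Small b → ∀ n → n₁ ≤ n → R b n ≡ 0ℚ

  Independent : ℕ → Set
  Independent d = ∀ R → Rat R → Vanishing d R → Zero d R

  independent-0 : Independent 0
  independent-0 R _ (n₀ , null) = n₀ , λ { [] _ _ n le → *-cancelˡ-pos (central-pos n)
    (trans (ℚₚ.*-comm (central n) (R [] n)) (trans (Null-const (null n le)) (sym (ℚₚ.*-zeroʳ (central n))))) }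
    where
    central-pos : ∀ n → 0ℚ ℚ.< central n
    central-pos n with binom n n | binom-pos n n
    ... | suc m | _ = recip-pos m

  module _ (d : ℕ) (ih : Independent d) where

    drop-top : ∀ R → Rat R → Vanishing (suc d) R → ∀ n₂ → (∀ b → length b ≡ suc d → Small b → ∀ n → n₂ ≤ n → R b n ≡ 0ℚ) → Zero (suc d) R
    drop-top R rat (n₀ , null) n₂ top≡0 = n₁ ℕ.+ n₂ , zero-at
      where
      lower : Zero d R
      lower = ih R rat (n₀ ℕ.+ n₂ , λ n le → Null-ext 0 (λ N _ → Tot-drop d (λ b len sm →
        trans (cong (_* σᵢ b n N) (top≡0 b len sm n (ℕₚ.≤-trans (ℕₚ.m≤n+m n₂ n₀) le))) (ℚₚ.*-zeroˡ (σᵢ b n N))))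
        (null n (ℕₚ.≤-trans (ℕₚ.m≤m+n n₀ n₂) le)))
      n₁ = proj₁ lower
      zero-at : ∀ b → length b ≤ suc d → Small b → ∀ n → n₁ ℕ.+ n₂ ≤ n → R b n ≡ 0ℚ
      zero-at b le sm n n≥ with ℕₚ.m≤n⇒m<n∨m≡n le
      ... | inj₁ lt = proj₂ lower b (ℕₚ.≤-pred lt) sm n (ℕₚ.≤-trans (ℕₚ.m≤m+n n₁ n₂) n≥)
      ... | inj₂ eq = top≡0 b eq sm n (ℕₚ.≤-trans (ℕₚ.m≤n+m n₂ n₁) n≥)

    TopDegree : ℕ → (List ℕ → ℕ → ℚ) → Set
    TopDegree e R = Σ ℕ λ n₂ → ∀ b → length b ≡ suc d → Σ (ℤ → ℤ) λ f → Deg e f × (∀ n → n₂ ≤ n → R b n ≡ ι (f (⁺ n)))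

    -- At maximal length the list is non-empty, so the multiplier is 1, and χ removes all
    -- extensions: only the plain difference remains, which lowers the degree.
    derive-top : ∀ R b n → length b ≡ suc d → derive (suc d) R b (suc n) ≡ R b n - R b (suc n)
    derive-top R b@(k ∷ _) n len = trans
      (cong (λ z → 1ℚ * R b n - R b (suc n) + z * S) (trans (cong ι (χ-above {suc d} {b} (ℕₚ.≤-reflexive (sym len)))) ι-0))
      (lem (R b n) (R b (suc n)) S)
      where
      S = sumTo K (λ l → R (l ∷ b) n * recip (suc n ℕ.^ exponent b l))
      lem : ∀ x y s → 1ℚ * x - y + 0ℚ * s ≡ x - y
      lem = solve-∀ ℚ-ring

    TopDegree-derive : ∀ e R → TopDegree (suc e) R → TopDegree e (derive (suc d) R)
    TopDegree-derive e R (n₂ , top) = suc n₂ , λ b len → Δ (proj₁ (top b len)) , proj₁ (proj₂ (top b len)) ,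
      λ { (suc n) (s≤s le) → trans (derive-top R b n len) (trans
        (cong₂ _-_ (proj₂ (proj₂ (top b len)) n le) (proj₂ (proj₂ (top b len)) (suc n) (ℕₚ.m≤n⇒m≤1+n le)))
        (sym (ι-∸ (proj₁ (top b len) (⁺ n)) (proj₁ (top b len) (⁺ suc n))))) }

    -- Induction on e, applied to the derived relation: its coefficients all vanish for large n. At
    -- length d + 1 this makes the coefficients of R eventually constant; at length d it gives
    -- `balance`.
    independent-top : ∀ e R → Rat R → TopDegree e R → Vanishing (suc d) R → Zero (suc d) R
    independent-top zero R rat (n₂ , top) van = drop-top R rat van n₂
      (λ b len _ n le → trans (proj₂ (proj₂ (top b len)) n le) (trans (cong ι (proj₁ (proj₂ (top b len)) (⁺ n))) ι-0))
    independent-top (suc e) R rat (n₂ , top) van = drop-top R rat van n₃ top≡0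
      where
      open ≡-Reasoning
      derived : Zero (suc d) (derive (suc d) R)
      derived = independent-top e (derive (suc d) R) (Rat-derive (suc d) rat) (TopDegree-derive e R (n₂ , top)) (Vanishing-derive (suc d) R van)
      n₃ = proj₁ derived ℕ.+ n₂
      derived≡0 : ∀ b → length b ≤ suc d → Small b → ∀ n → n₃ ≤ n → derive (suc d) R b (suc n) ≡ 0ℚ
      derived≡0 b le sm n n≥ = proj₂ derived b le sm (suc n) (ℕₚ.m≤n⇒m≤1+n (ℕₚ.≤-trans (ℕₚ.m≤m+n _ n₂) n≥))
      value : ∀ b → length b ≡ suc d → ℤ
      value b len = proj₁ (top b len) (⁺ n₃)
      constant : ∀ b (len : length b ≡ suc d) → Small b → ∀ m → R b (m ℕ.+ n₃) ≡ ι (value b len)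
      constant b len sm zero    = proj₂ (proj₂ (top b len)) n₃ (ℕₚ.m≤n+m n₂ _)
      constant b len sm (suc m) = begin
        R b (suc (m ℕ.+ n₃))                                            ≡⟨ lem (R b (m ℕ.+ n₃)) (R b (suc (m ℕ.+ n₃))) ⟩
        R b (m ℕ.+ n₃) - (R b (m ℕ.+ n₃) - R b (suc (m ℕ.+ n₃)))         ≡⟨ cong (λ z → R b (m ℕ.+ n₃) - z) (trans (sym (derive-top R b (m ℕ.+ n₃) len)) (derived≡0 b (ℕₚ.≤-reflexive len) sm (m ℕ.+ n₃) (ℕₚ.m≤n+m n₃ m))) ⟩
        R b (m ℕ.+ n₃) - 0ℚ                                             ≡⟨ ℚₚ.+-identityʳ _ ⟩
        R b (m ℕ.+ n₃)                                                  ≡⟨ constant b len sm m ⟩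
        ι (value b len)                                                 ∎
        where
        lem : ∀ x y → y ≡ x - (x - y)
        lem = solve-∀ ℚ-ring
      constant′ : ∀ b (len : length b ≡ suc d) → Small b → ∀ n → n₃ ≤ n → R b n ≡ ι (value b len)
      constant′ b len sm n le = trans (cong (R b) (sym (ℕₚ.m∸n+n≡m le))) (constant b len sm (n ∸ n₃))
      module _ (b : List ℕ) (len : length b ≡ d) (sm : Small b) where
        c : ℕ → ℤ
        c k = value (k ∷ b) (cong suc len)
        S : ℕ → ℚ
        S n = sumTo K (λ k → ι (c k) * recip (suc n ℕ.^ exponent b k))
        balance : ∀ n → n₃ ≤ n → S n ≡ R b (suc n) - u b (suc n) * R b n
        balance n le = begin
          S n                                                     ≡⟨ sumTo-cong K (λ k k<K → cong (_* recip (suc n ℕ.^ exponent b k)) (constant′ (k ∷ b) (cong suc len) (k<K ∷ sm) n le)) ⟨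
          S′                                                      ≡⟨ lem (u b (suc n) * R b n) (R b (suc n)) S′ ⟩
          (u b (suc n) * R b n - R b (suc n) + 1ℚ * S′) + (R b (suc n) - u b (suc n) * R b n)
            ≡⟨ cong (λ z → (u b (suc n) * R b n - R b (suc n) + z * S′) + (R b (suc n) - u b (suc n) * R b n)) (trans (cong ι (χ-below {suc d} {b} (s≤s (ℕₚ.≤-reflexive len)))) ι-1) ⟨
          derive (suc d) R b (suc n) + (R b (suc n) - u b (suc n) * R b n)
            ≡⟨ cong (_+ (R b (suc n) - u b (suc n) * R b n)) (derived≡0 b (ℕₚ.m≤n⇒m≤1+n (ℕₚ.≤-reflexive len)) sm n le) ⟩
          0ℚ + (R b (suc n) - u b (suc n) * R b n)                ≡⟨ ℚₚ.+-identityˡ _ ⟩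
          R b (suc n) - u b (suc n) * R b n                       ∎
          where
          S′ = sumTo K (λ k → R (k ∷ b) n * recip (suc n ℕ.^ exponent b k))
          lem : ∀ x y s → s ≡ (x - y + 1ℚ * s) + (y - x)
          lem = solve-∀ ℚ-ring
      -- `R b` is regular at -1, because its poles are natural numbers, and at `poles L`, which lies
      -- beyond all of them; these are the two ends of the pole count.
      values≡0 : ∀ b (len : length b ≡ d) (sm : Small b) k → k < K → c b len sm k ≡ ⁺ 0
      values≡0 [] len sm = P.no-pole K (c [] len sm) relation (Rat⇒Regular rat [] -[1+ 0 ] (den-neg (Rat.L rat)))
        (poles (Rat.L rat)) (Rat⇒Regular rat [] _ (den-large (Rat.L rat) _ ℕₚ.≤-refl))
        where
        module P = Poles (λ x → x) ω Cong-id (Poly.isCong ω-poly) (λ n ()) (R []) n₃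
        relation : P.Relation K (c [] len sm)
        relation n le = begin
          -- Multiplying by x = n + 1 clears the denominator of `u []` and turns the exponents k + 2
          -- of a first entry into the k + 1 of `principal`.
          principal K (c [] len sm) (suc n)                      ≡⟨ sumTo-cong K (λ k _ → shift k) ⟩
          sumTo K (λ k → ν (suc n) * (ι (c [] len sm k) * recip (suc n ℕ.^ suc (suc k)))) ≡⟨ sumTo-scale K (ν (suc n)) _ ⟩
          ν (suc n) * S [] len sm n                              ≡⟨ cong (ν (suc n) *_) (balance [] len sm n le) ⟩
          ν (suc n) * (R [] (suc n) - ι (ω (⁺ suc n)) * recip (suc n) * R [] n) ≡⟨ lem (ν (suc n)) (R [] (suc n)) (ι (ω (⁺ suc n))) (recip (suc n)) (R [] n) ⟩
          ν (suc n) * R [] (suc n) - ι (ω (⁺ suc n)) * (ν (suc n) * recip (suc n)) * R [] n ≡⟨ cong (λ z → ν (suc n) * R [] (suc n) - z * R [] n) (trans (cong (ι (ω (⁺ suc n)) *_) (recip-inverse (suc n) (s≤s z≤n))) (ℚₚ.*-identityʳ (ι (ω (⁺ suc n))))) ⟩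
          ν (suc n) * R [] (suc n) - ι (ω (⁺ suc n)) * R [] n    ∎
          where
          lem : ∀ v r w e t → v * (r - w * e * t) ≡ v * r - w * (v * e) * t
          lem = solve-∀ ℚ-ring
          lem₂ : ∀ c r → c * r ≡ 1ℚ * (c * r)
          lem₂ = solve-∀ ℚ-ring
          lem₃ : ∀ v e c r → v * e * (c * r) ≡ v * (c * (e * r))
          lem₃ = solve-∀ ℚ-ring
          shift : ∀ k → ι (c [] len sm k) * recip (suc n ℕ.^ suc k) ≡ ν (suc n) * (ι (c [] len sm k) * recip (suc n ℕ.^ suc (suc k)))
          shift k = trans (lem₂ (ι (c [] len sm k)) (recip (suc n ℕ.^ suc k))) (trans (cong (_* (ι (c [] len sm k) * recip (suc n ℕ.^ suc k))) (sym (recip-inverse (suc n) (s≤s z≤n))))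
            (trans (lem₃ (ν (suc n)) (recip (suc n)) (ι (c [] len sm k)) (recip (suc n ℕ.^ suc k))) (cong (λ z → ν (suc n) * (ι (c [] len sm k) * z)) (sym (recip-* (suc n) (suc n ℕ.^ suc k))))))
      values≡0 b@(_ ∷ _) len sm = P.no-pole K (c b len sm) relation (Rat⇒Regular rat b -[1+ 0 ] (den-neg (Rat.L rat)))
        (poles (Rat.L rat)) (Rat⇒Regular rat b _ (den-large (Rat.L rat) _ ℕₚ.≤-refl))
        where
        module P = Poles (λ _ → ⁺ 1) (λ _ → ⁺ 1) (Cong-const (⁺ 1)) (Cong-const (⁺ 1)) (λ n ()) (R b) n₃
        relation : P.Relation K (c b len sm)
        relation n le = trans (balance b len sm n le) (trans (lem (R b (suc n)) (R b n)) (cong (λ z → z * R b (suc n) - z * R b n) (sym ι-1)))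
          where
          lem : ∀ x y → x - 1ℚ * y ≡ 1ℚ * x - 1ℚ * y
          lem = solve-∀ ℚ-ring
      top≡0 : ∀ b → length b ≡ suc d → Small b → ∀ n → n₃ ≤ n → R b n ≡ 0ℚ
      top≡0 (k ∷ b) refl (k<K ∷ sm) n le = trans (constant′ (k ∷ b) refl (k<K ∷ sm) n le) (trans (cong ι (values≡0 b refl sm k k<K)) ι-0)

    -- For fixed n, multiplying the relation by the common denominator at n keeps it null and turns
    -- the top coefficients into polynomials; beyond the poles the factor is nonzero and can be
    -- cancelled.
    independent-suc : Independent (suc d)
    independent-suc R rat (n₀′ , null) = proj₁ cleared ℕ.+ poles L , λ b le sm n n≥ →
      cancel b n (ℕₚ.≤-trans (ℕₚ.m≤n+m (poles L) _) n≥) (proj₂ cleared b le sm n (ℕₚ.≤-trans (ℕₚ.m≤m+n _ (poles L)) n≥))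
      where
      open Rat rat
      R̃ : List ℕ → ℕ → ℚ
      R̃ b n = ι (den L (⁺ n)) * R b n
      cleared : Zero (suc d) R̃
      cleared = independent-top e R̃ (Rat-* (Rat-poly (λ _ → den L) (λ _ → den-poly L)) rat)
        (n₀ , λ b _ → num b , Poly.isDeg (num-poly b) , eq b)
        (n₀′ , λ n le → Null-ext 0 (λ N _ → trans (sym (Tot-scale (suc d) (ι (den L (⁺ n))) (λ b → R b n * σᵢ b n N)))
          (Tot-cong (suc d) (λ b _ _ → sym (ℚₚ.*-assoc (ι (den L (⁺ n))) (R b n) (σᵢ b n N))))) (Null-scale (ι (den L (⁺ n))) (null n le)))
      cancel : ∀ b n → poles L ≤ n → R̃ b n ≡ 0ℚ → R b n ≡ 0ℚ
      cancel b n le eq₀ = begin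
        R b n                        ≡⟨ ℚₚ.*-identityˡ (R b n) ⟨
        1ℚ * R b n                   ≡⟨ cong (_* R b n) (ℚₚ.*-inverseˡ D) ⟨
        ℚ.1/ D * D * R b n           ≡⟨ ℚₚ.*-assoc (ℚ.1/ D) D (R b n) ⟩
        ℚ.1/ D * (D * R b n)         ≡⟨ cong (ℚ.1/ D *_) eq₀ ⟩
        ℚ.1/ D * 0ℚ                  ≡⟨ ℚₚ.*-zeroʳ (ℚ.1/ D) ⟩
        0ℚ                           ∎
        where
        open ≡-Reasoning
        D = ι (den L (⁺ n))
        instance
          D-nonZero : ℚ.NonZero D
          D-nonZero = ℚ.≢-nonZero (λ z → den-large L n le (ι-injective (trans z (sym ι-0))))

  independent : ∀ d → Independent d
  independent zero    = independent-0
  independent (suc d) = independent-suc d (independent d)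

-- Comparison of M and the kernel of δ

InBox : ℕ → ℕ → Comp → Set
InBox K D b = Σ (List ℕ) λ i → toComp i ≡ b × length i ≤ D × All (_< K) i

InBox-mono : ∀ {K K′ D D′ b} → K ≤ K′ → D ≤ D′ → InBox K D b → InBox K′ D′ b
InBox-mono K≤ D≤ (i , eq , len , sm) = i , eq , ℕₚ.≤-trans len D≤ , All.map (λ k<K → ℕₚ.≤-trans k<K K≤) sm

box : ∀ {b} → Admissible b → Σ ℕ λ K → Σ ℕ λ D → InBox K D b
box adm with index adm
... | i , eq = proj₁ (small i) , length i , i , eq , ℕₚ.≤-refl , proj₂ (small i)
  where
  small : ∀ i → Σ ℕ λ K → All (_< K) i
  small []      = 0 , []
  small (k ∷ i) with small i
  ... | K , sm = suc k ℕ.+ K , ℕₚ.m≤m+n (suc k) K ∷ All.map (λ lt → ℕₚ.≤-trans lt (ℕₚ.m≤n+m K (suc k))) sm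

boxes : ∀ {s} → AllKeys Admissible s → Σ ℕ λ K → Σ ℕ λ D → AllKeys (InBox K D) s
boxes [] = 0 , 0 , []
boxes (adm ∷ adms) with box adm | boxes adms
... | K , D , b | K′ , D′ , bs = K ℕ.+ K′ , D ℕ.+ D′ ,
  InBox-mono (ℕₚ.m≤m+n K K′) (ℕₚ.m≤m+n D D′) b ∷ All.map (InBox-mono (ℕₚ.m≤n+m K′ K) (ℕₚ.m≤n+m D′ D)) bs

-- Reduces a statement about all compositions to those in the box: any other has coefficient 0.
coeff-key : ∀ {P : Comp → Set} b s → AllKeys P s → coeff b s ≡ ⁺ 0 ⊎ P b
coeff-key b []             []       = inj₁ refl
coeff-key b ((c , b′) ∷ s) (p ∷ ps) with Lₚ.≡-dec ℕₚ._≟_ b b′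
... | yes refl = inj₂ p
... | no _ with coeff-key b s ps
...   | inj₁ eq = inj₁ (cong (λ z → ⁺ 0 ℤ.+ z) eq)
...   | inj₂ q  = inj₂ q

module _ (K D : ℕ) where
  open Box K

  coefficients : FSum → List ℕ → ℕ → ℚ
  coefficients s b _ = ι (coeff (toComp b) s)

  -- A formal sum may repeat a key; summing over the box replaces its list of terms by total
  -- coefficients.
  Φ-combination : ∀ s → AllKeys (InBox K D) s → ∀ n N → combination D (coefficients s) n N ≡ Φ s n N
  Φ-combination [] [] n N = Tot-zero D (λ b _ _ → trans (cong (_* σᵢ b n N) ι-0) (ℚₚ.*-zeroˡ (σᵢ b n N)))
  Φ-combination ((c , b′) ∷ s) ((i , refl , len , sm) ∷ ps) n N = begin
    combination D (coefficients ((c , b′) ∷ s)) n N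
      ≡⟨ Tot-cong D (λ b _ _ → trans (cong (_* σᵢ b n N) (ι-+ (indicator b) (coeff (toComp b) s))) (ℚₚ.*-distribʳ-+ (σᵢ b n N) (ι (indicator b)) (ι (coeff (toComp b) s)))) ⟩
    Tot D (λ b → ι (indicator b) * σᵢ b n N + ι (coeff (toComp b) s) * σᵢ b n N)
      ≡⟨ Tot-+ D (λ b → ι (indicator b) * σᵢ b n N) (λ b → ι (coeff (toComp b) s) * σᵢ b n N) ⟩
    Tot D (λ b → ι (indicator b) * σᵢ b n N) + combination D (coefficients s) n N
      ≡⟨ cong₂ _+_ (trans (Tot-single D i len sm off) (cong (λ z → ι z * σᵢ i n N) on)) (Φ-combination s ps n N) ⟩
    ι c * σᵢ i n N + Φ s n N ∎
    where
    open ≡-Reasoning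
    indicator : List ℕ → ℤ
    indicator b = if does (Lₚ.≡-dec ℕₚ._≟_ (toComp b) (toComp i)) then c else ⁺ 0
    on : indicator i ≡ c
    on = cong (λ t → if t then c else ⁺ 0) (dec-true (Lₚ.≡-dec ℕₚ._≟_ (toComp i) (toComp i)) refl)
    off : ∀ b → b ≢ i → ι (indicator b) * σᵢ b n N ≡ 0ℚ
    off b b≢i = trans (cong (λ t → ι (if t then c else ⁺ 0) * σᵢ b n N) (dec-false (Lₚ.≡-dec ℕₚ._≟_ (toComp b) (toComp i)) (λ e → b≢i (toComp-injective b i e))))
      (trans (cong (_* σᵢ b n N) ι-0) (ℚₚ.*-zeroˡ (σᵢ b n N)))

  Φ-null⇒coeff≡0 : ∀ s → AllKeys (InBox K D) s → (∀ n → Null (Φ s n)) → ∀ b → coeff b s ≡ ⁺ 0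
  Φ-null⇒coeff≡0 s bs null b = at b (coeff-key b s bs)
    where
    coefficients≡0 : Zero D (coefficients s)
    coefficients≡0 = independent D (coefficients s) (Rat-const (λ b → coeff (toComp b) s))
      (0 , λ n _ → Null-ext 0 (λ N _ → sym (Φ-combination s bs n N)) (null n))
    at : ∀ b → coeff b s ≡ ⁺ 0 ⊎ InBox K D b → coeff b s ≡ ⁺ 0
    at b (inj₁ eq)                     = eq
    at b (inj₂ (i , refl , len , sm))  = ι-injective (trans (proj₂ coefficients≡0 i len sm (proj₁ coefficients≡0) ℕₚ.≤-refl) (sym ι-0))

  coeff≡0⇒Φ≡0 : ∀ s → AllKeys (InBox K D) s → (∀ b → coeff b s ≡ ⁺ 0) → ∀ n N → Φ s n N ≡ 0ℚ
  coeff≡0⇒Φ≡0 s bs eq n N = trans (sym (Φ-combination s bs n N))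
    (Tot-zero D (λ b _ _ → trans (cong (_* σᵢ b n N) (trans (cong ι (eq (toComp b))) ι-0)) (ℚₚ.*-zeroˡ (σᵢ b n N))))

theorem19 : ∀ (ℓ : FSum) → AllAdmissible ℓ → (InM ℓ → InKerδ ℓ) × (InKerδ ℓ → InM ℓ)
theorem19 ℓ adm = M⇒ker , ker⇒M
  where
  K = proj₁ (boxes (δ-admissible adm))
  D = proj₁ (proj₂ (boxes (δ-admissible adm)))
  bs = proj₂ (proj₂ (boxes (δ-admissible adm)))
  lem₁ : ∀ x y → x - (x - y) ≡ y
  lem₁ = solve-∀ ℚ-ring
  lem₂ : ∀ x → x - 0ℚ ≡ x
  lem₂ = solve-∀ ℚ-ring
  M⇒ker : InM ℓ → InKerδ ℓ
  M⇒ker inM = Φ-null⇒coeff≡0 K D (δ ℓ) bs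
    (λ n → Null-ext 0 (λ N _ → lem₁ (ζpartL ℓ n N) (Φ (δ ℓ) n N)) (Null-- (inM n) (δ-expansion adm n)))
  -- Here `Φ (δ ℓ)` is zero at every truncation, so the expansion alone makes `ζpartL ℓ n` null.
  ker⇒M : InKerδ ℓ → InM ℓ
  ker⇒M ker n = Null-ext 0 (λ N _ → trans (cong (λ z → ζpartL ℓ n N - z) (coeff≡0⇒Φ≡0 K D (δ ℓ) bs ker n N)) (lem₂ (ζpartL ℓ n N))) (δ-expansion adm n)
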